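{- Let $m=m(n)$ be a function of $n$. (i) Suppose that $\frac{4n}{m}=\log n+\omega$, where $\omega=\omega(n)\rightarrow\infty$ as $n\rightarrow\infty$. Then asymptotically almost surely $G(n,m,2)$ is connected. (ii) Suppose that $\frac{4n}{m}=\log n-\omega$, where $\omega=\omega(n)\rightarrow\infty$ as $n\rightarrow\infty$. Then asymptotically almost surely $G(n,m,2)$ is not connected.
   Context: The uniform random intersection graph $G(n,m,k)$ (for positive integers $k\le m$) is the random graph on a set $V$ of $n$ nodes defined as follows: fix a set $M$ of $m$ colours; to each node $v\in V$ assign a subset $F_v\subseteq M$ of exactly $k$ distinct colours, chosen uniformly at random among all $k$-subsets of $M$, independently for different nodes; distinct nodes $u,v$ are joined by an edge if and only if $F_u\cap F_v\neq\emptyset$. Here $k=2$. An event holds asymptotically almost surely if its probability tends to $1$ as $n\rightarrow\infty$. Here $\log$ denotes the natural logarithm. -}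

module Defs where

open import Data.Fin.Base using (Fin; zero; suc)
import Data.Fin.Properties as Fin
open import Data.Fin.Subset using (Subset; inside; outside; ∣_∣; _∩_; Nonempty; ⊥)
open import Data.Fin.Subset.Properties using (nonempty?; ∣⊥∣≡0; ∩-comm)
import Data.Integer.Base as ℤ
import Data.Integer.Properties as ℤ
open import Data.List.Base
  using (List; []; _∷_; length; filter; cartesianProductWith; allFin)
open import Data.List.Membership.Propositional using (_∈_)
open import Data.List.Membership.Propositional.Properties
  using (∈-cartesianProductWith⁺; ∈-filter⁺; ∈-allFin; ∈-length)
open import Data.List.Relation.Unary.Any using (here; there)
open import Data.Nat.Base as ℕ using (ℕ; zero; suc; z≤n; s≤s; s≤s⁻¹; NonZero)
import Data.Nat.Properties as ℕ
open import Data.Product.Base using (Σ; ∃; _×_; _,_; proj₁; proj₂)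
open import Data.Rational.Base as ℚ using (ℚ; 0ℚ; 1ℚ; toℚᵘ)
import Data.Rational.Properties as ℚ
import Data.Rational.Solver as ℚSolver
open import Data.Rational.Unnormalised.Base as ℚᵘ using (ℚᵘ; mkℚᵘ)
import Data.Rational.Unnormalised.Properties as ℚᵘ
open import Data.Sum.Base using (_⊎_; inj₁; inj₂)
open import Data.Vec.Base as Vec using (Vec; []; _∷_; lookup)
open import Data.Vec.Properties using (lookup-replicate)
open import Function.Base using (_∘_)
open import Level using (0ℓ)
open import Relation.Binary.Construct.Closure.ReflexiveTransitive
  using (Star; ε; _◅_; _◅◅_)
open import Relation.Binary.Core using (Rel)
import Relation.Binary.Definitions as B
open import Relation.Binary.PropositionalEquality
open import Relation.Nullary using (¬_; Dec; yes; no)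
open import Relation.Nullary.Decidable using (_×-dec_; _⊎-dec_; ¬?; map′)
open import Relation.Unary using (Pred; Decidable)

-- Bishop's regular sequences.  Entry k of a sequence is Bishop's
-- entry k + 1, so that it approximates the real to within 1 / (k + 1).

inv : ℕ → ℚ
inv k = ℤ.+ 1 ℚ./ suc k

record ℝ : Set where
  constructor mkℝ
  field
    seq     : ℕ → ℚ
    regular : ∀ j k → ℚ.∣ seq j ℚ.- seq k ∣ ℚ.≤ inv j ℚ.+ inv k

open ℝ public

-- Bishop's equality and (non-strict) order, as bounds on approximations.
infix 4 _≃ᴿ_ _≤ᴿ_

_≃ᴿ_ : Rel ℝ 0ℓ
x ≃ᴿ y = ∀ k → ℚ.∣ seq x k ℚ.- seq y k ∣ ℚ.≤ inv k ℚ.+ inv k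

_≤ᴿ_ : Rel ℝ 0ℓ
x ≤ᴿ y = ∀ k → seq x k ℚ.≤ seq y k ℚ.+ (inv k ℚ.+ inv k)

inv-ᵘ : ∀ k → toℚᵘ (inv k) ℚᵘ.≃ mkℚᵘ (ℤ.+ 1) k
inv-ᵘ k = ℚ.toℚᵘ-fromℚᵘ (mkℚᵘ (ℤ.+ 1) k)

0≤inv : ∀ k → 0ℚ ℚ.≤ inv k
0≤inv k = ℚ.nonNegative⁻¹ (inv k) {{ℚ.normalize-nonNeg 1 (suc k)}}

inv-antimono : ∀ {j k} → j ℕ.≤ k → inv k ℚ.≤ inv j
inv-antimono {j} {k} j≤k = ℚ.toℚᵘ-cancel-≤ (begin
  toℚᵘ (inv k)       ≃⟨ inv-ᵘ k ⟩
  mkℚᵘ (ℤ.+ 1) k     ≤⟨ ℚᵘ.*≤* (ℤ.*-monoˡ-≤-nonNeg (ℤ.+ 1) (ℤ.+≤+ (s≤s j≤k))) ⟩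
  mkℚᵘ (ℤ.+ 1) j     ≃⟨ inv-ᵘ j ⟨
  toℚᵘ (inv j)       ∎)
  where open ℚᵘ.≤-Reasoning

fromℕ : ℕ → ℚ
fromℕ n = ℤ.+ n ℚ./ 1

fromℕ-ᵘ : ∀ n → toℚᵘ (fromℕ n) ℚᵘ.≃ mkℚᵘ (ℤ.+ n) 0
fromℕ-ᵘ n = ℚ.toℚᵘ-fromℚᵘ (mkℚᵘ (ℤ.+ n) 0)

fromℕ-suc : ∀ n → fromℕ (suc n) ≡ fromℕ n ℚ.+ 1ℚ
fromℕ-suc n = ℚ.toℚᵘ-injective (begin
  toℚᵘ (fromℕ (suc n))              ≈⟨ fromℕ-ᵘ (suc n) ⟩
  mkℚᵘ (ℤ.+ suc n) 0                ≈⟨ ℚᵘ.*≡* (cong (ℤ._* ℤ.+ 1) (lem n)) ⟩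
  mkℚᵘ (ℤ.+ n) 0 ℚᵘ.+ toℚᵘ 1ℚ       ≈⟨ ℚᵘ.+-congˡ (toℚᵘ 1ℚ) (ℚᵘ.≃-sym (fromℕ-ᵘ n)) ⟩
  toℚᵘ (fromℕ n) ℚᵘ.+ toℚᵘ 1ℚ       ≈⟨ ℚ.toℚᵘ-homo-+ (fromℕ n) 1ℚ ⟨
  toℚᵘ (fromℕ n ℚ.+ 1ℚ)             ∎)
  where
  open import Relation.Binary.Reasoning.Setoid ℚᵘ.≃-setoid
  lem : ∀ n → ℤ.+ suc n ≡ ℤ.+ n ℤ.* ℤ.+ 1 ℤ.+ ℤ.+ 1
  lem n = trans (cong ℤ.+_ (sym (ℕ.+-comm n 1))) (cong (ℤ._+ ℤ.+ 1) (sym (ℤ.*-identityʳ (ℤ.+ n))))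

scale-inv : ∀ q A N → suc N ≡ suc A ℕ.* q → fromℕ q ℚ.* inv N ≡ inv A
scale-inv q A N eq = ℚ.toℚᵘ-injective (begin
  toℚᵘ (fromℕ q ℚ.* inv N)              ≈⟨ ℚ.toℚᵘ-homo-* (fromℕ q) (inv N) ⟩
  toℚᵘ (fromℕ q) ℚᵘ.* toℚᵘ (inv N)      ≈⟨ ℚᵘ.*-cong (fromℕ-ᵘ q) (inv-ᵘ N) ⟩
  mkℚᵘ (ℤ.+ q) 0 ℚᵘ.* mkℚᵘ (ℤ.+ 1) N    ≈⟨ ℚᵘ.*≡* lem ⟩
  mkℚᵘ (ℤ.+ 1) A                        ≈⟨ inv-ᵘ A ⟨
  toℚᵘ (inv A)                          ∎)
  where
  open import Relation.Binary.Reasoning.Setoid ℚᵘ.≃-setoid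
  lem : (ℤ.+ q ℤ.* ℤ.+ 1) ℤ.* ℤ.+ suc A ≡ ℤ.+ 1 ℤ.* ℤ.+ (1 ℕ.* suc N)
  lem rewrite ℤ.*-identityʳ (ℤ.+ q) | ℤ.*-identityˡ (ℤ.+ (1 ℕ.* suc N))
      | ℕ.*-identityˡ (suc N) | eq | ℕ.*-comm (suc A) q = sym (ℤ.pos-* q (suc A))

double-inv : ∀ k → inv (k ℕ.+ suc k) ℚ.+ inv (k ℕ.+ suc k) ≡ inv k
double-inv k = trans lem (scale-inv 2 k (k ℕ.+ suc k) eq)
  where
  open ℚSolver.+-*-Solver
  i = inv (k ℕ.+ suc k)
  lem : i ℚ.+ i ≡ fromℕ 2 ℚ.* i
  lem = solve 1 (λ i → i :+ i := con (fromℕ 2) :* i) refl i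
  eq : suc (k ℕ.+ suc k) ≡ suc k ℕ.* 2
  eq = trans (cong (suc k ℕ.+_) (sym (ℕ.+-identityʳ (suc k)))) (ℕ.*-comm 2 (suc k))

∣p∣≤ : ∀ {p q} → p ℚ.≤ q → ℚ.- p ℚ.≤ q → ℚ.∣ p ∣ ℚ.≤ q
∣p∣≤ {p} p≤q -p≤q with ℚ.∣p∣≡p∨∣p∣≡-p p
... | inj₁ eq = subst (ℚ._≤ _) (sym eq) p≤q
... | inj₂ eq = subst (ℚ._≤ _) (sym eq) -p≤q

fromℚ : ℚ → ℝ
fromℚ p = mkℝ (λ _ → p) λ j k →
  subst (ℚ._≤ inv j ℚ.+ inv k) (cong ℚ.∣_∣ (sym (ℚ.+-inverseʳ p)))
    (ℚ.+-mono-≤ (0≤inv j) (0≤inv k))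

infix  8 -ᴿ_
infixl 6 _+ᴿ_ _-ᴿ_

_+ᴿ_ : ℝ → ℝ → ℝ
x +ᴿ y = mkℝ (λ k → seq x (k ℕ.+ suc k) ℚ.+ seq y (k ℕ.+ suc k)) reg
  where
  reg : ∀ j k → _
  reg j k = begin
    ℚ.∣ (a ℚ.+ c) ℚ.- (b ℚ.+ d) ∣         ≡⟨ cong ℚ.∣_∣ (interchange a b c d) ⟩
    ℚ.∣ (a ℚ.- b) ℚ.+ (c ℚ.- d) ∣         ≤⟨ ℚ.∣p+q∣≤∣p∣+∣q∣ (a ℚ.- b) (c ℚ.- d) ⟩
    ℚ.∣ a ℚ.- b ∣ ℚ.+ ℚ.∣ c ℚ.- d ∣       ≤⟨ ℚ.+-mono-≤ (regular x j′ k′) (regular y j′ k′) ⟩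
    (u ℚ.+ v) ℚ.+ (u ℚ.+ v)               ≡⟨ regroup u v ⟩
    (u ℚ.+ u) ℚ.+ (v ℚ.+ v)               ≡⟨ cong₂ ℚ._+_ (double-inv j) (double-inv k) ⟩
    inv j ℚ.+ inv k                       ∎
    where
    open ℚ.≤-Reasoning
    j′ = j ℕ.+ suc j
    k′ = k ℕ.+ suc k
    a = seq x j′
    b = seq x k′
    c = seq y j′
    d = seq y k′
    u = inv j′
    v = inv k′
    open ℚSolver.+-*-Solver
    interchange : ∀ a b c d → (a ℚ.+ c) ℚ.- (b ℚ.+ d) ≡ (a ℚ.- b) ℚ.+ (c ℚ.- d)
    interchange = solve 4 (λ a b c d → (a :+ c) :- (b :+ d) := (a :- b) :+ (c :- d)) refl
    regroup : ∀ u v → (u ℚ.+ v) ℚ.+ (u ℚ.+ v) ≡ (u ℚ.+ u) ℚ.+ (v ℚ.+ v)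
    regroup = solve 2 (λ u v → (u :+ v) :+ (u :+ v) := (u :+ u) :+ (v :+ v)) refl

-ᴿ_ : ℝ → ℝ
-ᴿ x = mkℝ (λ k → ℚ.- seq x k) λ j k →
  subst (ℚ._≤ inv j ℚ.+ inv k) (lem (seq x j) (seq x k)) (regular x j k)
  where
  open ℚSolver.+-*-Solver
  lem : ∀ a b → ℚ.∣ a ℚ.- b ∣ ≡ ℚ.∣ ℚ.- a ℚ.- ℚ.- b ∣
  lem a b = trans (sym (ℚ.∣-p∣≡∣p∣ (a ℚ.- b)))
    (cong ℚ.∣_∣ (solve 2 (λ a b → :- (a :- b) := :- a :- :- b) refl a b))

_-ᴿ_ : ℝ → ℝ → ℝ
x -ᴿ y = x +ᴿ (-ᴿ y)

-- Σ_{j=1}^{l} 1 / (a + j)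
∑1/ : ℕ → ℕ → ℚ
∑1/ a zero    = 0ℚ
∑1/ a (suc l) = ∑1/ a l ℚ.+ inv (a ℕ.+ l)

-- With p = k + 1, the lower Riemann sum of ∫₁ⁿ dt/t with mesh 1/p:
-- Σ_{j=1}^{(n-1)p} (1/p) · 1 / (1 + j/p) = Σ_{j=1}^{(n-1)p} 1 / (p + j).
-- It differs from the integral, which is log n, by at most 1/p.
log-seq : ℕ → ℕ → ℚ
log-seq n k = ∑1/ (suc k) ((n ℕ.∸ 1) ℕ.* suc k)

∑-++ : ∀ a l l′ → ∑1/ a (l ℕ.+ l′) ≡ ∑1/ a l ℚ.+ ∑1/ (a ℕ.+ l) l′
∑-++ a l zero rewrite ℕ.+-identityʳ l = sym (ℚ.+-identityʳ _)
∑-++ a l (suc l′) rewrite ℕ.+-suc l l′ | ∑-++ a l l′ | ℕ.+-assoc a l l′ =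
  ℚ.+-assoc (∑1/ a l) (∑1/ (a ℕ.+ l) l′) (inv (a ℕ.+ (l ℕ.+ l′)))

∑-shift : ∀ k l → ∑1/ k l ℚ.+ inv (k ℕ.+ l) ≡ ∑1/ (suc k) l ℚ.+ inv k
∑-shift k zero rewrite ℕ.+-identityʳ k = refl
∑-shift k (suc l) rewrite ℕ.+-suc k l | ∑-shift k l =
  solve 3 (λ s i j → (s :+ i) :+ j := (s :+ j) :+ i) refl
    (∑1/ (suc k) l) (inv k) (inv (suc (k ℕ.+ l)))
  where open ℚSolver.+-*-Solver

∑-upper : ∀ k l → ∑1/ k l ℚ.≤ ∑1/ (suc k) l ℚ.+ inv k
∑-upper k l = begin
  ∑1/ k l                       ≡⟨ ℚ.+-identityʳ _ ⟨
  ∑1/ k l ℚ.+ 0ℚ                ≤⟨ ℚ.+-monoʳ-≤ (∑1/ k l) (0≤inv (k ℕ.+ l)) ⟩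
  ∑1/ k l ℚ.+ inv (k ℕ.+ l)     ≡⟨ ∑-shift k l ⟩
  ∑1/ (suc k) l ℚ.+ inv k       ∎
  where open ℚ.≤-Reasoning

fromℕ-suc-* : ∀ l c → fromℕ (suc l) ℚ.* c ≡ fromℕ l ℚ.* c ℚ.+ c
fromℕ-suc-* l c rewrite fromℕ-suc l =
  solve 2 (λ x c → (x :+ con 1ℚ) :* c := x :* c :+ c) refl (fromℕ l) c
  where open ℚSolver.+-*-Solver

block-≥ : ∀ b c q → b ℕ.+ q ℕ.≤ suc c → fromℕ q ℚ.* inv c ℚ.≤ ∑1/ b q
block-≥ b c zero    _  = ℚ.≤-reflexive (ℚ.*-zeroˡ (inv c))
block-≥ b c (suc q) le rewrite fromℕ-suc-* q (inv c) | ℕ.+-suc b q =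
  ℚ.+-mono-≤ (block-≥ b c q (ℕ.m≤n⇒m≤1+n (s≤s⁻¹ le))) (inv-antimono (s≤s⁻¹ le))

block-≤ : ∀ b c q → c ℕ.≤ b → ∑1/ b q ℚ.≤ fromℕ q ℚ.* inv c
block-≤ b c zero    _  = ℚ.≤-reflexive (sym (ℚ.*-zeroˡ (inv c)))
block-≤ b c (suc q) le rewrite fromℕ-suc-* q (inv c) =
  ℚ.+-mono-≤ (block-≤ b c q le) (inv-antimono (ℕ.≤-trans le (ℕ.m≤m+n b q)))

-- Refining the mesh by a factor q = r + 1.
∑-suc-* : ∀ a l q →
  ∑1/ (a ℕ.* q) (suc l ℕ.* q) ≡ ∑1/ (a ℕ.* q) (l ℕ.* q) ℚ.+ ∑1/ ((a ℕ.+ l) ℕ.* q) q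
∑-suc-* a l q rewrite ℕ.+-comm q (l ℕ.* q) | ℕ.*-distribʳ-+ q a l =
  ∑-++ (a ℕ.* q) (l ℕ.* q) q

refine-≥ : ∀ a l r → ∑1/ a l ℚ.≤ ∑1/ (a ℕ.* suc r) (l ℕ.* suc r)
refine-≥ a zero    r = ℚ.≤-refl
refine-≥ a (suc l) r rewrite ∑-suc-* a l (suc r) =
  ℚ.+-mono-≤ (refine-≥ a l r) (begin
    inv (a ℕ.+ l)                ≡⟨ scale-inv (suc r) (a ℕ.+ l) N refl ⟨
    fromℕ (suc r) ℚ.* inv N      ≤⟨ block-≥ ((a ℕ.+ l) ℕ.* suc r) N (suc r)
                                      (ℕ.≤-reflexive (ℕ.+-comm ((a ℕ.+ l) ℕ.* suc r) (suc r))) ⟩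
    ∑1/ ((a ℕ.+ l) ℕ.* suc r) (suc r) ∎)
  where
  open ℚ.≤-Reasoning
  N = r ℕ.+ (a ℕ.+ l) ℕ.* suc r

refine-≤ : ∀ k l r → ∑1/ (suc k ℕ.* suc r) (l ℕ.* suc r) ℚ.≤ ∑1/ k l
refine-≤ k zero    r = ℚ.≤-refl
refine-≤ k (suc l) r rewrite ∑-suc-* (suc k) l (suc r) =
  ℚ.+-mono-≤ (refine-≤ k l r) (begin
    ∑1/ ((suc k ℕ.+ l) ℕ.* suc r) (suc r)   ≤⟨ block-≤ ((suc k ℕ.+ l) ℕ.* suc r) N (suc r) (ℕ.n≤1+n N) ⟩
    fromℕ (suc r) ℚ.* inv N                 ≡⟨ scale-inv (suc r) (k ℕ.+ l) N refl ⟩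
    inv (k ℕ.+ l)                           ∎)
  where
  open ℚ.≤-Reasoning
  N = r ℕ.+ (k ℕ.+ l) ℕ.* suc r

log-≤ : ∀ n j k → log-seq n j ℚ.≤ log-seq n k ℚ.+ inv k
log-≤ n j k = begin
  ∑1/ p (l ℕ.* p)                     ≤⟨ refine-≥ p (l ℕ.* p) k ⟩
  ∑1/ (p ℕ.* q) (l ℕ.* p ℕ.* q)       ≡⟨ cong₂ ∑1/ (ℕ.*-comm p q) swap ⟩
  ∑1/ (q ℕ.* p) (l ℕ.* q ℕ.* p)       ≤⟨ refine-≤ k (l ℕ.* q) j ⟩
  ∑1/ k (l ℕ.* q)                     ≤⟨ ∑-upper k (l ℕ.* q) ⟩
  ∑1/ q (l ℕ.* q) ℚ.+ inv k           ∎
  where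
  open ℚ.≤-Reasoning
  p = suc j
  q = suc k
  l = n ℕ.∸ 1
  swap : l ℕ.* p ℕ.* q ≡ l ℕ.* q ℕ.* p
  swap = trans (ℕ.*-assoc l p q) (trans (cong (l ℕ.*_) (ℕ.*-comm p q)) (sym (ℕ.*-assoc l q p)))

log-diff : ∀ n j k → log-seq n j ℚ.- log-seq n k ℚ.≤ inv j ℚ.+ inv k
log-diff n j k = begin
  x ℚ.- y                    ≤⟨ ℚ.+-monoˡ-≤ (ℚ.- y) (log-≤ n j k) ⟩
  (y ℚ.+ inv k) ℚ.- y        ≡⟨ solve 2 (λ y i → (y :+ i) :- y := con 0ℚ :+ i) refl y (inv k) ⟩
  0ℚ ℚ.+ inv k               ≤⟨ ℚ.+-monoˡ-≤ (inv k) (0≤inv j) ⟩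
  inv j ℚ.+ inv k            ∎
  where
  open ℚ.≤-Reasoning
  open ℚSolver.+-*-Solver
  x = log-seq n j
  y = log-seq n k

log : (n : ℕ) → .{{NonZero n}} → ℝ
log n = mkℝ (log-seq n) λ j k → ∣p∣≤ (log-diff n j k)
  (subst₂ ℚ._≤_
    (solve 2 (λ x y → y :- x := :- (x :- y)) refl (log-seq n j) (log-seq n k))
    (ℚ.+-comm (inv k) (inv j))
    (log-diff n k j))
  where open ℚSolver.+-*-Solver

TendsTo∞ : (ℕ → ℝ) → Set
TendsTo∞ f = ∀ (K : ℝ) → ∃ λ N → ∀ n → N ℕ.≤ n → K ≤ᴿ f n

TendsTo : (ℕ → ℚ) → ℚ → Set
TendsTo f L = ∀ ε → 0ℚ ℚ.< ε → ∃ λ N → ∀ n → N ℕ.≤ n → ℚ.∣ f n ℚ.- L ∣ ℚ.< ε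

record SimpleGraph (n : ℕ) : Set₁ where
  field
    Adj        : Rel (Fin n) 0ℓ
    adj?       : B.Decidable Adj
    symmetric  : B.Symmetric Adj
    loopless   : ∀ {u} → ¬ Adj u u

open SimpleGraph public

Connected : ∀ {n} → Pred (SimpleGraph n) 0ℓ
Connected G = ∀ u v → Star (Adj G) u v

module Reachability {n : ℕ} {R : Rel (Fin n) 0ℓ} (R? : B.Decidable R) where

  -- Walks whose interior vertices lie in the given list.
  Via : List (Fin n) → Rel (Fin n) 0ℓ
  Via []       u v = u ≡ v ⊎ R u v
  Via (w ∷ ws) u v = Via ws u v ⊎ (Via ws u w × Via ws w v)

  via? : ∀ ws → B.Decidable (Via ws)
  via? []       u v = (u Fin.≟ v) ⊎-dec R? u v
  via? (w ∷ ws) u v = via? ws u v ⊎-dec (via? ws u w ×-dec via? ws w v)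

  sound : ∀ ws {u v} → Via ws u v → Star R u v
  sound []       (inj₁ refl)     = ε
  sound []       (inj₂ r)        = r ◅ ε
  sound (w ∷ ws) (inj₁ p)        = sound ws p
  sound (w ∷ ws) (inj₂ (p , q))  = sound ws p ◅◅ sound ws q

  via-base : ∀ ws {u v} → u ≡ v ⊎ R u v → Via ws u v
  via-base []       b = b
  via-base (w ∷ ws) b = inj₁ (via-base ws b)

  via-trans : ∀ ws {u w v} → w ∈ ws → Via ws u w → Via ws w v → Via ws u v
  via-trans (x ∷ ws) (here refl) p q = inj₂ (to p , from q)
    where
    to : ∀ {u} → Via (x ∷ ws) u x → Via ws u x
    to (inj₁ p)       = p
    to (inj₂ (p , _)) = p
    from : ∀ {v} → Via (x ∷ ws) x v → Via ws x v
    from (inj₁ p)       = p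
    from (inj₂ (_ , p)) = p
  via-trans (x ∷ ws) (there i) (inj₁ p)       (inj₁ q)       = inj₁ (via-trans ws i p q)
  via-trans (x ∷ ws) (there i) (inj₁ p)       (inj₂ (q , r)) = inj₂ (via-trans ws i p q , r)
  via-trans (x ∷ ws) (there i) (inj₂ (p , q)) (inj₁ r)       = inj₂ (p , via-trans ws i q r)
  via-trans (x ∷ ws) (there i) (inj₂ (p , _)) (inj₂ (_ , r)) = inj₂ (p , r)

  complete : ∀ {u v} → Star R u v → Via (allFin n) u v
  complete ε              = via-base (allFin n) (inj₁ refl)
  complete (_◅_ {j = w} r rs) =
    via-trans (allFin n) (∈-allFin w) (via-base (allFin n) (inj₂ r)) (complete rs)

  reachable? : B.Decidable (Star R)
  reachable? u v = map′ (sound (allFin n)) complete (via? (allFin n) u v)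

connected? : ∀ {n} → Decidable (Connected {n})
connected? G = Fin.all? λ u → Fin.all? λ v → Reachability.reachable? (adj? G) u v

intersectionGraph : ∀ {n m} → Vec (Subset m) n → SimpleGraph n
intersectionGraph F = record
  { Adj       = λ u v → u ≢ v × Nonempty (lookup F u ∩ lookup F v)
  ; adj?      = λ u v → ¬? (u Fin.≟ v) ×-dec nonempty? (lookup F u ∩ lookup F v)
  ; symmetric = λ {u} {v} (u≢v , ne) →
      (λ eq → u≢v (sym eq)) , subst Nonempty (∩-comm (lookup F u) (lookup F v)) ne
  ; loopless  = λ (u≢u , _) → u≢u refl
  }

-- All vectors with entries from xs.  Each occurs exactly once when xs has
-- no repetitions, and the uniform distribution on vectors xs n makes the n
-- entries independent and uniform on xs.
vectors : ∀ {A : Set} → List A → (n : ℕ) → List (Vec A n)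
vectors xs zero    = [] ∷ []
vectors xs (suc n) = cartesianProductWith _∷_ xs (vectors xs n)

allSubsets : (m : ℕ) → List (Subset m)
allSubsets = vectors (outside ∷ inside ∷ [])

kSubsets : (m k : ℕ) → List (Subset m)
kSubsets m k = filter (λ S → ∣ S ∣ ℕ.≟ k) (allSubsets m)

assignments : (n m k : ℕ) → List (Vec (Subset m) n)
assignments n m k = vectors (kSubsets m k) n

∈-vectors : ∀ {A : Set} {xs : List A} {n} (v : Vec A n) →
            (∀ i → lookup v i ∈ xs) → v ∈ vectors xs n
∈-vectors []       _ = here refl
∈-vectors (x ∷ v)  h =
  ∈-cartesianProductWith⁺ _∷_ (h zero) (∈-vectors v (h ∘ suc))

∈-allSubsets : ∀ {m} (S : Subset m) → S ∈ allSubsets m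
∈-allSubsets S = ∈-vectors S (λ i → side (lookup S i))
  where
  side : ∀ s → s ∈ outside ∷ inside ∷ []
  side outside = here refl
  side inside  = there (here refl)

someSubset : ∀ {k m} → k ℕ.≤ m → Σ (Subset m) λ S → ∣ S ∣ ≡ k
someSubset {m = m} z≤n = ⊥ , ∣⊥∣≡0 m
someSubset (s≤s k≤m) with S , eq ← someSubset k≤m = inside ∷ S , cong suc eq

assignments-nonZero : ∀ n {m k} → k ℕ.≤ m → NonZero (length (assignments n m k))
assignments-nonZero n {m} {k} k≤m = ℕ.>-nonZero (∈-length (∈-vectors (Vec.replicate n S) mem))
  where
  S = proj₁ (someSubset k≤m)
  mem : ∀ i → lookup (Vec.replicate n S) i ∈ kSubsets m k
  mem i rewrite lookup-replicate i S =
    ∈-filter⁺ (λ S → ∣ S ∣ ℕ.≟ k) (∈-allSubsets S) (proj₂ (someSubset k≤m))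

-- Uniform over the positions of Ω, so repeated entries count repeatedly.
uniformProb : ∀ {A : Set} {P : Pred A 0ℓ} (Ω : List A) → .{{NonZero (length Ω)}} →
              Decidable P → ℚ
uniformProb Ω P? = ℤ.+ length (filter P? Ω) ℚ./ length Ω

ProbG : (n m k : ℕ) → .(k ℕ.≤ m) → {P : Pred (SimpleGraph n) 0ℓ} → Decidable P → ℚ
ProbG n m k k≤m P? =
  uniformProb (assignments n m k) {{assignments-nonZero n k≤m}} (P? ∘ intersectionGraph)

-- Asymptotically almost surely, G(n, m(n), k) satisfies P.
AAS : (m : ℕ → ℕ) (k : ℕ) → .(∀ n → k ℕ.≤ m n) →
      {P : ∀ {n} → Pred (SimpleGraph n) 0ℓ} → (∀ {n} → Decidable (P {n})) → Set
AAS m k k≤m P? = TendsTo (λ n → ProbG n (m n) k (k≤m n) P?) 1ℚ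

2≤⇒nonZero : ∀ {m} → 2 ℕ.≤ m → NonZero m
2≤⇒nonZero (s≤s _) = _

-- The nodes are n independent uniform edges of the complete graph on the m
-- colours, and the graph is disconnected iff these edges have two nontrivial
-- components.
--
-- (i) If so, the colour set A of one of them has a ≤ m/2 colours, no edge
-- crosses its boundary, and at least a/2 edges lie inside A, as they cover A.
-- By Markov's inequality for the sum of ∏ᵢ w(Fᵢ), where w is 1 + m²/(na)
-- inside A, 1 outside A and 0 across, the expected number of such A of size a
-- is at most (C (n/a) e^(-x(1-a/m)))^(a/2) with x = 4n/m.  This is summed
-- over a: for x a/m ≤ 1 the base is at most C n e^(1-x), and otherwise
-- n/a ≤ x²/4 makes it at most C x² e^(-x/2).
--
-- (ii) The number X of isolated nodes has mean n q^(n-1), where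
-- q = C(m-2,2) / C(m,2), and Var X / (E X)² ≤ 1 / E X + 1/q - 1 since
-- C(m,2) C(m-4,2) ≤ C(m-2,2)².  Both terms tend to 0.
--
-- Instead of an exponential function, y ≤ e^s is witnessed by a finite
-- product of factors 1 + yᵢ with ∑ yᵢ ≤ s.  Telescoping products relate n
-- to the Riemann sums that define log n, and all that is needed is that
-- ∏ (1 + yᵢ) ≤ 1 whenever ∑ yᵢ ≤ 0.

module Submission where

-- Both parts become inequalities between natural numbers: for any given `E`, the number of bad
-- assignments times `E` is at most `C(m,2)^n` for all large `n`. A limit is taken only at the very
-- end, and ω enters only as a gap of some constant `K`, depending on `E`, between `x = 4n/m` and
-- `log n`.
--
-- In (i) the exponent a/2 is not an integer for odd a, so Markov's inequality and the estimate for
-- each size are used in squared form. The sets of size a are required to contribute at most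
-- `D^(-a)` with `D = d + 1`, so that the sizes add up to a geometric series below 1/d; absorbing
-- `D` is what determines `K`. The split at `x a / m = 1` is forced: the exponent `x (1 - a/m)` can
-- be as small as x/2, too little to beat a factor n close to e^x, but for such a the factor n/a is
-- only polynomial in x.
--
-- In (ii) nothing says beforehand that m is large. It follows from `x ≤ log n`, which gives
-- `4n ≤ m²`; this bounds the error of order n/m² in the exponent and makes 1/q - 1 small.

-- Rational arithmetic and its transfer to and from the naturals.

module Rational where

  open import Defs hiding (∑-++)
  import Data.Integer.Base as ℤ
  import Data.Integer.Properties as ℤ
  open import Data.Nat.Base as ℕ using (ℕ; zero; suc)
  import Data.Nat.Properties as ℕ
  open import Data.Rational.Base
  open import Data.Rational.Properties
  import Data.Rational.Solver as ℚSolver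
  import Data.Rational.Unnormalised.Base as ℚᵘ
  import Data.Rational.Unnormalised.Properties as ℚᵘ
  open import Relation.Binary.PropositionalEquality
  open import Relation.Nullary.Decidable using (yes; no)
  open import Relation.Nullary.Negation using (contradiction)
  open ℚSolver.+-*-Solver public using (solve; con; _:+_; _:*_; _:-_; :-_; _:=_)

  0≤p+q : ∀ {p q} → 0ℚ ≤ p → 0ℚ ≤ q → 0ℚ ≤ p + q
  0≤p+q = +-mono-≤

  0≤p*q : ∀ {p q} → 0ℚ ≤ p → 0ℚ ≤ q → 0ℚ ≤ p * q
  0≤p*q {p} {q} 0≤p 0≤q = nonNegative⁻¹ (p * q)
    {{nonNeg*nonNeg⇒nonNeg p {{nonNegative 0≤p}} q {{nonNegative 0≤q}}}}

  0≤q-p⇒p≤q : ∀ {p q} → 0ℚ ≤ q - p → p ≤ q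
  0≤q-p⇒p≤q {p} {q} 0≤ = subst₂ _≤_ (+-identityˡ p) (cancel p q) (+-monoˡ-≤ p 0≤)
    where
    cancel : ∀ p q → q - p + p ≡ q
    cancel = solve 2 (λ p q → q :- p :+ p := q) refl

  p≤q⇒0≤q-p : ∀ {p q} → p ≤ q → 0ℚ ≤ q - p
  p≤q⇒0≤q-p {p} {q} p≤q = subst (_≤ q - p) (+-inverseʳ p) (+-monoˡ-≤ (- p) p≤q)

  -- Inequalities are proved by certificate: `d` is a visibly nonnegative form of the difference,
  -- and the ring solver checks that it is the difference.
  ≤-by : ∀ {p q d} → 0ℚ ≤ d → q - p ≡ d → p ≤ q
  ≤-by 0≤d eq = 0≤q-p⇒p≤q (subst (0ℚ ≤_) (sym eq) 0≤d)

  -- The certificate holds only modulo the relation `l ≡ r`, with cofactor `c`. The relations used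
  -- are mostly of the form `i * n ≡ 1ℚ`, so division is treated as polynomial algebra with an extra
  -- variable for the inverse.
  ≤-by₁ : ∀ {p q d l r} c → 0ℚ ≤ d → l ≡ r → q - p ≡ d + c * (l - r) → p ≤ q
  ≤-by₁ {d = d} {l} c 0≤d refl eq = ≤-by 0≤d (trans eq (lem d c l))
    where
    lem : ∀ d c l → d + c * (l - l) ≡ d
    lem = solve 3 (λ d c l → d :+ c :* (l :- l) := d) refl

  ≤-by₂ : ∀ {p q d l r l′ r′} c c′ → 0ℚ ≤ d → l ≡ r → l′ ≡ r′ →
          q - p ≡ d + c * (l - r) + c′ * (l′ - r′) → p ≤ q
  ≤-by₂ {d = d} {l′ = l} c c′ 0≤d e refl eq = ≤-by₁ c 0≤d e (trans eq (lem d c′ l _))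
    where
    lem : ∀ d c l h → d + h + c * (l - l) ≡ d + h
    lem = solve 4 (λ d c l h → d :+ h :+ c :* (l :- l) := d :+ h) refl

  ≡-by₁ : ∀ {p q l r} c → l ≡ r → p ≡ q + c * (l - r) → p ≡ q
  ≡-by₁ {q = q} {l} c refl eq = trans eq (lem q c l)
    where
    lem : ∀ q c l → q + c * (l - l) ≡ q
    lem = solve 3 (λ q c l → q :+ c :* (l :- l) := q) refl

  *-mono-≤ : ∀ {p q r s} → 0ℚ ≤ p → 0ℚ ≤ r → p ≤ q → r ≤ s → p * r ≤ q * s
  *-mono-≤ {p} {q} {r} {s} 0≤p 0≤r p≤q r≤s = ≤-trans
    (*-monoʳ-≤-nonNeg r {{nonNegative 0≤r}} p≤q)
    (*-monoˡ-≤-nonNeg q {{nonNegative (≤-trans 0≤p p≤q)}} r≤s)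

  *-≤1 : ∀ {p q} → 0ℚ ≤ p → 0ℚ ≤ q → p ≤ 1ℚ → q ≤ 1ℚ → p * q ≤ 1ℚ
  *-≤1 = *-mono-≤

  0≤1 : 0ℚ ≤ 1ℚ
  0≤1 = nonNegative⁻¹ 1ℚ

  fromℕ-mono-≤ : ∀ {a b} → a ℕ.≤ b → fromℕ a ≤ fromℕ b
  fromℕ-mono-≤ {a} {b} a≤b = toℚᵘ-cancel-≤ (begin
    toℚᵘ (fromℕ a)    ≃⟨ fromℕ-ᵘ a ⟩
    ℚᵘ.mkℚᵘ (ℤ.+ a) 0   ≤⟨ ℚᵘ.*≤* (ℤ.*-monoʳ-≤-nonNeg (ℤ.+ 1) (ℤ.+≤+ a≤b)) ⟩
    ℚᵘ.mkℚᵘ (ℤ.+ b) 0   ≃⟨ fromℕ-ᵘ b ⟨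
    toℚᵘ (fromℕ b)    ∎)
    where
    open ℚᵘ.≤-Reasoning

  -- The way back: the estimates are computed in ℚ but compare natural numbers.
  fromℕ-cancel-≤ : ∀ {a b} → fromℕ a ≤ fromℕ b → a ℕ.≤ b
  fromℕ-cancel-≤ {a} {b} a≤b with a ℕ.≤? b
  ... | yes p = p
  ... | no ¬p = contradiction (≤-trans (fromℕ-mono-≤ (ℕ.≰⇒> ¬p)) a≤b)
    λ le → <-irrefl refl (<-≤-trans
      (subst (_< fromℕ b + 1ℚ) (+-identityʳ _) (+-monoʳ-< (fromℕ b) (positive⁻¹ 1ℚ)))
      (subst (_≤ fromℕ b) (fromℕ-suc b) le))

  0≤fromℕ : ∀ n → 0ℚ ≤ fromℕ n
  0≤fromℕ n = fromℕ-mono-≤ {0} {n} ℕ.z≤n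

  fromℕ-+ : ∀ a b → fromℕ (a ℕ.+ b) ≡ fromℕ a + fromℕ b
  fromℕ-+ zero    b = sym (+-identityˡ _)
  fromℕ-+ (suc a) b rewrite fromℕ-suc (a ℕ.+ b) | fromℕ-suc a | fromℕ-+ a b =
    lem (fromℕ a) (fromℕ b)
    where
    lem : ∀ x y → x + y + 1ℚ ≡ x + 1ℚ + y
    lem = solve 2 (λ x y → x :+ y :+ con 1ℚ := x :+ con 1ℚ :+ y) refl

  fromℕ-* : ∀ a b → fromℕ (a ℕ.* b) ≡ fromℕ a * fromℕ b
  fromℕ-* zero    b = sym (*-zeroˡ (fromℕ b))
  fromℕ-* (suc a) b rewrite fromℕ-+ b (a ℕ.* b) | fromℕ-suc a | fromℕ-* a b =
    lem (fromℕ a) (fromℕ b)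
    where
    lem : ∀ x y → y + x * y ≡ (x + 1ℚ) * y
    lem = solve 2 (λ x y → y :+ x :* y := (x :+ con 1ℚ) :* y) refl

  inv-inverse : ∀ k → inv k * fromℕ (suc k) ≡ 1ℚ
  inv-inverse k = trans (*-comm (inv k) _) (scale-inv (suc k) 0 k (sym (ℕ.+-identityʳ (suc k))))

  infixr 8 _^_
  _^_ : ℚ → ℕ → ℚ
  p ^ zero  = 1ℚ
  p ^ suc k = p * p ^ k

  0≤^ : ∀ {p} k → 0ℚ ≤ p → 0ℚ ≤ p ^ k
  0≤^ zero    _   = 0≤1
  0≤^ (suc k) 0≤p = 0≤p*q 0≤p (0≤^ k 0≤p)

  ^-mono-≤ : ∀ {p q} k → 0ℚ ≤ p → p ≤ q → p ^ k ≤ q ^ k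
  ^-mono-≤ zero    0≤p p≤q = ≤-refl
  ^-mono-≤ (suc k) 0≤p p≤q = *-mono-≤ 0≤p (0≤^ k 0≤p) p≤q (^-mono-≤ k 0≤p p≤q)

  ^-distrib-* : ∀ p q k → (p * q) ^ k ≡ p ^ k * q ^ k
  ^-distrib-* p q zero    = refl
  ^-distrib-* p q (suc k) rewrite ^-distrib-* p q k = lem p q (p ^ k) (q ^ k)
    where
    lem : ∀ a b c d → a * b * (c * d) ≡ a * c * (b * d)
    lem = solve 4 (λ a b c d → a :* b :* (c :* d) := a :* c :* (b :* d)) refl

  1^ : ∀ k → 1ℚ ^ k ≡ 1ℚ
  1^ zero    = refl
  1^ (suc k) = trans (*-identityˡ _) (1^ k)

  fromℕ-^ : ∀ a k → fromℕ (a ℕ.^ k) ≡ fromℕ a ^ k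
  fromℕ-^ a zero    = refl
  fromℕ-^ a (suc k) = trans (fromℕ-* a (a ℕ.^ k)) (cong (fromℕ a *_) (fromℕ-^ a k))

  ^-+ : ∀ p j k → p ^ (j ℕ.+ k) ≡ p ^ j * p ^ k
  ^-+ p zero    k = sym (*-identityˡ _)
  ^-+ p (suc j) k rewrite ^-+ p j k = sym (*-assoc p _ _)

  -- A record because Agda cannot infer a from fromℕ a, which unfolds.
  infix 4 _↦_
  record _↦_ (a : ℕ) (x : ℚ) : Set where
    constructor mk
    field value : fromℕ a ≡ x

  infixl 6 _⟨+⟩_
  infixl 7 _⟨*⟩_
  infixr 8 _⟨^⟩_
  _⟨+⟩_ : ∀ {a b x y} → a ↦ x → b ↦ y → a ℕ.+ b ↦ x + y
  _⟨+⟩_ {a} {b} (mk p) (mk q) = mk (trans (fromℕ-+ a b) (cong₂ _+_ p q))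

  _⟨*⟩_ : ∀ {a b x y} → a ↦ x → b ↦ y → a ℕ.* b ↦ x * y
  _⟨*⟩_ {a} {b} (mk p) (mk q) = mk (trans (fromℕ-* a b) (cong₂ _*_ p q))

  _⟨^⟩_ : ∀ {a x} → a ↦ x → ∀ k → a ℕ.^ k ↦ x ^ k
  _⟨^⟩_ {a} (mk p) k = mk (trans (fromℕ-^ a k) (cong (_^ k) p))

  ⟦_⟧ : ∀ a → a ↦ fromℕ a
  ⟦ a ⟧ = mk refl

-- Exponential bounds witnessed by finite products.

module Exponential where

  open import Defs hiding (∑-++)
  open import Data.List.Base using (List; []; _∷_; _++_)
  open import Data.List.Relation.Unary.All using (All; []; _∷_)
  open import Data.List.Relation.Unary.All.Properties using (++⁺)
  open import Data.Nat.Base as ℕ using (ℕ; zero; suc)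
  import Data.Nat.Properties as ℕ
  open import Data.Product.Base using (_×_; _,_)
  open import Data.Rational.Base
  open import Data.Rational.Properties
  open import Data.Sum.Base using (inj₁; inj₂)
  open import Relation.Binary.PropositionalEquality
  open import Relation.Nullary.Decidable using (yes; no)
  open import Relation.Nullary.Negation using (contradiction)
  open Rational

  ∑ : List ℚ → ℚ
  ∑ []       = 0ℚ
  ∑ (y ∷ ys) = y + ∑ ys

  ∏1+ : List ℚ → ℚ
  ∏1+ []       = 1ℚ
  ∏1+ (y ∷ ys) = (1ℚ + y) * ∏1+ ys

  ∑-++ : ∀ ys zs → ∑ (ys ++ zs) ≡ ∑ ys + ∑ zs
  ∑-++ []       zs = sym (+-identityˡ _)
  ∑-++ (y ∷ ys) zs rewrite ∑-++ ys zs = sym (+-assoc y _ _)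

  ∏1+-++ : ∀ ys zs → ∏1+ (ys ++ zs) ≡ ∏1+ ys * ∏1+ zs
  ∏1+-++ []       zs = sym (*-identityˡ _)
  ∏1+-++ (y ∷ ys) zs rewrite ∏1+-++ ys zs = sym (*-assoc (1ℚ + y) _ _)

  Up Down : ℚ → Set
  Up y   = 0ℚ ≤ y
  Down y = 0ℚ ≤ 1ℚ + y × y ≤ 0ℚ

  ∑-up : ∀ {ys} → All Up ys → 0ℚ ≤ ∑ ys
  ∑-up []         = ≤-refl
  ∑-up (0≤y ∷ us) = 0≤p+q 0≤y (∑-up us)

  0≤∏1+-up : ∀ {ys} → All Up ys → 0ℚ ≤ ∏1+ ys
  0≤∏1+-up []         = 0≤1
  0≤∏1+-up (0≤y ∷ us) = 0≤p*q (0≤p+q 0≤1 0≤y) (0≤∏1+-up us)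

  0≤∏1+-down : ∀ {ys} → All Down ys → 0ℚ ≤ ∏1+ ys
  0≤∏1+-down []             = 0≤1
  0≤∏1+-down ((0≤ , _) ∷ ds) = 0≤p*q 0≤ (0≤∏1+-down ds)

  1+y≤1 : ∀ {y} → y ≤ 0ℚ → 1ℚ + y ≤ 1ℚ
  1+y≤1 = +-monoʳ-≤ 1ℚ

  ∏1+-down≤1 : ∀ {ys} → All Down ys → ∏1+ ys ≤ 1ℚ
  ∏1+-down≤1 []                = ≤-refl
  ∏1+-down≤1 ((0≤ , y≤0) ∷ ds) = *-≤1 0≤ (0≤∏1+-down ds) (1+y≤1 y≤0) (∏1+-down≤1 ds)

  -- If c and d have opposite signs then (1 + c) (1 + d) ≤ 1 + (c + d); hence
  -- factors are absorbed into c, always taking one whose sign is opposite to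
  -- that of c.
  merge : ∀ c {us ds} → 0ℚ ≤ 1ℚ + c → All Up us → All Down ds →
          c + (∑ us + ∑ ds) ≤ 0ℚ → (1ℚ + c) * (∏1+ us * ∏1+ ds) ≤ 1ℚ
  merge c {us} {ds} 0≤1+c aus ads ≤0 with c ≤? 0ℚ
  merge c {[]} {ds} 0≤1+c [] ads ≤0 | yes c≤0 =
    *-≤1 0≤1+c (0≤p*q 0≤1 (0≤∏1+-down ads)) (1+y≤1 c≤0)
      (*-≤1 0≤1 (0≤∏1+-down ads) ≤-refl (∏1+-down≤1 ads))
  merge c {u ∷ us} {ds} 0≤1+c (0≤u ∷ aus) ads ≤0 | yes c≤0 = ≤-trans
    (≤-by (0≤p*q (0≤p*q (p≤q⇒0≤q-p c≤0) 0≤u) (0≤p*q (0≤∏1+-up aus) (0≤∏1+-down ads)))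
      (lem c u (∏1+ us) (∏1+ ds)))
    (merge (c + u) (subst (0ℚ ≤_) (+-assoc 1ℚ c u) (0≤p+q 0≤1+c 0≤u)) aus ads
      (subst (_≤ 0ℚ) (lem′ c u (∑ us) (∑ ds)) ≤0))
    where
    lem : ∀ c u x y → (1ℚ + (c + u)) * (x * y) - (1ℚ + c) * ((1ℚ + u) * x * y) ≡ (0ℚ - c) * u * (x * y)
    lem = solve 4 (λ c u x y →
        (con 1ℚ :+ (c :+ u)) :* (x :* y) :- (con 1ℚ :+ c) :* ((con 1ℚ :+ u) :* x :* y) :=
        (con 0ℚ :- c) :* u :* (x :* y))
      refl
    lem′ : ∀ c u x y → c + (u + x + y) ≡ c + u + (x + y)
    lem′ = solve 4 (λ c u x y → c :+ (u :+ x :+ y) := c :+ u :+ (x :+ y)) refl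
  merge c {us} {[]} 0≤1+c aus [] ≤0 | no c≰0 = contradiction
    (≤-trans (≤-by (0≤p+q (∑-up aus) ≤-refl) (lem c (∑ us))) ≤0) c≰0
    where
    lem : ∀ c x → c + (x + 0ℚ) - c ≡ x + 0ℚ
    lem = solve 2 (λ c x → c :+ (x :+ con 0ℚ) :- c := x :+ con 0ℚ) refl
  merge c {us} {d ∷ ds} 0≤1+c aus ((0≤1+d , d≤0) ∷ ads) ≤0 | no c≰0 = ≤-trans
    (≤-by (0≤p*q (0≤p*q 0≤c (p≤q⇒0≤q-p d≤0)) (0≤p*q (0≤∏1+-up aus) (0≤∏1+-down ads)))
      (lem c d (∏1+ us) (∏1+ ds)))
    (merge (c + d) (subst (0ℚ ≤_) (lem″ c d) (0≤p+q 0≤1+d 0≤c)) aus ads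
      (subst (_≤ 0ℚ) (lem′ c d (∑ us) (∑ ds)) ≤0))
    where
    0≤c : 0ℚ ≤ c
    0≤c = <⇒≤ (≰⇒> c≰0)
    lem : ∀ c d x y → (1ℚ + (c + d)) * (x * y) - (1ℚ + c) * (x * ((1ℚ + d) * y)) ≡ c * (0ℚ - d) * (x * y)
    lem = solve 4 (λ c d x y →
        (con 1ℚ :+ (c :+ d)) :* (x :* y) :- (con 1ℚ :+ c) :* (x :* ((con 1ℚ :+ d) :* y)) :=
        c :* (con 0ℚ :- d) :* (x :* y))
      refl
    lem′ : ∀ c d x y → c + (x + (d + y)) ≡ c + d + (x + y)
    lem′ = solve 4 (λ c d x y → c :+ (x :+ (d :+ y)) := c :+ d :+ (x :+ y)) refl
    lem″ : ∀ c d → 1ℚ + d + c ≡ 1ℚ + (c + d)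
    lem″ = solve 2 (λ c d → con 1ℚ :+ d :+ c := con 1ℚ :+ (c :+ d)) refl

  -- A witness that y ≤ e ^ s: a product of factors 1 + yᵢ that bounds y, the
  -- sum of the yᵢ being at most s.
  infix 4 _≤exp_
  record _≤exp_ (y s : ℚ) : Set where
    constructor mk
    field
      {ups downs} : List ℚ
      allUp       : All Up ups
      allDown     : All Down downs
      nonneg      : 0ℚ ≤ y
      bound       : y ≤ ∏1+ ups * ∏1+ downs
      total       : ∑ ups + ∑ downs ≤ s

  open _≤exp_ using (nonneg) public

  -- The only way a witness is ever consumed. Every estimate is therefore arranged as a product to
  -- be bounded by 1, its exponents adding up to something nonpositive.
  ≤exp⇒≤1 : ∀ {y s} → y ≤exp s → s ≤ 0ℚ → y ≤ 1ℚ
  ≤exp⇒≤1 (mk {us} {ds} aus ads 0≤y y≤ ∑≤) s≤0 = ≤-trans y≤ (subst (_≤ 1ℚ) (*-identityˡ _)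
    (merge 0ℚ 0≤1 aus ads (subst (_≤ 0ℚ) (sym (+-identityˡ _)) (≤-trans ∑≤ s≤0))))

  -- For negative `s` the factor must satisfy `0 ≤ 1 + s`, which follows from `0 ≤ y ≤ 1 + s`.
  ≤exp-factor : ∀ {y s} → 0ℚ ≤ y → y ≤ 1ℚ + s → y ≤exp s
  ≤exp-factor {y} {s} 0≤y y≤ with ≤-total 0ℚ s
  ... | inj₁ 0≤s = mk {ups = s ∷ []} {downs = []} (0≤s ∷ []) [] 0≤y (subst (y ≤_) (lem s) y≤) (≤-reflexive (lem′ s))
    where
    lem : ∀ s → 1ℚ + s ≡ (1ℚ + s) * 1ℚ * 1ℚ
    lem = solve 1 (λ s → con 1ℚ :+ s := (con 1ℚ :+ s) :* con 1ℚ :* con 1ℚ) refl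
    lem′ : ∀ s → s + 0ℚ + 0ℚ ≡ s
    lem′ = solve 1 (λ s → s :+ con 0ℚ :+ con 0ℚ := s) refl
  ... | inj₂ s≤0 = mk {ups = []} {downs = s ∷ []} [] ((≤-trans 0≤y y≤ , s≤0) ∷ []) 0≤y (subst (y ≤_) (lem s) y≤) (≤-reflexive (lem′ s))
    where
    lem : ∀ s → 1ℚ + s ≡ 1ℚ * ((1ℚ + s) * 1ℚ)
    lem = solve 1 (λ s → con 1ℚ :+ s := con 1ℚ :* ((con 1ℚ :+ s) :* con 1ℚ)) refl
    lem′ : ∀ s → 0ℚ + (s + 0ℚ) ≡ s
    lem′ = solve 1 (λ s → con 0ℚ :+ (s :+ con 0ℚ) := s) refl

  infixr 7 _⊗_
  _⊗_ : ∀ {y z s t} → y ≤exp s → z ≤exp t → (y * z) ≤exp (s + t)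
  mk {us} {ds} aus ads 0≤y y≤ ∑≤ ⊗ mk {us′} {ds′} aus′ ads′ 0≤z z≤ ∑≤′ =
    mk (++⁺ aus aus′) (++⁺ ads ads′) (0≤p*q 0≤y 0≤z)
      (≤-trans (*-mono-≤ 0≤y 0≤z y≤ z≤) (≤-reflexive eq))
      (≤-trans (≤-reflexive eq′) (+-mono-≤ ∑≤ ∑≤′))
    where
    lem : ∀ a b c d → a * b * (c * d) ≡ a * c * (b * d)
    lem = solve 4 (λ a b c d → a :* b :* (c :* d) := a :* c :* (b :* d)) refl
    lem′ : ∀ a b c d → (a + c) + (b + d) ≡ a + b + (c + d)
    lem′ = solve 4 (λ a b c d → a :+ c :+ (b :+ d) := a :+ b :+ (c :+ d)) refl
    eq : _
    eq = trans (lem (∏1+ us) (∏1+ ds) (∏1+ us′) (∏1+ ds′))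
      (sym (cong₂ _*_ (∏1+-++ us us′) (∏1+-++ ds ds′)))
    eq′ : _
    eq′ = trans (cong₂ _+_ (∑-++ us us′) (∑-++ ds ds′)) (lem′ (∑ us) (∑ ds) (∑ us′) (∑ ds′))

  ≤exp-weaken : ∀ {y z s t} → 0ℚ ≤ y → y ≤ z → s ≤ t → z ≤exp s → y ≤exp t
  ≤exp-weaken 0≤y y≤z s≤t (mk aus ads _ z≤ ∑≤) = mk aus ads 0≤y (≤-trans y≤z z≤) (≤-trans ∑≤ s≤t)

  ≤exp-^ : ∀ {y s} k → y ≤exp s → (y ^ k) ≤exp (fromℕ k * s)
  ≤exp-^ {s = s} zero e = ≤exp-factor 0≤1 (≤-reflexive (sym (cong (1ℚ +_) (*-zeroˡ s))))
  ≤exp-^ {s = s} (suc k) e = ≤exp-weaken (nonneg e⊗) ≤-refl (≤-reflexive eq) e⊗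
    where
    e⊗ = e ⊗ ≤exp-^ k e
    lem : ∀ s k → s + k * s ≡ (k + 1ℚ) * s
    lem = solve 2 (λ s k → s :+ k :* s := (k :+ con 1ℚ) :* s) refl
    eq : s + fromℕ k * s ≡ fromℕ (suc k) * s
    eq rewrite fromℕ-suc k = lem s (fromℕ k)

  -- The product of the factors 1 + 1/(2+j) = (3+j)/(2+j) over j = 1, ..., l telescopes to (3+l)/3.
  3+l≤exp : ∀ l → (fromℕ (3 ℕ.+ l) * inv 2) ≤exp ∑1/ 2 l
  3+l≤exp zero    = ≤exp-factor 0≤1 ≤-refl
  3+l≤exp (suc l) = ≤exp-weaken (0≤p*q (0≤fromℕ (4 ℕ.+ l)) (0≤inv 2)) (≤-reflexive eq) ≤-refl
    (3+l≤exp l ⊗ ≤exp-factor (0≤p+q 0≤1 (0≤inv (2 ℕ.+ l))) ≤-refl)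
    where
    lem : ∀ x i j → (x + 1ℚ) * j ≡ x * j * (1ℚ + i) + j * (1ℚ - i * x)
    lem = solve 3 (λ x i j →
        (x :+ con 1ℚ) :* j :=
        x :* j :* (con 1ℚ :+ i) :+ j :* (con 1ℚ :- i :* x))
      refl
    lem′ : ∀ x j → x + j * (1ℚ - 1ℚ) ≡ x
    lem′ = solve 2 (λ x j → x :+ j :* (con 1ℚ :- con 1ℚ) := x) refl
    x = fromℕ (3 ℕ.+ l)
    i = inv (2 ℕ.+ l)
    j = inv 2
    eq : fromℕ (4 ℕ.+ l) * j ≡ x * j * (1ℚ + i)
    eq = begin
      fromℕ (4 ℕ.+ l) * j                       ≡⟨ cong (_* j) (fromℕ-suc (3 ℕ.+ l)) ⟩
      (x + 1ℚ) * j                              ≡⟨ lem x i j ⟩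
      x * j * (1ℚ + i) + j * (1ℚ - i * x)       ≡⟨ cong (λ h → x * j * (1ℚ + i) + j * (1ℚ - h)) (inv-inverse (2 ℕ.+ l)) ⟩
      x * j * (1ℚ + i) + j * (1ℚ - 1ℚ)          ≡⟨ lem′ (x * j * (1ℚ + i)) j ⟩
      x * j * (1ℚ + i)                          ∎
      where open ≡-Reasoning

  -- The product of the factors 1 - 1/(2+j) = (1+j)/(2+j) over j = 1, ..., l telescopes to 2/(2+l).
  1/2+l≤exp : ∀ l → (fromℕ 2 * inv (1 ℕ.+ l)) ≤exp (- ∑1/ 2 l)
  1/2+l≤exp zero    = ≤exp-factor 0≤1 ≤-refl
  1/2+l≤exp (suc l) = ≤exp-weaken (0≤p*q (0≤fromℕ 2) (0≤inv (2 ℕ.+ l))) (≤-reflexive eq)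
    (≤-reflexive (lem″ (∑1/ 2 l) (inv (2 ℕ.+ l))))
    (1/2+l≤exp l ⊗ ≤exp-factor (p≤q⇒0≤q-p (inv-antimono {0} {2 ℕ.+ l} ℕ.z≤n)) ≤-refl)
    where
    lem″ : ∀ s i → - s + - i ≡ - (s + i)
    lem″ = solve 2 (λ s i → :- s :+ :- i := :- (s :+ i)) refl
    lem : ∀ x i j → j * (1ℚ - i) ≡ j * (1ℚ - i * (x + 1ℚ)) + j * x * i
    lem = solve 3 (λ x i j →
        j :* (con 1ℚ :- i) :=
        j :* (con 1ℚ :- i :* (x :+ con 1ℚ)) :+ j :* x :* i)
      refl
    lem′ : ∀ i j → j * (1ℚ - 1ℚ) + 1ℚ * i ≡ i
    lem′ = solve 2 (λ i j → j :* (con 1ℚ :- con 1ℚ) :+ con 1ℚ :* i := i) refl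
    x = fromℕ (2 ℕ.+ l)
    i = inv (2 ℕ.+ l)
    j = inv (1 ℕ.+ l)
    eq : fromℕ 2 * i ≡ fromℕ 2 * j * (1ℚ - i)
    eq = trans (cong (fromℕ 2 *_) (sym (begin
      j * (1ℚ - i)                            ≡⟨ lem x i j ⟩
      j * (1ℚ - i * (x + 1ℚ)) + j * x * i     ≡⟨ cong₂ (λ p q → j * (1ℚ - p) + q * i)
                                                   (trans (cong (i *_) (sym (fromℕ-suc (2 ℕ.+ l)))) (inv-inverse (2 ℕ.+ l)))
                                                   (inv-inverse (1 ℕ.+ l)) ⟩
      j * (1ℚ - 1ℚ) + 1ℚ * i                  ≡⟨ lem′ i j ⟩
      i                                       ∎)))
      (sym (*-assoc (fromℕ 2) j (1ℚ - i)))
      where open ≡-Reasoning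

  -- Within 1/2 of log n, which suffices as ω absorbs bounded errors.
  L : ℕ → ℚ
  L n = log-seq n 1

  0≤∑1/ : ∀ a l → 0ℚ ≤ ∑1/ a l
  0≤∑1/ a zero    = ≤-refl
  0≤∑1/ a (suc l) = 0≤p+q (0≤∑1/ a l) (0≤inv (a ℕ.+ l))

  -- At l = 2k the telescoped product is (3+2k)/3. One further factor 3/2, paid for by the exponent
  -- `inv 1`, lifts it to k + 3/2.
  n≤exp : ∀ k → fromℕ (suc k) ≤exp (L (suc k) + inv 1)
  n≤exp k = ≤exp-weaken (0≤fromℕ (suc k)) le ≤-refl
    (3+l≤exp (k ℕ.* 2) ⊗ ≤exp-factor (0≤p+q 0≤1 (0≤inv 1)) ≤-refl)
    where
    lem : ∀ x → (x * fromℕ 2 + fromℕ 3) * inv 2 * (1ℚ + inv 1) - (x + 1ℚ) ≡ inv 1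
    lem = solve 1 (λ x →
        (x :* con (fromℕ 2) :+ con (fromℕ 3)) :* con (inv 2) :* (con 1ℚ :+ con (inv 1)) :- (x
          :+ con 1ℚ) :=
        con (inv 1))
      refl
    3+2k : fromℕ (3 ℕ.+ k ℕ.* 2) ≡ fromℕ k * fromℕ 2 + fromℕ 3
    3+2k = trans (cong fromℕ (ℕ.+-comm 3 (k ℕ.* 2)))
      (trans (fromℕ-+ (k ℕ.* 2) 3) (cong (_+ fromℕ 3) (fromℕ-* k 2)))
    le : fromℕ (suc k) ≤ fromℕ (3 ℕ.+ k ℕ.* 2) * inv 2 * (1ℚ + inv 1)
    le = subst₂ (λ p q → p ≤ q * inv 2 * (1ℚ + inv 1)) (sym (fromℕ-suc k)) (sym 3+2k)
      (≤-by (0≤inv 1) (lem (fromℕ k)))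

  1/n≤exp : ∀ k → inv k ≤exp (- L (suc k))
  1/n≤exp k = subst (_≤exp (- L (suc k))) (scale-inv 2 k (1 ℕ.+ k ℕ.* 2) refl) (1/2+l≤exp (k ℕ.* 2))

-- The estimate for colour sets of a given size, for part (i).

module ComponentEstimate where

  open import Defs hiding (∑-++)
  open import Data.Nat.Base as ℕ using (ℕ; suc)
  import Data.Nat.Properties as ℕ
  open import Data.Product.Base using (∃; _×_; _,_; proj₁; proj₂)
  open import Data.Rational.Base
  open import Data.Rational.Properties
  open import Data.Sum.Base using (inj₁; inj₂)
  open import Relation.Binary.PropositionalEquality
  open Rational
  open Exponential

  -- The hypothesis is one term of the binomial expansion of (m+a)^m, with c = C(m,a). As (1 +
  -- a/m)^m ≤ e^a, the conclusion is the usual bound (e m / a)^a for C(m,a), in a form free of e.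
  component-size : ∀ {c a m ia im} j k → ia * a ≡ 1ℚ → im * m ≡ 1ℚ → 0ℚ ≤ ia → 0ℚ ≤ im →
                   c * (a ^ j * m ^ k) ≤ (m + a) ^ (j ℕ.+ k) →
                   c ≤ (m * ia) ^ j * (1ℚ + a * im) ^ (j ℕ.+ k)
  component-size {c} {a} {m} {ia} {im} j k ea em 0≤ia 0≤im le = begin
    c                                                           ≡⟨ eq ⟩
    c * (a ^ j * m ^ k) * (ia ^ j * im ^ k)                     ≤⟨ *-monoʳ-≤-nonNeg (ia ^ j * im ^ k)
                                                                     {{nonNegative (0≤p*q (0≤^ j 0≤ia) (0≤^ k 0≤im))}} le ⟩
    (m + a) ^ (j ℕ.+ k) * (ia ^ j * im ^ k)                     ≡⟨ cong (λ z → z ^ (j ℕ.+ k) * (ia ^ j * im ^ k)) (eq₂ a m im em) ⟩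
    (m * (1ℚ + a * im)) ^ (j ℕ.+ k) * (ia ^ j * im ^ k)         ≡⟨ cong (_* (ia ^ j * im ^ k)) (^-distrib-* m _ (j ℕ.+ k)) ⟩
    m ^ (j ℕ.+ k) * g * (ia ^ j * im ^ k)                       ≡⟨ cong (λ z → z * g * (ia ^ j * im ^ k)) (^-+ m j k) ⟩
    m ^ j * m ^ k * g * (ia ^ j * im ^ k)                       ≡⟨ eq₃ (m ^ j) (m ^ k) g (ia ^ j) (im ^ k) (inverse^ em k) ⟩
    m ^ j * ia ^ j * g                                          ≡⟨ cong (_* g) (^-distrib-* m ia j) ⟨
    (m * ia) ^ j * g                                            ∎
    where
    open ≤-Reasoning
    g = (1ℚ + a * im) ^ (j ℕ.+ k)
    inverse^ : ∀ {x y} → x * y ≡ 1ℚ → ∀ k → x ^ k * y ^ k ≡ 1ℚ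
    inverse^ {x} {y} e k = trans (sym (^-distrib-* x y k)) (trans (cong (_^ k) e) (1^ k))
    eq₁ : ∀ c x y x′ y′ → x′ * x ≡ 1ℚ → y′ * y ≡ 1ℚ → c * (x * y) * (x′ * y′) ≡ c
    eq₁ c x y x′ y′ e e′ = ≡-by₁ (c * (x′ * x)) e′ (≡-by₁ c e (solve 5 (λ c x y x′ y′ →
        c :* (x :* y) :* (x′ :* y′) :=
        c :+ c :* (x′ :* x) :* (y′ :* y :- con 1ℚ) :+ c :* (x′ :* x :- con 1ℚ))
      refl c x y x′ y′))
    eq : c ≡ c * (a ^ j * m ^ k) * (ia ^ j * im ^ k)
    eq = sym (eq₁ c (a ^ j) (m ^ k) (ia ^ j) (im ^ k) (inverse^ ea j) (inverse^ em k))
    eq₂ : ∀ a m im → im * m ≡ 1ℚ → m + a ≡ m * (1ℚ + a * im)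
    eq₂ a m im e = ≡-by₁ (- a) e (solve 3 (λ a m im →
        m :+ a :=
        m :* (con 1ℚ :+ a :* im) :+ :- a :* (im :* m :- con 1ℚ))
      refl a m im)
    eq₃ : ∀ u v g u′ v′ → v′ * v ≡ 1ℚ → u * v * g * (u′ * v′) ≡ u * u′ * g
    eq₃ u v g u′ v′ e = ≡-by₁ (u * u′ * g) e (solve 5 (λ u v g u′ v′ →
        u :* v :* g :* (u′ :* v′) :=
        u :* u′ :* g :+ u :* u′ :* g :* (v′ :* v :- con 1ℚ))
      refl u v g u′ v′)

  -- With λ₁/λ₂ = 1 + m²/(na), C(a,2)/C(m,2) ≤ (a/m)² and C(b,2)/C(m,2) ≤ (b/m)², the mean weight of
  -- one node relative to λ₂ is at most a/n + (a/m)² + (b/m)². The tilt m²/(na) is what turns into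
  -- the term a/n.
  weight-total : ∀ {n a b m A B N in′ im} → m ≡ a + b →
    A ≡ (a * a - a) * inv 1 → B ≡ (b * b - b) * inv 1 → N ≡ (m * m - m) * inv 1 →
    0ℚ ≤ n → 0ℚ ≤ a → 0ℚ ≤ b → 0ℚ ≤ im → in′ * n ≡ 1ℚ → im * m ≡ 1ℚ →
    (n * a + m * m) * A + (n * a) * B ≤
    n * a * N * (a * in′ + ((a * im) * (a * im) + (b * im) * (b * im)))
  weight-total {n} {a} {b} {in′ = in′} {im} refl refl refl refl 0≤n 0≤a 0≤b 0≤im en em =
    ≤-by₂ (a * a * ((a + b) * (a + b) - (a + b)) * inv 1)
      (n * a * (a * a + b * b) * inv 1 * (im * (a + b) + 1ℚ - im) - n * a * inv 1 * (a + b))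
      (0≤p+q (0≤p*q (0≤p*q (0≤p*q 0≤n 0≤a) (0≤p*q 0≤a 0≤b)) 0≤im)
             (0≤p*q (0≤p*q (0≤p*q 0≤a 0≤b) (0≤p+q 0≤a 0≤b)) (0≤inv 1)))
      en em (solve 5 (λ n a b in′ im →
          n :* a :* (((a :+ b) :* (a :+ b) :- (a :+ b)) :* con (inv 1)) :* (a :* in′
            :+ (a :* im :* (a :* im) :+ b :* im :* (b :* im))) :- ((n :* a :+ (a :+ b) :* (a
            :+ b)) :* ((a :* a :- a) :* con (inv 1)) :+ n :* a :* ((b :* b :- b) :* con (inv 1))) :=
          n :* a :* (a :* b) :* im :+ a :* b :* (a :+ b) :* con (inv 1) :+ a :* a :* ((a
            :+ b) :* (a :+ b) :- (a :+ b)) :* con (inv 1) :* (in′ :* n :- con 1ℚ)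
            :+ (n :* a :* (a :* a :+ b :* b) :* con (inv 1) :* (im :* (a :+ b) :+ con 1ℚ :- im)
            :- n :* a :* con (inv 1) :* (a :+ b)) :* (im :* (a :+ b) :- con 1ℚ))
        refl n a b in′ im)

  -- Pure bookkeeping with powers: `y` absorbs (P D)² λ₂/λ₁, where `P` is m/a, `z` is the mean
  -- weight per node, and `g` is the factor left over from C(m,a). The analytic content is the
  -- hypothesis that their product is at most 1.
  combine : ∀ {c D l₁ l₂ W N P g y z} a n →
    0ℚ ≤ c → 0ℚ ≤ D → 0ℚ ≤ l₁ → 0ℚ ≤ l₂ → 0ℚ ≤ W → 0ℚ ≤ N → 0ℚ ≤ P →
    c ≤ P ^ a * g → W ≤ l₂ * N * z → l₂ * ((P * D) * (P * D)) ≤ l₁ * y →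
    y ^ a * ((g * g) * (z ^ n * z ^ n)) ≤ 1ℚ → 0ℚ ≤ (g * g) * (z ^ n * z ^ n) →
    (c * D ^ a) * (c * D ^ a) * (l₂ ^ a * (W ^ n * W ^ n)) ≤
    (N ^ n * N ^ n) * (l₁ ^ a * (l₂ ^ n * l₂ ^ n))
  combine {c} {D} {l₁} {l₂} {W} {N} {P} {g} {y} {z} a n 0≤c 0≤D 0≤l₁ 0≤l₂ 0≤W 0≤N 0≤P c≤ W≤ P≤ ≤1 0≤ = begin
    (c * D ^ a) * (c * D ^ a) * (l₂ ^ a * (W ^ n * W ^ n))
      ≤⟨ *-mono-≤ (0≤p*q 0≤cD 0≤cD) (0≤p*q (0≤^ a 0≤l₂) (0≤p*q (0≤^ n 0≤W) (0≤^ n 0≤W)))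
           (*-mono-≤ 0≤cD 0≤cD cD≤ cD≤)
           (*-monoˡ-≤-nonNeg (l₂ ^ a) {{nonNegative (0≤^ a 0≤l₂)}} (*-mono-≤ (0≤^ n 0≤W) (0≤^ n 0≤W) Wn≤ Wn≤)) ⟩
    (P ^ a * g * D ^ a) * (P ^ a * g * D ^ a) * (l₂ ^ a * ((l₂ ^ n * N ^ n * z ^ n) * (l₂ ^ n * N ^ n * z ^ n)))
      ≡⟨ eq₁ (P ^ a) g (D ^ a) (l₂ ^ a) (l₂ ^ n) (N ^ n) (z ^ n) ⟩
    (l₂ ^ a * ((P ^ a * D ^ a) * (P ^ a * D ^ a))) * (((g * g) * (z ^ n * z ^ n)) * R)
      ≡⟨ cong (_* (((g * g) * (z ^ n * z ^ n)) * R)) (sym eq₂) ⟩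
    (l₂ * ((P * D) * (P * D))) ^ a * (((g * g) * (z ^ n * z ^ n)) * R)
      ≤⟨ *-monoʳ-≤-nonNeg (((g * g) * (z ^ n * z ^ n)) * R) {{nonNegative (0≤p*q 0≤ 0≤R)}}
           (^-mono-≤ a (0≤p*q 0≤l₂ (0≤p*q (0≤p*q 0≤P 0≤D) (0≤p*q 0≤P 0≤D))) P≤) ⟩
    (l₁ * y) ^ a * (((g * g) * (z ^ n * z ^ n)) * R)
      ≡⟨ cong (_* (((g * g) * (z ^ n * z ^ n)) * R)) (^-distrib-* l₁ y a) ⟩
    l₁ ^ a * y ^ a * (((g * g) * (z ^ n * z ^ n)) * R)
      ≡⟨ eq₃ (l₁ ^ a) (y ^ a) ((g * g) * (z ^ n * z ^ n)) R ⟩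
    (y ^ a * ((g * g) * (z ^ n * z ^ n))) * (l₁ ^ a * R)
      ≤⟨ *-monoʳ-≤-nonNeg (l₁ ^ a * R) {{nonNegative (0≤p*q (0≤^ a 0≤l₁) 0≤R)}} ≤1 ⟩
    1ℚ * (l₁ ^ a * R)
      ≡⟨ eq₄ (l₁ ^ a) (l₂ ^ n) (N ^ n) ⟩
    (N ^ n * N ^ n) * (l₁ ^ a * (l₂ ^ n * l₂ ^ n)) ∎
    where
    open ≤-Reasoning
    R = (l₂ ^ n * l₂ ^ n) * (N ^ n * N ^ n)
    0≤cD = 0≤p*q 0≤c (0≤^ a 0≤D)
    0≤R = 0≤p*q (0≤p*q (0≤^ n 0≤l₂) (0≤^ n 0≤l₂)) (0≤p*q (0≤^ n 0≤N) (0≤^ n 0≤N))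
    cD≤ : c * D ^ a ≤ P ^ a * g * D ^ a
    cD≤ = *-monoʳ-≤-nonNeg (D ^ a) {{nonNegative (0≤^ a 0≤D)}} c≤
    Wn≤ : W ^ n ≤ l₂ ^ n * N ^ n * z ^ n
    Wn≤ = ≤-trans (^-mono-≤ n 0≤W W≤)
      (≤-reflexive (trans (^-distrib-* (l₂ * N) z n) (cong (_* z ^ n) (^-distrib-* l₂ N n))))
    eq₁ : ∀ p g d l l′ N z → (p * g * d) * (p * g * d) * (l * ((l′ * N * z) * (l′ * N * z))) ≡
          (l * ((p * d) * (p * d))) * (((g * g) * (z * z)) * ((l′ * l′) * (N * N)))
    eq₁ p g d l l′ N z = solve 7 (λ p g d l l′ N z →
        p :* g :* d :* (p :* g :* d) :* (l :* (l′ :* N :* z :* (l′ :* N :* z))) :=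
        l :* (p :* d :* (p :* d)) :* (g :* g :* (z :* z) :* (l′ :* l′ :* (N :* N))))
      refl p g d l l′ N z
    eq₂ : (l₂ * ((P * D) * (P * D))) ^ a ≡ l₂ ^ a * ((P ^ a * D ^ a) * (P ^ a * D ^ a))
    eq₂ rewrite ^-distrib-* l₂ ((P * D) * (P * D)) a | ^-distrib-* (P * D) (P * D) a | ^-distrib-* P D a = refl
    eq₃ : ∀ l y g r → l * y * (g * r) ≡ y * g * (l * r)
    eq₃ l y g r = solve 4 (λ l y g r → l :* y :* (g :* r) := y :* g :* (l :* r)) refl l y g r
    eq₄ : ∀ l l′ N → 1ℚ * (l * ((l′ * l′) * (N * N))) ≡ (N * N) * (l * (l′ * l′))
    eq₄ l l′ N = solve 3 (λ l l′ N →
        con 1ℚ :* (l :* (l′ :* l′ :* (N :* N))) :=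
        N :* N :* (l :* (l′ :* l′)))
      refl l l′ N

  w≤exp : ∀ {w} → 0ℚ ≤ w → w ≤exp w
  w≤exp {w} 0≤w = ≤exp-factor 0≤w (≤-by 0≤1 (solve 1 (λ w → con 1ℚ :+ w :- w := con 1ℚ) refl w))

  -- From 1 ≤ x a / m follows n / a ≤ x² / 4, which is subexponential in x.
  large : ∀ {x n a m ia im D} → 0ℚ ≤ x → 0ℚ ≤ n → 0ℚ ≤ m → 0ℚ ≤ ia → 0ℚ ≤ D →
    x * m ≡ fromℕ 4 * n → ia * a ≡ 1ℚ → im * m ≡ 1ℚ → 1ℚ ≤ x * (a * im) →
    fromℕ 128 * D ≤ x → (D * D * (n * ia)) ≤exp (x * inv 3)
  large {x} {n} {a} {m} {ia} {im} {D} 0≤x 0≤n 0≤m 0≤ia 0≤D ex ea em 1≤ D≤ =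
    ≤exp-weaken (0≤p*q (0≤p*q 0≤D 0≤D) 0≤nia) (≤-trans bound (≤-reflexive (w⁴ x)))
      (≤-reflexive (4w x)) (e ⊗ e ⊗ e ⊗ e)
    where
    e = w≤exp (0≤p*q 0≤x (0≤inv 15))
    0≤nia = 0≤p*q 0≤n 0≤ia
    w⁴ : ∀ x → inv 65535 * ((x * x) * (x * x)) ≡ x * inv 15 * (x * inv 15 * (x * inv 15 * (x * inv 15)))
    w⁴ x = solve 1 (λ x →
        con (inv 65535) :* (x :* x :* (x :* x)) :=
        x :* con (inv 15) :* (x :* con (inv 15) :* (x :* con (inv 15) :* (x :* con (inv 15)))))
      refl x
    4w : ∀ x → x * inv 15 + (x * inv 15 + (x * inv 15 + x * inv 15)) ≡ x * inv 3
    4w x = solve 1 (λ x →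
        x :* con (inv 15) :+ (x :* con (inv 15) :+ (x :* con (inv 15) :+ x :* con (inv 15))) :=
        x :* con (inv 3))
      refl x
    mia≤x : m * ia ≤ x
    mia≤x = ≤-by₂ (- x * (im * m)) (- x) (0≤p*q (0≤p*q 0≤m 0≤ia) (p≤q⇒0≤q-p 1≤)) ea em
      (solve 5 (λ x a m ia im →
          x :- m :* ia :=
          m :* ia :* (x :* (a :* im) :- con 1ℚ) :+ :- x :* (im :* m) :* (ia :* a :- con 1ℚ)
            :+ :- x :* (im :* m :- con 1ℚ))
        refl x a m ia im)
    4nia≤ : fromℕ 4 * (n * ia) ≤ x * x
    4nia≤ = ≤-by₁ (ia) (0≤p*q 0≤x (p≤q⇒0≤q-p mia≤x)) ex (solve 4 (λ x n m ia →
        x :* x :- con (fromℕ 4) :* (n :* ia) :=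
        x :* (x :- m :* ia) :+ ia :* (x :* m :- con (fromℕ 4) :* n))
      refl x n m ia)
    128Dx≤ : fromℕ 128 * (D * x) ≤ x * x
    128Dx≤ = ≤-by (0≤p*q 0≤x (p≤q⇒0≤q-p D≤)) (solve 2 (λ x D →
        x :* x :- con (fromℕ 128) :* (D :* x) :=
        x :* (x :- con (fromℕ 128) :* D))
      refl x D)
    sq : (fromℕ 128 * (D * x)) * (fromℕ 128 * (D * x)) ≤ (x * x) * (x * x)
    sq = *-mono-≤ 0≤ 0≤ 128Dx≤ 128Dx≤
      where 0≤ = 0≤p*q (0≤fromℕ 128) (0≤p*q 0≤D 0≤x)
    -- Since D ≤ x/128 and n/a ≤ x²/4, the left side is at most x⁴ / (4 · 128²) = (x/16)⁴, and w ≤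
    -- e^w for w = x/16 gives e^(x/4). The constant 128 is chosen so that 4 · 128² is the fourth
    -- power of 16.
    bound : D * D * (n * ia) ≤ inv 65535 * ((x * x) * (x * x))
    bound = ≤-by (0≤p+q (0≤p*q (0≤inv 65535) (p≤q⇒0≤q-p sq))
                        (0≤p*q (0≤p*q (0≤inv 3) (0≤p*q 0≤D 0≤D)) (p≤q⇒0≤q-p 4nia≤)))
      (solve 4 (λ x n ia D →
          con (inv 65535) :* (x :* x :* (x :* x)) :- D :* D :* (n :* ia) :=
          con (inv 65535) :* (x :* x :* (x :* x)
            :- con (fromℕ 128) :* (D :* x) :* (con (fromℕ 128) :* (D :* x)))
            :+ con (inv 3) :* (D :* D) :* (x :* x :- con (fromℕ 4) :* (n :* ia)))
        refl x n ia D)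

  -- Here s = a/m and r = 1 - s. The exponent x r has to pay for `v`, a bound on log(D² n/a), and
  -- for the constant 4 that `exponent-sum` requires.
  small-or-large : ∀ {x n a m ia im s r l D d} →
    0ℚ ≤ x → 0ℚ ≤ n → 0ℚ ≤ m → 0ℚ ≤ ia → 0ℚ ≤ d → ia ≤ 1ℚ → D ≡ 1ℚ + d →
    s ≡ a * im → s + r ≡ 1ℚ → s ≤ r →
    x * m ≡ fromℕ 4 * n → ia * a ≡ 1ℚ → im * m ≡ 1ℚ → n ≤exp (l + inv 1) →
    l + (fromℕ 2 * d + fromℕ 6) ≤ x → fromℕ 128 * D ≤ x →
    ∃ λ v → (D * D * (n * ia)) ≤exp v × v + fromℕ 4 ≤ x * r
  small-or-large {x} {n} {a} {m} {ia} {im} {s} {r} {l} {_} {d}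
    0≤x 0≤n 0≤m 0≤ia 0≤d ia≤1 refl refl s+r s≤r ex ea em en l≤ D≤ with ≤-total (x * s) 1ℚ
  -- x r = x - x s ≥ x - 1. The factor 1/a is dropped, each D costs `d` and n costs `l + 1/2`; the
  -- hypothesis with `2 d + 6` then leaves 1/2 to spare.
  ... | inj₁ ≤1 = d + (d + (l + inv 1)) ,
    ≤exp-weaken (0≤p*q (0≤p*q 0≤D 0≤D) (0≤p*q 0≤n 0≤ia))
      (≤-by {q = (1ℚ + d) * ((1ℚ + d) * n)} (0≤p*q (0≤p*q (0≤p*q 0≤D 0≤D) 0≤n) (p≤q⇒0≤q-p ia≤1)) (solve 3 (λ n ia d →
          (con 1ℚ :+ d) :* ((con 1ℚ :+ d) :* n) :- (con 1ℚ :+ d) :* (con 1ℚ :+ d) :* (n :* ia) :=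
          (con 1ℚ :+ d) :* (con 1ℚ :+ d) :* n :* (con 1ℚ :- ia))
        refl n ia d))
      ≤-refl (eD ⊗ eD ⊗ en) ,
    ≤-by₁ x (0≤p+q (0≤p+q (p≤q⇒0≤q-p l≤) (p≤q⇒0≤q-p ≤1)) (0≤inv 1)) s+r
      (solve 6 (λ x a im r l d →
          x :* r :- (d :+ (d :+ (l :+ con (inv 1))) :+ con (fromℕ 4)) :=
          x :- (l :+ (con (fromℕ 2) :* d :+ con (fromℕ 6))) :+ (con 1ℚ :- x :* (a :* im))
            :+ con (inv 1) :+ x :* (a :* im :+ r :- con 1ℚ))
        refl x a im r l d)
    where
    0≤D : 0ℚ ≤ 1ℚ + d
    0≤D = 0≤p+q 0≤1 0≤d
    eD : (1ℚ + d) ≤exp d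
    eD = ≤exp-factor 0≤D ≤-refl
  -- Now s ≤ r only gives x r ≥ x/2. One x/4 pays for `v`, the other is at least 32 D and so exceeds
  -- 4.
  ... | inj₂ 1≤ = x * inv 3 ,
    large 0≤x 0≤n 0≤m 0≤ia (0≤p+q 0≤1 0≤d) ex ea em 1≤ D≤ ,
    ≤-by₁ (x * inv 1) (0≤p+q (0≤p+q (0≤p*q (0≤p*q 0≤x (0≤inv 1)) (p≤q⇒0≤q-p s≤r))
                      (0≤p*q (0≤inv 3) (p≤q⇒0≤q-p D≤))) (0≤p+q (0≤fromℕ 28) (0≤p*q (0≤fromℕ 32) 0≤d)))
      s+r (solve 5 (λ x a im r d →
          x :* r :- (x :* con (inv 3) :+ con (fromℕ 4)) :=
          x :* con (inv 1) :* (r :- a :* im) :+ con (inv 3) :* (x :- con (fromℕ 128) :* (con 1ℚ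
            :+ d)) :+ (con (fromℕ 28) :+ con (fromℕ 32) :* d) :+ x :* con (inv 1) :* (a :* im
            :+ r :- con 1ℚ))
        refl x a im r d)

  -- The exponents of y^a, g² and z^(2n) are a v, 2 m s = 2a and 2 n u = 2a - 4 n s r. As x m = 4n,
  -- the last term is -a x r, so the sum is a (v + 4 - x r): this is the origin of the 4.
  exponent-sum : ∀ {x n a m in′ im r v} → 0ℚ ≤ a →
    x * m ≡ fromℕ 4 * n → in′ * n ≡ 1ℚ → im * m ≡ 1ℚ → v + fromℕ 4 ≤ x * r →
    let s = a * im
        u = a * in′ - fromℕ 2 * (s * r)
    in a * v + ((m * s + m * s) + (n * u + n * u)) ≤ 0ℚ
  exponent-sum {x} {n} {a} {m} {in′} {im} {r} {v} 0≤a ex en em v≤ = ≤-trans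
    (≤-by₁ {q = a * v + (fromℕ 2 * (m * (a * im)) + fromℕ 2 * a - fromℕ 4 * (n * (a * im * r)))}
      (- (fromℕ 2 * a)) (≤-refl {0ℚ}) en (solve 7 (λ n a m in′ im r v →
          a :* v :+ (con (fromℕ 2) :* (m :* (a :* im)) :+ con (fromℕ 2) :* a
            :- con (fromℕ 4) :* (n :* (a :* im :* r))) :- (a :* v :+ (m :* (a :* im)
            :+ m :* (a :* im) :+ (n :* (a :* in′ :- con (fromℕ 2) :* (a :* im :* r))
            :+ n :* (a :* in′ :- con (fromℕ 2) :* (a :* im :* r))))) :=
          con 0ℚ :+ :- (con (fromℕ 2) :* a) :* (in′ :* n :- con 1ℚ))
        refl n a m in′ im r v))
    (≤-by₂ (- (a * im * r)) (a * x * r - fromℕ 2 * a) (0≤p*q 0≤a (p≤q⇒0≤q-p v≤)) ex em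
      (solve 7 (λ x n a m im r v →
          con 0ℚ :- (a :* v :+ (con (fromℕ 2) :* (m :* (a :* im)) :+ con (fromℕ 2) :* a
            :- con (fromℕ 4) :* (n :* (a :* im :* r)))) :=
          a :* (x :* r :- (v :+ con (fromℕ 4))) :+ :- (a :* im :* r) :* (x :* m
            :- con (fromℕ 4) :* n) :+ (a :* x :* r :- con (fromℕ 2) :* a) :* (im :* m :- con 1ℚ))
        refl x n a m im r v))

  open _↦_

  half : ∀ {A a} → A ℕ.+ A ℕ.+ a ≡ a ℕ.* a → fromℕ A ≡ (fromℕ a * fromℕ a - fromℕ a) * inv 1
  half {A} {a} eq = lem (fromℕ A) (fromℕ a) (trans (sym (value (⟦ A ⟧ ⟨+⟩ ⟦ A ⟧ ⟨+⟩ ⟦ a ⟧))) (trans (cong fromℕ eq) (fromℕ-* a a)))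
    where
    lem : ∀ A a → A + A + a ≡ a * a → A ≡ (a * a - a) * inv 1
    lem A a e = ≡-by₁ (inv 1) e (solve 2 (λ A a →
        A :=
        (a :* a :- a) :* con (inv 1) :+ con (inv 1) :* (A :+ A :+ a :- a :* a))
      refl A a)

  -- `c`, `A`, `B` and `N` stand for C(m,a), C(a,2), C(b,2) and C(m,2), known only through the
  -- properties that the estimate uses; the quadratic ones are stated without subtraction or
  -- division.
  component-estimate : ∀ k p b d {c A B N x} →
    let n  = suc k
        a  = suc p
        m  = a ℕ.+ b
        D  = suc d
        λ₁ = n ℕ.* a ℕ.+ m ℕ.* m
        λ₂ = n ℕ.* a
        W  = λ₁ ℕ.* A ℕ.+ λ₂ ℕ.* B
    in a ℕ.≤ b → x * fromℕ m ≡ fromℕ 4 * fromℕ n →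
       L n + (fromℕ 2 * fromℕ d + fromℕ 6) ≤ x → fromℕ 128 * fromℕ D ≤ x →
       c ℕ.* (a ℕ.^ a ℕ.* m ℕ.^ b) ℕ.≤ (m ℕ.+ a) ℕ.^ m →
       A ℕ.+ A ℕ.+ a ≡ a ℕ.* a → B ℕ.+ B ℕ.+ b ≡ b ℕ.* b → N ℕ.+ N ℕ.+ m ≡ m ℕ.* m →
       (c ℕ.* D ℕ.^ a) ℕ.* (c ℕ.* D ℕ.^ a) ℕ.* (λ₂ ℕ.^ a ℕ.* (W ℕ.^ n ℕ.* W ℕ.^ n)) ℕ.≤
       (N ℕ.^ n ℕ.* N ℕ.^ n) ℕ.* (λ₁ ℕ.^ a ℕ.* (λ₂ ℕ.^ n ℕ.* λ₂ ℕ.^ n))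
  component-estimate k p b d {c} {A} {B} {N} {x} a≤b ex L≤ D≤ c≤ eA eB eN =
    fromℕ-cancel-≤ (subst₂ _≤_ (sym (value lhs)) (sym (value rhs))
      (combine {P = m * ia} {g = g} {y = D * D * (n * ia)} {z = z} a′ n′
        (0≤fromℕ c) (0≤fromℕ (suc d)) 0≤l₁ 0≤l₂ 0≤W (0≤fromℕ N) (0≤p*q 0≤m 0≤ia)
        (component-size a′ b ea em 0≤ia 0≤im
          (subst₂ _≤_ (value (⟦ c ⟧ ⟨*⟩ (⟦ a′ ⟧ ⟨^⟩ a′ ⟨*⟩ ⟦ m′ ⟧ ⟨^⟩ b))) (value ((⟦ m′ ⟧ ⟨+⟩ ⟦ a′ ⟧) ⟨^⟩ m′)) (fromℕ-mono-≤ c≤)))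
        (weight-total {n = n} {a} {fromℕ b} {m} {in′ = in′} {im} (fromℕ-+ a′ b) (half {A} {a′} eA) (half {B} {b} eB) (half {N} {m′} eN)
          0≤n 0≤a (0≤fromℕ b) 0≤im en em)
        (scale n a m ia D 0≤n 0≤a 0≤ia ea)
        (≤exp⇒≤1 E (exponent-sum {x} {n} {a} {m} {in′} {im} {r} {v} 0≤a ex en em v≤))
        (nonneg rest)))
    where
    n′ = suc k
    a′ = suc p
    m′ = a′ ℕ.+ b
    n  = fromℕ n′
    a  = fromℕ a′
    m  = fromℕ m′
    D  = fromℕ (suc d)
    ia = inv p
    im = inv (p ℕ.+ b)
    in′ = inv k
    s  = a * im
    r  = fromℕ b * im
    u  = a * in′ - fromℕ 2 * (s * r)
    z  = a * in′ + (s * s + r * r)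
    g  = (1ℚ + s) ^ m′
    l₁ = n * a + m * m
    l₂ = n * a
    W  = l₁ * fromℕ A + l₂ * fromℕ B
    ea : ia * a ≡ 1ℚ
    ea = inv-inverse p
    em : im * m ≡ 1ℚ
    em = inv-inverse (p ℕ.+ b)
    en : in′ * n ≡ 1ℚ
    en = inv-inverse k
    0≤n = 0≤fromℕ n′
    0≤a = 0≤fromℕ a′
    0≤m = 0≤fromℕ m′
    0≤ia = 0≤inv p
    0≤im = 0≤inv (p ℕ.+ b)
    0≤s = 0≤p*q 0≤a 0≤im
    0≤l₂ = 0≤p*q 0≤n 0≤a
    0≤l₁ = 0≤p+q 0≤l₂ (0≤p*q 0≤m 0≤m)
    0≤W = 0≤p+q (0≤p*q 0≤l₁ (0≤fromℕ A)) (0≤p*q 0≤l₂ (0≤fromℕ B))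
    λ₁≡ : n′ ℕ.* a′ ℕ.+ m′ ℕ.* m′ ↦ l₁
    λ₁≡ = ⟦ n′ ⟧ ⟨*⟩ ⟦ a′ ⟧ ⟨+⟩ ⟦ m′ ⟧ ⟨*⟩ ⟦ m′ ⟧
    λ₂≡ : n′ ℕ.* a′ ↦ l₂
    λ₂≡ = ⟦ n′ ⟧ ⟨*⟩ ⟦ a′ ⟧
    W≡ = λ₁≡ ⟨*⟩ ⟦ A ⟧ ⟨+⟩ λ₂≡ ⟨*⟩ ⟦ B ⟧
    cD≡ = ⟦ c ⟧ ⟨*⟩ ⟦ suc d ⟧ ⟨^⟩ a′
    lhs = cD≡ ⟨*⟩ cD≡ ⟨*⟩ (λ₂≡ ⟨^⟩ a′ ⟨*⟩ (W≡ ⟨^⟩ n′ ⟨*⟩ W≡ ⟨^⟩ n′))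
    rhs = (⟦ N ⟧ ⟨^⟩ n′ ⟨*⟩ ⟦ N ⟧ ⟨^⟩ n′) ⟨*⟩ (λ₁≡ ⟨^⟩ a′ ⟨*⟩ (λ₂≡ ⟨^⟩ n′ ⟨*⟩ λ₂≡ ⟨^⟩ n′))
    -- λ₁ ≥ m², so λ₂/λ₁ ≤ na/m², which turns (m/a)² D² into D² n/a.
    scale : ∀ n a m ia D → 0ℚ ≤ n → 0ℚ ≤ a → 0ℚ ≤ ia → ia * a ≡ 1ℚ →
            (n * a) * ((m * ia * D) * (m * ia * D)) ≤ (n * a + m * m) * (D * D * (n * ia))
    scale n a m ia D 0≤n 0≤a 0≤ia e =
      ≤-by₁ (- (n * ia * ((m * D) * (m * D)))) (0≤p*q (0≤p*q 0≤n 0≤a) (0≤p*q (0≤p*p D) (0≤p*q 0≤n 0≤ia))) e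
        (solve 5 (λ n a m ia D →
            (n :* a :+ m :* m) :* (D :* D :* (n :* ia))
              :- n :* a :* (m :* ia :* D :* (m :* ia :* D)) :=
            n :* a :* (D :* D :* (n :* ia)) :+ :- (n :* ia :* (m :* D :* (m :* D))) :* (ia :* a
              :- con 1ℚ))
          refl n a m ia D)
      where
      0≤p*p : ∀ p → 0ℚ ≤ p * p
      0≤p*p p with ≤-total 0ℚ p
      ... | inj₁ 0≤p = 0≤p*q 0≤p 0≤p
      ... | inj₂ p≤0 = subst (0ℚ ≤_) (negate² p) (0≤p*q (p≤q⇒0≤q-p p≤0) (p≤q⇒0≤q-p p≤0))
        where
        negate² : ∀ p → (0ℚ - p) * (0ℚ - p) ≡ p * p
        negate² p = solve 1 (λ p → (con 0ℚ :- p) :* (con 0ℚ :- p) := p :* p) refl p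
    s+r : s + r ≡ 1ℚ
    s+r = trans (sym (*-distribʳ-+ im a (fromℕ b))) (trans (cong (_* im) (sym (fromℕ-+ a′ b))) (trans (*-comm m im) em))
    s≤r : s ≤ r
    s≤r = *-monoʳ-≤-nonNeg im {{nonNegative 0≤im}} (fromℕ-mono-≤ a≤b)
    key = small-or-large {x} {n} {a} {m} {ia} {im} {s} {r} {L n′} {D} {fromℕ d}
      (≤-trans (0≤p*q (0≤fromℕ 128) (0≤fromℕ (suc d))) D≤) 0≤n 0≤m 0≤ia (0≤fromℕ d)
      (inv-antimono {0} {p} ℕ.z≤n) (trans (fromℕ-suc d) (+-comm (fromℕ d) 1ℚ)) refl s+r s≤r ex ea em
      (n≤exp k) L≤ D≤
    v = proj₁ key
    v≤ = proj₂ (proj₂ key)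
    ey = proj₁ (proj₂ key)
    eg : g ≤exp (m * s)
    eg = ≤exp-^ m′ (≤exp-factor (0≤p+q 0≤1 0≤s) ≤-refl)
    -- Because s + r = 1, s² + r² = 1 - 2 s r: the weight lost to crossing nodes.
    z≤ : ∀ c s r → s + r ≡ 1ℚ → c + (s * s + r * r) ≤ 1ℚ + (c - fromℕ 2 * (s * r))
    z≤ c s r e = ≤-by₁ (- (s + r + 1ℚ)) (≤-refl {0ℚ}) e (solve 3 (λ c s r →
        con 1ℚ :+ (c :- con (fromℕ 2) :* (s :* r)) :- (c :+ (s :* s :+ r :* r)) :=
        con 0ℚ :+ :- (s :+ r :+ con 1ℚ) :* (s :+ r :- con 1ℚ))
      refl c s r)
    ez : (z ^ n′) ≤exp (n * u)
    ez = ≤exp-^ n′ (≤exp-factor (0≤p+q (0≤p*q 0≤a (0≤inv k)) (0≤p+q (0≤p*q 0≤s 0≤s) (0≤p*q 0≤r 0≤r))) (z≤ (a * in′) s r s+r))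
      where 0≤r = 0≤p*q (0≤fromℕ b) 0≤im
    rest = (eg ⊗ eg) ⊗ (ez ⊗ ez)
    E = ≤exp-^ a′ ey ⊗ rest

-- Sums over assignments and subsets.

module Counting where

  open import Defs using (vectors; allSubsets; kSubsets)
  open import Data.Bool.Base using (if_then_else_)
  open import Data.Fin.Base using (Fin; zero; suc)
  open import Data.Fin.Subset using (Subset; inside; outside; ∣_∣; ∁; ⊤) renaming (_∈_ to _∈ˢ_)
  open import Data.Fin.Subset.Properties
    using (_⊆?_; out⊆; drop-∷-⊆; in⊆in; ⊆⊤; ∣⊤∣≡n)
  open import Data.List.Base
    using (List; []; _∷_; _++_; map; length; filter; cartesianProductWith)
  open import Data.List.Membership.Propositional using (_∈_)
  open import Data.List.Membership.Propositional.Properties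
    using (∈-cartesianProductWith⁻; ∈-filter⁻)
  open import Data.List.Relation.Unary.Any using (here; there)
  open import Data.Nat.Base
  open import Data.Nat.Combinatorics
    using (_C_; nC1≡n; nCk+nC[k+1]≡[n+1]C[k+1])
  open import Data.Nat.Properties
  open import Data.Nat.Tactic.RingSolver using (solve-∀)
  open import Data.Product.Base using (_,_)
  open import Data.Vec.Base using (Vec; []; _∷_; lookup; here)
  open import Function.Base using (_∘_)
  open import Relation.Binary.PropositionalEquality
  open import Relation.Nullary using (¬_; Dec; yes; no; does)
  open import Relation.Nullary.Negation using (contradiction)
  open import Relation.Unary using (Pred; Decidable)
  open import Level using (0ℓ)

  private variable
    A B : Set
    P Q : Set

  𝟙 : Dec P → ℕ
  𝟙 P? = if does P? then 1 else 0

  𝟙-yes : (P? : Dec P) → P → 𝟙 P? ≡ 1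
  𝟙-yes (yes _)  _ = refl
  𝟙-yes (no ¬p)  p = contradiction p ¬p

  𝟙-no : (P? : Dec P) → ¬ P → 𝟙 P? ≡ 0
  𝟙-no (yes p) ¬p = contradiction p ¬p
  𝟙-no (no _)  _  = refl

  𝟙≤1 : (P? : Dec P) → 𝟙 P? ≤ 1
  𝟙≤1 (yes _) = ≤-refl
  𝟙≤1 (no _)  = z≤n

  𝟙≤ : ∀ {n} (P? : Dec P) → (P → 1 ≤ n) → 𝟙 P? ≤ n
  𝟙≤ (yes p) h = h p
  𝟙≤ (no _)  h = z≤n

  𝟙-mono : (P? : Dec P) (Q? : Dec Q) → (P → Q) → 𝟙 P? ≤ 𝟙 Q?
  𝟙-mono (yes p) Q? f = ≤-reflexive (sym (𝟙-yes Q? (f p)))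
  𝟙-mono (no _)  Q? f = z≤n

  𝟙-cong : (P? : Dec P) (Q? : Dec Q) → (P → Q) → (Q → P) → 𝟙 P? ≡ 𝟙 Q?
  𝟙-cong P? Q? f g = ≤-antisym (𝟙-mono P? Q? f) (𝟙-mono Q? P? g)

  ∑ : (A → ℕ) → List A → ℕ
  ∑ f []       = 0
  ∑ f (x ∷ xs) = f x + ∑ f xs

  ∑-mono-∈ : ∀ {f g : A → ℕ} xs → (∀ {x} → x ∈ xs → f x ≤ g x) → ∑ f xs ≤ ∑ g xs
  ∑-mono-∈ []       h = z≤n
  ∑-mono-∈ (x ∷ xs) h = +-mono-≤ (h (here refl)) (∑-mono-∈ xs (h ∘ there))

  ∑-mono : ∀ {f g : A → ℕ} xs → (∀ x → f x ≤ g x) → ∑ f xs ≤ ∑ g xs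
  ∑-mono xs h = ∑-mono-∈ xs (λ {x} _ → h x)

  ∑-cong : ∀ {f g : A → ℕ} xs → (∀ x → f x ≡ g x) → ∑ f xs ≡ ∑ g xs
  ∑-cong []       h = refl
  ∑-cong (x ∷ xs) h = cong₂ _+_ (h x) (∑-cong xs h)

  ∑-++ : ∀ (f : A → ℕ) xs ys → ∑ f (xs ++ ys) ≡ ∑ f xs + ∑ f ys
  ∑-++ f []       ys = refl
  ∑-++ f (x ∷ xs) ys = trans (cong (f x +_) (∑-++ f xs ys)) (sym (+-assoc (f x) _ _))

  ∑-map : ∀ (f : B → ℕ) (g : A → B) xs → ∑ f (map g xs) ≡ ∑ (f ∘ g) xs
  ∑-map f g []       = refl
  ∑-map f g (x ∷ xs) = cong (f (g x) +_) (∑-map f g xs)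

  ∑-+ : ∀ (f g : A → ℕ) xs → ∑ (λ x → f x + g x) xs ≡ ∑ f xs + ∑ g xs
  ∑-+ f g []       = refl
  ∑-+ f g (x ∷ xs) rewrite ∑-+ f g xs = lem (f x) (g x) (∑ f xs) (∑ g xs)
    where
    lem : ∀ a b c d → a + b + (c + d) ≡ a + c + (b + d)
    lem = solve-∀

  ∑-*ˡ : ∀ c (f : A → ℕ) xs → ∑ (λ x → c * f x) xs ≡ c * ∑ f xs
  ∑-*ˡ c f []       = sym (*-zeroʳ c)
  ∑-*ˡ c f (x ∷ xs) = trans (cong (c * f x +_) (∑-*ˡ c f xs)) (sym (*-distribˡ-+ c (f x) _))

  ∑-*ʳ : ∀ c (f : A → ℕ) xs → ∑ (λ x → f x * c) xs ≡ ∑ f xs * c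
  ∑-*ʳ c f xs = trans (∑-cong xs λ x → *-comm (f x) c) (trans (∑-*ˡ c f xs) (*-comm c _))

  ∑-const : ∀ c (xs : List A) → ∑ (λ _ → c) xs ≡ length xs * c
  ∑-const c []       = refl
  ∑-const c (x ∷ xs) = cong (c +_) (∑-const c xs)

  ∑-swap : ∀ (f : A → B → ℕ) xs ys → ∑ (λ x → ∑ (f x) ys) xs ≡ ∑ (λ y → ∑ (λ x → f x y) xs) ys
  ∑-swap f []       ys = sym (trans (∑-const 0 ys) (*-zeroʳ (length ys)))
  ∑-swap f (x ∷ xs) ys = trans (cong (∑ (f x) ys +_) (∑-swap f xs ys)) (sym (∑-+ (f x) _ ys))

  ≤∑ : ∀ (f : A → ℕ) {x xs} → x ∈ xs → f x ≤ ∑ f xs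
  ≤∑ f (here refl) = m≤m+n _ _
  ≤∑ f (there p)   = ≤-trans (≤∑ f p) (m≤n+m _ _)

  ∑-filter : ∀ {P : Pred A 0ℓ} (P? : Decidable P) (f : A → ℕ) xs →
             ∑ f (filter P? xs) ≡ ∑ (λ x → 𝟙 (P? x) * f x) xs
  ∑-filter P? f []       = refl
  ∑-filter P? f (x ∷ xs) with P? x
  ... | yes _ = cong₂ _+_ (sym (*-identityˡ (f x))) (∑-filter P? f xs)
  ... | no _  = ∑-filter P? f xs

  length-filter : ∀ {P : Pred A 0ℓ} (P? : Decidable P) xs →
                  length (filter P? xs) ≡ ∑ (𝟙 ∘ P?) xs
  length-filter P? []       = refl
  length-filter P? (x ∷ xs) with P? x
  ... | yes _ = cong suc (length-filter P? xs)
  ... | no _  = length-filter P? xs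

  ∑-cartesianProductWith : ∀ {C : Set} (f : C → ℕ) (g : A → B → C) xs ys →
    ∑ f (cartesianProductWith g xs ys) ≡ ∑ (λ x → ∑ (λ y → f (g x y)) ys) xs
  ∑-cartesianProductWith f g []       ys = refl
  ∑-cartesianProductWith f g (x ∷ xs) ys = trans (∑-++ f (map (g x) ys) _)
    (cong₂ _+_ (∑-map f (g x) ys) (∑-cartesianProductWith f g xs ys))

  ∏ : ∀ {n} → (Fin n → ℕ) → ℕ
  ∏ {zero}  f = 1
  ∏ {suc n} f = f zero * ∏ (f ∘ suc)

  ∏-mono : ∀ {n} {f g : Fin n → ℕ} → (∀ i → f i ≤ g i) → ∏ f ≤ ∏ g
  ∏-mono {zero}  h = ≤-refl
  ∏-mono {suc n} h = *-mono-≤ (h zero) (∏-mono (h ∘ suc))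

  ∏-const : ∀ n c → ∏ {n} (λ _ → c) ≡ c ^ n
  ∏-const zero    c = refl
  ∏-const (suc n) c = cong (c *_) (∏-const n c)

  weight : ∀ {n} → (Fin n → A → ℕ) → Vec A n → ℕ
  weight w []       = 1
  weight w (x ∷ xs) = w zero x * weight (w ∘ suc) xs

  -- Independence of the nodes, in unnormalised form: the expectation of a product of functions of
  -- single nodes is the product of the expectations.
  ∑-weight : ∀ n (w : Fin n → A → ℕ) xs →
             ∑ (weight w) (vectors xs n) ≡ ∏ (λ i → ∑ (w i) xs)
  ∑-weight zero    w xs = refl
  ∑-weight (suc n) w xs = begin
    ∑ (weight w) (cartesianProductWith _∷_ xs (vectors xs n))
      ≡⟨ ∑-cartesianProductWith (weight w) _∷_ xs (vectors xs n) ⟩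
    ∑ (λ x → ∑ (λ v → w zero x * weight (w ∘ suc) v) (vectors xs n)) xs
      ≡⟨ ∑-cong xs (λ x → ∑-*ˡ (w zero x) (weight (w ∘ suc)) (vectors xs n)) ⟩
    ∑ (λ x → w zero x * ∑ (weight (w ∘ suc)) (vectors xs n)) xs
      ≡⟨ ∑-*ʳ _ (w zero) xs ⟩
    ∑ (w zero) xs * ∑ (weight (w ∘ suc)) (vectors xs n)
      ≡⟨ cong (∑ (w zero) xs *_) (∑-weight n (w ∘ suc) xs) ⟩
    ∑ (w zero) xs * ∏ (λ i → ∑ (w (suc i)) xs) ∎
    where open ≡-Reasoning

  ∑-1 : ∀ (xs : List A) → ∑ (λ _ → 1) xs ≡ length xs
  ∑-1 xs = trans (∑-const 1 xs) (*-identityʳ _)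

  weight-1 : ∀ {n} (v : Vec A n) → weight (λ _ _ → 1) v ≡ 1
  weight-1 []      = refl
  weight-1 (x ∷ v) = trans (*-identityˡ _) (weight-1 v)

  length-vectors : ∀ (xs : List A) n → length (vectors xs n) ≡ length xs ^ n
  length-vectors xs n = begin
    length (vectors xs n)                     ≡⟨ ∑-1 (vectors xs n) ⟨
    ∑ (λ _ → 1) (vectors xs n)                ≡⟨ ∑-cong (vectors xs n) weight-1 ⟨
    ∑ (weight (λ _ _ → 1)) (vectors xs n)     ≡⟨ ∑-weight n (λ _ _ → 1) xs ⟩
    ∏ {n} (λ _ → ∑ (λ _ → 1) xs)              ≡⟨ ∏-const n _ ⟩
    ∑ (λ _ → 1) xs ^ n                        ≡⟨ cong (_^ n) (∑-1 xs) ⟩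
    length xs ^ n                             ∎
    where open ≡-Reasoning

  ∈-vectors⁻ : ∀ (xs : List A) n {v} → v ∈ vectors xs n → ∀ i → lookup v i ∈ xs
  ∈-vectors⁻ xs (suc n) p i with ∈-cartesianProductWith⁻ _∷_ xs (vectors xs n) p
  ∈-vectors⁻ xs (suc n) p zero    | _ , _ , x∈ , v∈ , refl = x∈
  ∈-vectors⁻ xs (suc n) p (suc i) | _ , _ , x∈ , v∈ , refl = ∈-vectors⁻ xs n v∈ i

  ∑-allSubsets-suc : ∀ {m} (f : Subset (suc m) → ℕ) → ∑ f (allSubsets (suc m)) ≡
    ∑ (λ S → f (outside ∷ S)) (allSubsets m) + ∑ (λ S → f (inside ∷ S)) (allSubsets m)
  ∑-allSubsets-suc {m} f = trans
    (∑-cartesianProductWith f _∷_ (outside ∷ inside ∷ []) (allSubsets m))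
    (cong (∑ (λ S → f (outside ∷ S)) (allSubsets m) +_) (+-identityʳ _))

  ∑-kSubsets : ∀ m k (f : Subset m → ℕ) →
    ∑ f (kSubsets m k) ≡ ∑ (λ S → 𝟙 (∣ S ∣ ≟ k) * f S) (allSubsets m)
  ∑-kSubsets m k f = ∑-filter (λ S → ∣ S ∣ ≟ k) f (allSubsets m)

  -- Induction along `A`. A colour inside `A` may or may not belong to `S`, which is Pascal's rule;
  -- a colour outside `A` cannot.
  count-allSubsets : ∀ {m} k (A : Subset m) →
    ∑ (λ S → 𝟙 (∣ S ∣ ≟ k) * 𝟙 (S ⊆? A)) (allSubsets m) ≡ ∣ A ∣ C k
  count-allSubsets zero    [] = refl
  count-allSubsets (suc k) [] = refl
  count-allSubsets {suc m} k (outside ∷ A) = begin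
    ∑ f (allSubsets (suc m))                                       ≡⟨ ∑-allSubsets-suc f ⟩
    ∑ (λ S → f (outside ∷ S)) (allSubsets m) + ∑ (λ S → f (inside ∷ S)) (allSubsets m)
      ≡⟨ cong₂ _+_ (∑-cong (allSubsets m) λ S → cong (𝟙 (∣ S ∣ ≟ k) *_)
                     (𝟙-cong (outside ∷ S ⊆? outside ∷ A) (S ⊆? A) drop-∷-⊆ out⊆))
                   (∑-cong (allSubsets m) λ S → trans (cong (𝟙 (suc ∣ S ∣ ≟ k) *_)
                     (𝟙-no (inside ∷ S ⊆? outside ∷ A) λ le → in∉out (le here)))
                     (*-zeroʳ (𝟙 (suc ∣ S ∣ ≟ k)))) ⟩
    ∑ (λ S → 𝟙 (∣ S ∣ ≟ k) * 𝟙 (S ⊆? A)) (allSubsets m) + ∑ (λ S → 0) (allSubsets m)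
      ≡⟨ cong₂ _+_ (count-allSubsets k A) (trans (∑-const 0 (allSubsets m)) (*-zeroʳ (length (allSubsets m)))) ⟩
    ∣ A ∣ C k + 0                                                  ≡⟨ +-identityʳ _ ⟩
    ∣ A ∣ C k                                                      ∎
    where
    open ≡-Reasoning
    f : Subset (suc m) → ℕ
    f S = 𝟙 (∣ S ∣ ≟ k) * 𝟙 (S ⊆? outside ∷ A)
    in∉out : ¬ zero ∈ˢ (outside ∷ A)
    in∉out ()
  count-allSubsets {suc m} zero (inside ∷ A) = begin
    ∑ f (allSubsets (suc m))                                       ≡⟨ ∑-allSubsets-suc f ⟩
    ∑ (λ S → f (outside ∷ S)) (allSubsets m) + ∑ (λ S → f (inside ∷ S)) (allSubsets m)
      ≡⟨ cong₂ _+_ (∑-cong (allSubsets m) λ S → cong (𝟙 (∣ S ∣ ≟ 0) *_)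
                     (𝟙-cong (outside ∷ S ⊆? inside ∷ A) (S ⊆? A) drop-∷-⊆ out⊆))
                   (trans (∑-const 0 (allSubsets m)) (*-zeroʳ (length (allSubsets m)))) ⟩
    ∑ (λ S → 𝟙 (∣ S ∣ ≟ 0) * 𝟙 (S ⊆? A)) (allSubsets m) + 0        ≡⟨ +-identityʳ _ ⟩
    ∑ (λ S → 𝟙 (∣ S ∣ ≟ 0) * 𝟙 (S ⊆? A)) (allSubsets m)            ≡⟨ count-allSubsets 0 A ⟩
    ∣ A ∣ C 0                                                      ∎
    where
    open ≡-Reasoning
    f : Subset (suc m) → ℕ
    f S = 𝟙 (∣ S ∣ ≟ 0) * 𝟙 (S ⊆? inside ∷ A)
  count-allSubsets {suc m} (suc k) (inside ∷ A) = begin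
    ∑ f (allSubsets (suc m))                                       ≡⟨ ∑-allSubsets-suc f ⟩
    ∑ (λ S → f (outside ∷ S)) (allSubsets m) + ∑ (λ S → f (inside ∷ S)) (allSubsets m)
      ≡⟨ cong₂ _+_ (∑-cong (allSubsets m) λ S → cong (𝟙 (∣ S ∣ ≟ suc k) *_)
                     (𝟙-cong (outside ∷ S ⊆? inside ∷ A) (S ⊆? A) drop-∷-⊆ out⊆))
                   (∑-cong (allSubsets m) λ S → cong₂ _*_
                     (𝟙-cong (suc ∣ S ∣ ≟ suc k) (∣ S ∣ ≟ k) suc-injective (cong suc))
                     (𝟙-cong (inside ∷ S ⊆? inside ∷ A) (S ⊆? A) drop-∷-⊆ in⊆in)) ⟩
    ∑ (λ S → 𝟙 (∣ S ∣ ≟ suc k) * 𝟙 (S ⊆? A)) (allSubsets m) + ∑ (λ S → 𝟙 (∣ S ∣ ≟ k) * 𝟙 (S ⊆? A)) (allSubsets m)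
      ≡⟨ cong₂ _+_ (count-allSubsets (suc k) A) (count-allSubsets k A) ⟩
    ∣ A ∣ C suc k + ∣ A ∣ C k                                      ≡⟨ +-comm (∣ A ∣ C suc k) _ ⟩
    ∣ A ∣ C k + ∣ A ∣ C suc k                                      ≡⟨ nCk+nC[k+1]≡[n+1]C[k+1] ∣ A ∣ k ⟩
    suc ∣ A ∣ C suc k                                              ∎
    where
    open ≡-Reasoning
    f : Subset (suc m) → ℕ
    f S = 𝟙 (∣ S ∣ ≟ suc k) * 𝟙 (S ⊆? inside ∷ A)

  count-kSubsets : ∀ {m} k (A : Subset m) → ∑ (λ S → 𝟙 (S ⊆? A)) (kSubsets m k) ≡ ∣ A ∣ C k
  count-kSubsets {m} k A = trans (∑-kSubsets m k _) (count-allSubsets k A)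

  length-kSubsets : ∀ m k → length (kSubsets m k) ≡ m C k
  length-kSubsets m k = begin
    length (kSubsets m k)                    ≡⟨ ∑-1 (kSubsets m k) ⟨
    ∑ (λ _ → 1) (kSubsets m k)               ≡⟨ ∑-cong (kSubsets m k) (λ S → 𝟙-yes (S ⊆? ⊤) ⊆⊤) ⟨
    ∑ (λ S → 𝟙 (S ⊆? ⊤)) (kSubsets m k)      ≡⟨ count-kSubsets {m} k ⊤ ⟩
    ∣ ⊤ {m} ∣ C k                            ≡⟨ cong (_C k) (∣⊤∣≡n m) ⟩
    m C k                                    ∎
    where open ≡-Reasoning

  ∈-kSubsets⁻ : ∀ {m k} {S : Subset m} → S ∈ kSubsets m k → ∣ S ∣ ≡ k
  ∈-kSubsets⁻ {m} {k} p with ∈-filter⁻ (λ S → ∣ S ∣ ≟ k) {xs = allSubsets m} p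
  ... | _ , eq = eq

  -- The formula n(n-1)/2, written so that it needs neither division nor truncated subtraction.
  nC2 : ∀ n → n C 2 + n C 2 + n ≡ n * n
  nC2 zero    = refl
  nC2 (suc n) = begin
    suc n C 2 + suc n C 2 + suc n           ≡⟨ cong (λ c → c + c + suc n) (nCk+nC[k+1]≡[n+1]C[k+1] n 1) ⟨
    (n C 1 + n C 2) + (n C 1 + n C 2) + suc n   ≡⟨ cong (λ c → (c + n C 2) + (c + n C 2) + suc n) (nC1≡n n) ⟩
    (n + n C 2) + (n + n C 2) + suc n       ≡⟨ lem n (n C 2) ⟩
    n C 2 + n C 2 + n + (n + suc n)         ≡⟨ cong (_+ (n + suc n)) (nC2 n) ⟩
    n * n + (n + suc n)                     ≡⟨ lem′ n ⟩
    suc n * suc n                           ∎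
    where
    open ≡-Reasoning
    lem : ∀ n c → (n + c) + (n + c) + suc n ≡ c + c + n + (n + suc n)
    lem = solve-∀
    lem′ : ∀ n → n * n + (n + suc n) ≡ suc n * suc n
    lem′ = solve-∀

  weight-subset : ∀ {m} a b (S : Subset m) →
    weight (λ _ s → if s then a else b) S ≡ a ^ ∣ S ∣ * b ^ ∣ ∁ S ∣
  weight-subset a b []            = refl
  weight-subset a b (outside ∷ S) rewrite weight-subset a b S = lem b (a ^ ∣ S ∣) (b ^ ∣ ∁ S ∣)
    where
    lem : ∀ b x y → b * (x * y) ≡ x * (b * y)
    lem = solve-∀
  weight-subset a b (inside ∷ S)  rewrite weight-subset a b S = sym (*-assoc a (a ^ ∣ S ∣) _)

  -- One term of the binomial theorem. Expanding the power gives a sum over all subsets, in which a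
  -- subset S has weight a^|S| b^(k+l-|S|); only those of size `k` are kept.
  nCk*a^k*b^l≤ : ∀ k l a b → ((k + l) C k) * (a ^ k * b ^ l) ≤ (b + a) ^ (k + l)
  nCk*a^k*b^l≤ k l a b = begin
    ((k + l) C k) * (a ^ k * b ^ l)                              ≡⟨ cong (_* (a ^ k * b ^ l)) (length-kSubsets (k + l) k) ⟨
    length (kSubsets (k + l) k) * (a ^ k * b ^ l)              ≡⟨ ∑-const _ (kSubsets (k + l) k) ⟨
    ∑ (λ _ → a ^ k * b ^ l) (kSubsets (k + l) k)               ≤⟨ ∑-mono-∈ (kSubsets (k + l) k) (λ {S} S∈ → ≤-reflexive (eq S S∈)) ⟩
    ∑ (weight w) (kSubsets (k + l) k)                          ≡⟨ ∑-kSubsets (k + l) k (weight w) ⟩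
    ∑ (λ S → 𝟙 (∣ S ∣ ≟ k) * weight w S) (allSubsets (k + l))  ≤⟨ ∑-mono (allSubsets (k + l)) (λ S → *-monoˡ-≤ (weight w S) (𝟙≤1 (∣ S ∣ ≟ k))) ⟩
    ∑ (λ S → 1 * weight w S) (allSubsets (k + l))              ≡⟨ ∑-cong (allSubsets (k + l)) (λ S → *-identityˡ (weight w S)) ⟩
    ∑ (weight w) (allSubsets (k + l))                          ≡⟨ ∑-weight (k + l) w (outside ∷ inside ∷ []) ⟩
    ∏ {k + l} (λ _ → b + (a + 0))                              ≡⟨ ∏-const (k + l) _ ⟩
    (b + (a + 0)) ^ (k + l)                                    ≡⟨ cong (λ z → (b + z) ^ (k + l)) (+-identityʳ a) ⟩
    (b + a) ^ (k + l)                                          ∎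
    where
    open ≤-Reasoning
    open import Data.Bool.Base using (Bool)
    open import Data.Fin.Subset.Properties using (∣∁p∣≡n∸∣p∣)
    w : ∀ {n} → Fin n → Bool → ℕ
    w _ s = if s then a else b
    eq : ∀ S → S ∈ kSubsets (k + l) k → a ^ k * b ^ l ≡ weight w S
    eq S S∈ = sym (trans (weight-subset a b S) (cong₂ (λ x y → a ^ x * b ^ y) ∣S∣
      (trans (∣∁p∣≡n∸∣p∣ S) (trans (cong (k + l ∸_) ∣S∣) (m+n∸m≡n k l)))))
      where ∣S∣ = ∈-kSubsets⁻ {S = S} S∈

-- The union bound over colour sets of components.

module Disconnected where

  open import Data.Bool.Base using (if_then_else_)
  open import Data.Fin.Base using (Fin; zero; suc)
  import Data.Fin.Properties as Fin
  open import Data.Fin.Subset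
    using (Subset; inside; outside; ∣_∣; _∈_; _⊆_; ∁; ⊥; _∪_)
  open import Data.Fin.Subset.Properties
    using (_⊆?_; ∉⊥; x∈p∪q⁺; x∈p∪q⁻; ∣⊥∣≡0; p⊆q⇒∣p∣≤∣q∣; x∉p⇒x∈∁p; x∈p∩q⁺; ∣∁p∣≡n∸∣p∣;
           ∣p∣≤n)
  open import Data.List.Base using (List; []; _∷_; length; filter; downFrom)
  import Data.List.Membership.Propositional as List
  open import Data.List.Membership.Propositional.Properties using (∈-downFrom⁺; ∈-filter⁺)
  open import Data.Nat.Base hiding (_⊔_)
  open import Data.Nat.Combinatorics using (_C_)
  open import Data.Nat.Properties
  open import Data.Nat.Tactic.RingSolver using (solve-∀)
  open import Data.Product.Base using (∃; _×_; _,_)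
  open import Data.Sum.Base using (_⊎_; inj₁; inj₂; [_,_]′)
  open import Data.Vec.Base using (Vec; []; _∷_; lookup; count)
  open import Defs hiding (∑-++)
  open import Function.Base using (_∘_)
  open import Level using (0ℓ)
  open import Relation.Binary.Construct.Closure.ReflexiveTransitive
    using (Star; ε; _◅_; _◅◅_; reverse)
  open import Relation.Binary.PropositionalEquality
  open import Relation.Nullary using (¬_; yes; no; does)
  open import Relation.Nullary.Decidable using (_×-dec_; _⊎-dec_; ¬?)
  open import Relation.Nullary.Negation using (contradiction)
  open import Relation.Unary using (Pred; Decidable)
  open Counting

  ∣p∪q∣≤∣p∣+∣q∣ : ∀ {m} (p q : Subset m) → ∣ p ∪ q ∣ ≤ ∣ p ∣ + ∣ q ∣
  ∣p∪q∣≤∣p∣+∣q∣ []            []            = z≤n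
  ∣p∪q∣≤∣p∣+∣q∣ (outside ∷ p) (outside ∷ q) = ∣p∪q∣≤∣p∣+∣q∣ p q
  ∣p∪q∣≤∣p∣+∣q∣ (outside ∷ p) (inside ∷ q)  =
    ≤-trans (s≤s (∣p∪q∣≤∣p∣+∣q∣ p q)) (≤-reflexive (sym (+-suc ∣ p ∣ ∣ q ∣)))
  ∣p∪q∣≤∣p∣+∣q∣ (inside ∷ p)  (outside ∷ q) = s≤s (∣p∪q∣≤∣p∣+∣q∣ p q)
  ∣p∪q∣≤∣p∣+∣q∣ (inside ∷ p)  (inside ∷ q)  = s≤s (≤-trans (∣p∪q∣≤∣p∣+∣q∣ p q) (+-monoʳ-≤ ∣ p ∣ (n≤1+n ∣ q ∣)))

  ⋃ : ∀ {n m} {P : Pred (Fin n) 0ℓ} → Decidable P → Vec (Subset m) n → Subset m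
  ⋃ P? []      = ⊥
  ⋃ P? (S ∷ F) = if does (P? zero) then S ∪ ⋃ (P? ∘ suc) F else ⋃ (P? ∘ suc) F

  ∈⋃⁺ : ∀ {n m} {P : Pred (Fin n) 0ℓ} (P? : Decidable P) (F : Vec (Subset m) n) {i c} →
        P i → c ∈ lookup F i → c ∈ ⋃ P? F
  ∈⋃⁺ P? (S ∷ F) {zero} Pi c∈ with P? zero
  ... | yes _  = x∈p∪q⁺ (inj₁ c∈)
  ... | no ¬Pi = contradiction Pi ¬Pi
  ∈⋃⁺ P? (S ∷ F) {suc i} Pi c∈ with P? zero
  ... | yes _  = x∈p∪q⁺ (inj₂ (∈⋃⁺ (P? ∘ suc) F Pi c∈))
  ... | no _   = ∈⋃⁺ (P? ∘ suc) F Pi c∈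

  ∈⋃⁻ : ∀ {n m} {P : Pred (Fin n) 0ℓ} (P? : Decidable P) (F : Vec (Subset m) n) {c} →
        c ∈ ⋃ P? F → ∃ λ i → P i × c ∈ lookup F i
  ∈⋃⁻ P? []      c∈ = contradiction c∈ ∉⊥
  ∈⋃⁻ P? (S ∷ F) c∈ with P? zero
  ∈⋃⁻ P? (S ∷ F) c∈ | yes P0 with x∈p∪q⁻ S (⋃ (P? ∘ suc) F) c∈
  ... | inj₁ c∈S = zero , P0 , c∈S
  ... | inj₂ c∈⋃ with i , Pi , c∈Fi ← ∈⋃⁻ (P? ∘ suc) F c∈⋃ = suc i , Pi , c∈Fi
  ∈⋃⁻ P? (S ∷ F) c∈ | no _ with i , Pi , c∈Fi ← ∈⋃⁻ (P? ∘ suc) F c∈ = suc i , Pi , c∈Fi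

  -- Each set that enters the union adds at most two colours and is counted on the right because it
  -- lies in `A`. Applied to a component, this says that its colours require at least half as many
  -- nodes.
  ∣⋃∣≤ : ∀ {n m} {P : Pred (Fin n) 0ℓ} (P? : Decidable P) (F : Vec (Subset m) n) (A : Subset m) →
         (∀ i → ∣ lookup F i ∣ ≡ 2) → (∀ i → P i → lookup F i ⊆ A) →
         ∣ ⋃ P? F ∣ ≤ 2 * count (_⊆? A) F
  ∣⋃∣≤ {m = m} P? [] A ∣F∣ F⊆ = ≤-reflexive (∣⊥∣≡0 m)
  ∣⋃∣≤ P? (S ∷ F) A ∣F∣ F⊆ with P? zero | S ⊆? A
  ... | yes P0 | yes _   = begin
    ∣ S ∪ ⋃ (P? ∘ suc) F ∣          ≤⟨ ∣p∪q∣≤∣p∣+∣q∣ S (⋃ (P? ∘ suc) F) ⟩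
    ∣ S ∣ + ∣ ⋃ (P? ∘ suc) F ∣      ≤⟨ +-mono-≤ (≤-reflexive (∣F∣ zero)) (∣⋃∣≤ (P? ∘ suc) F A (∣F∣ ∘ suc) (F⊆ ∘ suc)) ⟩
    2 + 2 * count (_⊆? A) F         ≡⟨ *-suc 2 (count (_⊆? A) F) ⟨
    2 * suc (count (_⊆? A) F)       ∎
    where open ≤-Reasoning
  ... | yes P0 | no S⊈A  = contradiction (λ {x} → F⊆ zero P0 {x}) S⊈A
  ... | no _   | yes _   = ≤-trans (∣⋃∣≤ (P? ∘ suc) F A (∣F∣ ∘ suc) (F⊆ ∘ suc)) (*-monoʳ-≤ 2 (n≤1+n _))
  ... | no _   | no _    = ∣⋃∣≤ (P? ∘ suc) F A (∣F∣ ∘ suc) (F⊆ ∘ suc)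

  Separated : ∀ {n m} → Subset m → Vec (Subset m) n → Set
  Separated A F = ∀ i → lookup F i ⊆ A ⊎ lookup F i ⊆ ∁ A

  -- Necessary for A to be the colour set of a component, and all that the
  -- union bound needs.
  Enclosed : ∀ {n m} → Subset m → Vec (Subset m) n → Set
  Enclosed A F = Separated A F × ∣ A ∣ ≤ 2 * count (_⊆? A) F

  enclosed? : ∀ {n m} (A : Subset m) → Decidable (Enclosed {n} A)
  enclosed? A F = Fin.all? (λ i → (lookup F i ⊆? A) ⊎-dec (lookup F i ⊆? ∁ A)) ×-dec (∣ A ∣ ≤? 2 * count (_⊆? A) F)

  module _ {n m} (F : Vec (Subset m) n) (∣F∣ : ∀ i → ∣ lookup F i ∣ ≡ 2) where

    private
      Reach : Fin n → Fin n → Set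
      Reach = Star (Adj (intersectionGraph F))

      reach? : ∀ u → Decidable (Reach u)
      reach? u = Reachability.reachable? (adj? (intersectionGraph F)) u

    -- Adjacency demands distinct nodes, so a shared colour yields an edge only when `w` and `w′`
    -- differ; otherwise there is nothing to show.
    sharing : ∀ {u w w′ c} → Reach u w → c ∈ lookup F w → c ∈ lookup F w′ → Reach u w′
    sharing {u} {w} {w′} p c∈ c∈′ with w Fin.≟ w′
    ... | yes refl = p
    ... | no w≢w′  = p ◅◅ ((w≢w′ , _ , x∈p∩q⁺ (c∈ , c∈′)) ◅ ε)

    component : Fin n → Subset m
    component u = ⋃ (reach? u) F

    component-⊇ : ∀ {u i} → Reach u i → lookup F i ⊆ component u
    component-⊇ {u} p = ∈⋃⁺ (reach? u) F p

    component-∁ : ∀ {u i} → ¬ Reach u i → lookup F i ⊆ ∁ (component u)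
    component-∁ {u} ¬p c∈ = x∉p⇒x∈∁p λ c∈A → let _ , q , c∈′ = ∈⋃⁻ (reach? u) F c∈A in ¬p (sharing q c∈′ c∈)

    component-enclosed : ∀ u → Enclosed (component u) F
    component-enclosed u = separated , ∣⋃∣≤ (reach? u) F (component u) ∣F∣ (λ i p → component-⊇ p)
      where
      separated : Separated (component u) F
      separated i with reach? u i
      ... | yes p = inj₁ (component-⊇ p)
      ... | no ¬p = inj₂ (component-∁ ¬p)

    0<∣component∣ : ∀ u → 0 < ∣ component u ∣
    0<∣component∣ u = ≤-trans (s≤s z≤n) (≤-trans (≤-reflexive (sym (∣F∣ u))) (p⊆q⇒∣p∣≤∣q∣ (component-⊇ {u} {u} ε)))

    components-disjoint : ∀ {u v} → ¬ Reach u v → ∣ component u ∣ + ∣ component v ∣ ≤ m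
    components-disjoint {u} {v} ¬p = begin
      ∣ component u ∣ + ∣ component v ∣        ≤⟨ +-monoʳ-≤ ∣ component u ∣ (p⊆q⇒∣p∣≤∣q∣ ⊆∁) ⟩
      ∣ component u ∣ + ∣ ∁ (component u) ∣    ≡⟨ cong (∣ component u ∣ +_) (∣∁p∣≡n∸∣p∣ (component u)) ⟩
      ∣ component u ∣ + (m ∸ ∣ component u ∣)  ≡⟨ m+[n∸m]≡n (∣p∣≤n (component u)) ⟩
      m                                        ∎
      where
      open ≤-Reasoning
      ⊆∁ : component v ⊆ ∁ (component u)
      ⊆∁ c∈ with w , q , c∈w ← ∈⋃⁻ (reach? v) F c∈ = component-∁ (λ p → ¬p (p ◅◅ reverse (symmetric (intersectionGraph F)) q)) c∈w

    -- Decidability of reachability turns the negation into two nodes in different components. Their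
    -- colour sets are disjoint, so the smaller one has at most m/2 colours.
    disconnected⇒enclosed : ¬ Connected (intersectionGraph F) →
      ∃ λ A → 0 < ∣ A ∣ × ∣ A ∣ + ∣ A ∣ ≤ m × Enclosed A F
    disconnected⇒enclosed ¬conn
      with u , ¬u ← Fin.¬∀⟶∃¬ n _ (λ u → Fin.all? (reach? u)) ¬conn
      with v , ¬p ← Fin.¬∀⟶∃¬ n _ (reach? u) ¬u
      with ≤-total ∣ component u ∣ ∣ component v ∣
    ... | inj₁ u≤v = component u , 0<∣component∣ u ,
      ≤-trans (+-monoʳ-≤ ∣ component u ∣ u≤v) (components-disjoint ¬p) , component-enclosed u
    ... | inj₂ v≤u = component v , 0<∣component∣ v ,
      ≤-trans (+-monoˡ-≤ ∣ component v ∣ v≤u) (components-disjoint ¬p) , component-enclosed v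

  module _ (λ₁ λ₂ : ℕ) where

    -- The weight w of the Markov argument multiplied by λ₂, to stay within the naturals. A set that
    -- meets both `A` and its complement gets 0.
    side : ∀ {m} → Subset m → Subset m → ℕ
    side A S = λ₁ * 𝟙 (S ⊆? A) + λ₂ * 𝟙 (S ⊆? ∁ A)

    separated-weight : ∀ {n m} (A : Subset m) (F : Vec (Subset m) n) → Separated A F →
      ∃ λ s → count (_⊆? A) F + s ≡ n × λ₁ ^ count (_⊆? A) F * λ₂ ^ s ≤ weight (λ _ → side A) F
    separated-weight A []      sep = 0 , refl , ≤-refl
    separated-weight A (S ∷ F) sep with s , eq , le ← separated-weight A F (sep ∘ suc) with S ⊆? A
    ... | yes _ = s , cong suc eq , (begin
      λ₁ * λ₁ ^ t * λ₂ ^ s                ≡⟨ *-assoc λ₁ (λ₁ ^ t) _ ⟩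
      λ₁ * (λ₁ ^ t * λ₂ ^ s)              ≤⟨ *-mono-≤ (≤-trans (≤-reflexive (sym (*-identityʳ λ₁))) (m≤m+n (λ₁ * 1) _)) le ⟩
      (λ₁ * 1 + λ₂ * 𝟙 (S ⊆? ∁ A)) * weight (λ _ → side A) F  ∎)
      where
      open ≤-Reasoning
      t = count (_⊆? A) F
    ... | no S⊈A = suc s , trans (+-suc t s) (cong suc eq) , (begin
      λ₁ ^ t * (λ₂ * λ₂ ^ s)              ≡⟨ lem (λ₁ ^ t) λ₂ (λ₂ ^ s) ⟩
      λ₂ * (λ₁ ^ t * λ₂ ^ s)              ≤⟨ *-mono-≤ λ₂≤ le ⟩
      (λ₁ * 0 + λ₂ * 𝟙 (S ⊆? ∁ A)) * weight (λ _ → side A) F  ∎)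
      where
      open ≤-Reasoning
      t = count (_⊆? A) F
      lem : ∀ a b c → a * (b * c) ≡ b * (a * c)
      lem = solve-∀
      S⊆∁A : S ⊆ ∁ A
      S⊆∁A = [ (λ h → contradiction (λ {x} → h {x}) S⊈A) , (λ h {x} → h {x}) ]′ (sep zero)
      λ₂≤ : λ₂ ≤ λ₁ * 0 + λ₂ * 𝟙 (S ⊆? ∁ A)
      λ₂≤ rewrite 𝟙-yes (S ⊆? ∁ A) S⊆∁A = ≤-trans (≤-reflexive (sym (*-identityʳ λ₂))) (m≤n+m (λ₂ * 1) _)

    -- With t nodes inside `A` the weight is at least λ₁^t λ₂^(n-t). Squaring gives λ₁^(2t), and
    -- since 2t ≥ a, the excess e = 2t - a of these factors may be lowered from λ₁ to λ₂. Without
    -- the square, an odd a would require the root of λ₁.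
    enclosed-weight : ∀ {n m} (A : Subset m) (F : Vec (Subset m) n) → λ₂ ≤ λ₁ → Enclosed A F →
      λ₁ ^ ∣ A ∣ * (λ₂ ^ n * λ₂ ^ n) ≤ λ₂ ^ ∣ A ∣ * (weight (λ _ → side A) F * weight (λ _ → side A) F)
    enclosed-weight {n} A F λ₂≤λ₁ (sep , A≤) with s , eq , le ← separated-weight A F sep = begin
      λ₁ ^ a * (λ₂ ^ n * λ₂ ^ n)                    ≡⟨ cong (λ z → λ₁ ^ a * (λ₂ ^ z * λ₂ ^ z)) (sym eq) ⟩
      λ₁ ^ a * (λ₂ ^ (t + s) * λ₂ ^ (t + s))        ≡⟨ cong (λ z → λ₁ ^ a * (z * z)) (^-distribˡ-+-* λ₂ t s) ⟩
      λ₁ ^ a * ((λ₂ ^ t * λ₂ ^ s) * (λ₂ ^ t * λ₂ ^ s))  ≡⟨ lem₁ (λ₁ ^ a) (λ₂ ^ t) (λ₂ ^ s) ⟩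
      λ₁ ^ a * (λ₂ ^ t * λ₂ ^ t) * (λ₂ ^ s * λ₂ ^ s)    ≡⟨ cong (λ z → λ₁ ^ a * z * (λ₂ ^ s * λ₂ ^ s)) (double λ₂) ⟩
      λ₁ ^ a * (λ₂ ^ a * λ₂ ^ e) * (λ₂ ^ s * λ₂ ^ s)    ≤⟨ *-monoˡ-≤ (λ₂ ^ s * λ₂ ^ s) (*-monoʳ-≤ (λ₁ ^ a) (*-monoʳ-≤ (λ₂ ^ a) (^-monoˡ-≤ e λ₂≤λ₁))) ⟩
      λ₁ ^ a * (λ₂ ^ a * λ₁ ^ e) * (λ₂ ^ s * λ₂ ^ s)    ≡⟨ lem₂ (λ₁ ^ a) (λ₂ ^ a) (λ₁ ^ e) (λ₂ ^ s * λ₂ ^ s) ⟩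
      λ₂ ^ a * ((λ₁ ^ a * λ₁ ^ e) * (λ₂ ^ s * λ₂ ^ s))  ≡⟨ cong (λ z → λ₂ ^ a * (z * (λ₂ ^ s * λ₂ ^ s))) (double λ₁) ⟨
      λ₂ ^ a * ((λ₁ ^ t * λ₁ ^ t) * (λ₂ ^ s * λ₂ ^ s))  ≡⟨ lem₃ (λ₂ ^ a) (λ₁ ^ t) (λ₂ ^ s) ⟩
      λ₂ ^ a * ((λ₁ ^ t * λ₂ ^ s) * (λ₁ ^ t * λ₂ ^ s))  ≤⟨ *-monoʳ-≤ (λ₂ ^ a) (*-mono-≤ le le) ⟩
      λ₂ ^ a * (weight (λ _ → side A) F * weight (λ _ → side A) F) ∎
      where
      open ≤-Reasoning
      a = ∣ A ∣
      t = count (_⊆? A) F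
      e = t + t ∸ a
      t+t : t + t ≡ a + e
      t+t = sym (m+[n∸m]≡n (≤-trans A≤ (≤-reflexive (cong (t +_) (+-identityʳ t)))))
      double : ∀ x → x ^ t * x ^ t ≡ x ^ a * x ^ e
      double x = trans (sym (^-distribˡ-+-* x t t)) (trans (cong (x ^_) t+t) (^-distribˡ-+-* x a e))
      lem₁ : ∀ x y z → x * ((y * z) * (y * z)) ≡ x * (y * y) * (z * z)
      lem₁ = solve-∀
      lem₂ : ∀ x y z w → x * (y * z) * w ≡ y * ((x * z) * w)
      lem₂ = solve-∀
      lem₃ : ∀ x y z → x * ((y * y) * (z * z)) ≡ x * ((y * z) * (y * z))
      lem₃ = solve-∀

    ∑-side : ∀ {m} (A : Subset m) → ∑ (side A) (kSubsets m 2) ≡ λ₁ * (∣ A ∣ C 2) + λ₂ * (∣ ∁ A ∣ C 2)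
    ∑-side {m} A = trans (∑-+ _ _ (kSubsets m 2)) (cong₂ _+_
      (trans (∑-*ˡ λ₁ _ (kSubsets m 2)) (cong (λ₁ *_) (count-kSubsets {m} 2 A)))
      (trans (∑-*ˡ λ₂ _ (kSubsets m 2)) (cong (λ₂ *_) (count-kSubsets {m} 2 (∁ A)))))

  m*m≤n*n⇒m≤n : ∀ {m n} → m * m ≤ n * n → m ≤ n
  m*m≤n*n⇒m≤n {m} {n} le with m ≤? n
  ... | yes m≤n = m≤n
  ... | no  m≰n = contradiction le (<⇒≱ (*-mono-< (≰⇒> m≰n) (≰⇒> m≰n)))

  -- Markov's inequality for the threshold √(y/z), squared so that no root occurs.
  markov² : ∀ {A : Set} {P : Pred A 0ℓ} (P? : Decidable P) (f : A → ℕ) y z xs →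
    (∀ x → P x → y ≤ z * (f x * f x)) →
    ∑ (𝟙 ∘ P?) xs * ∑ (𝟙 ∘ P?) xs * y ≤ z * (∑ f xs * ∑ f xs)
  markov² P? f y z []       h = z≤n
  markov² P? f y z (x ∷ xs) h with markov² P? f y z xs h | P? x
  ... | ih | no _   = ≤-trans ih (*-monoʳ-≤ z (*-mono-≤ (m≤n+m _ (f x)) (m≤n+m _ (f x))))
  ... | ih | yes Px = begin
    (1 + e) * (1 + e) * y                          ≡⟨ lem₁ e y ⟩
    y + 2 * (e * y) + e * e * y                    ≤⟨ +-mono-≤ (+-mono-≤ (h x Px) (*-monoʳ-≤ 2 cross)) ih ⟩
    z * (w * w) + 2 * (z * (w * s)) + z * (s * s)  ≡⟨ lem₂ z w s ⟩
    z * ((w + s) * (w + s))                        ∎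
    where
    open ≤-Reasoning
    e = ∑ (𝟙 ∘ P?) xs
    w = f x
    s = ∑ f xs
    lem₁ : ∀ e y → (1 + e) * (1 + e) * y ≡ y + 2 * (e * y) + e * e * y
    lem₁ = solve-∀
    lem₂ : ∀ z w s → z * (w * w) + 2 * (z * (w * s)) + z * (s * s) ≡ z * ((w + s) * (w + s))
    lem₂ = solve-∀
    lem₃ : ∀ e y → e * y * (e * y) ≡ e * e * y * y
    lem₃ = solve-∀
    lem₄ : ∀ z w s → z * (s * s) * (z * (w * w)) ≡ z * (w * s) * (z * (w * s))
    lem₄ = solve-∀
    -- The mixed term of the square: the induction hypothesis and the bound at `x` are multiplied,
    -- and both sides of the result are perfect squares once multiplied out suitably.
    cross : e * y ≤ z * (w * s)
    cross = m*m≤n*n⇒m≤n (begin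
      e * y * (e * y)                  ≡⟨ lem₃ e y ⟩
      e * e * y * y                    ≤⟨ *-mono-≤ ih (h x Px) ⟩
      z * (s * s) * (z * (w * w))      ≡⟨ lem₄ z w s ⟩
      z * (w * s) * (z * (w * s))      ∎)

  -- Used with `xs` the sets of one size: a bound for a single set that already includes the number
  -- of sets as a factor gives a bound for all of them together.
  average : ∀ {A : Set} (f : A → ℕ) D T xs → (∀ {x} → x List.∈ xs → length xs * D * f x ≤ T) →
            ∑ f xs * D ≤ T
  average f D T []          h = z≤n
  average f D T xs@(_ ∷ _) h = *-cancelˡ-≤ (length xs) (begin
    length xs * (∑ f xs * D)            ≡⟨ lem (length xs) (∑ f xs) D ⟩
    length xs * D * ∑ f xs              ≡⟨ ∑-*ˡ (length xs * D) f xs ⟨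
    ∑ (λ x → length xs * D * f x) xs    ≤⟨ ∑-mono-∈ xs h ⟩
    ∑ (λ _ → T) xs                      ≡⟨ ∑-const T xs ⟩
    length xs * T                       ∎)
    where
    open ≤-Reasoning
    lem : ∀ l s D → l * (s * D) ≡ l * D * s
    lem = solve-∀

  -- With D = d + 1, the sum of D^(-j) over j = 1, ..., r is (1 - D^(-r)) / d. The extra `T` on the
  -- left is the term D^(-r), which the induction needs.
  geometric : ∀ d T (b : ℕ → ℕ) r → (∀ {p} → p < r → b p * suc d ^ suc p ≤ T) →
              d * ∑ b (downFrom r) * suc d ^ r + T ≤ T * suc d ^ r
  geometric d T b zero    h = ≤-reflexive (lem d T)
    where
    lem : ∀ d T → d * 0 * 1 + T ≡ T * 1
    lem = solve-∀
  geometric d T b (suc r) h = +-cancelʳ-≤ (d * T) _ _ (begin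
    d * (b r + s) * (suc d * D) + T + d * T           ≡⟨ lem₁ d (b r) s D T ⟩
    d * (b r * (suc d * D)) + suc d * (d * s * D + T) ≤⟨ +-mono-≤ (*-monoʳ-≤ d (h ≤-refl)) (*-monoʳ-≤ (suc d) (geometric d T b r (h ∘ m<n⇒m<1+n))) ⟩
    d * T + suc d * (T * D)                           ≡⟨ lem₂ d T D ⟩
    T * (suc d * D) + d * T                           ∎)
    where
    open ≤-Reasoning
    s = ∑ b (downFrom r)
    D = suc d ^ r
    lem₁ : ∀ d b s D T → d * (b + s) * (suc d * D) + T + d * T ≡ d * (b * (suc d * D)) + suc d * (d * s * D + T)
    lem₁ = solve-∀
    lem₂ : ∀ d T D → d * T + suc d * (T * D) ≡ T * (suc d * D) + d * T
    lem₂ = solve-∀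

  geometric-sum : ∀ d T (b : ℕ → ℕ) r → (∀ {p} → p < r → b p * suc d ^ suc p ≤ T) →
                  d * ∑ b (downFrom r) ≤ T
  geometric-sum d T b r h = *-cancelʳ-≤ _ _ (suc d ^ r) {{m^n≢0 (suc d) r}}
    (≤-trans (m≤m+n _ T) (geometric d T b r h))

  -- The tilt λ₁ / λ₂ = 1 + m² / (n a) in favour of nodes inside A is nearly
  -- optimal for having at least a / 2 of them.
  SizeEstimate : (n m d p b : ℕ) → Set
  SizeEstimate n m d p b =
    ((m C a) * suc d ^ a) * ((m C a) * suc d ^ a) * (λ₂ ^ a * (W ^ n * W ^ n)) ≤
    ((m C 2) ^ n * (m C 2) ^ n) * (λ₁ ^ a * (λ₂ ^ n * λ₂ ^ n))
    where
    a  = suc p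
    λ₁ = n * a + m * m
    λ₂ = n * a
    W  = λ₁ * (a C 2) + λ₂ * (b C 2)

  module _ (k m d : ℕ)
    (estimate : ∀ p b → suc p + b ≡ m → suc p ≤ b → SizeEstimate (suc k) m d p b) where

    private
      n = suc k
      Ω = assignments n m 2
      T = (m C 2) ^ n

      e : Subset m → ℕ
      e A = ∑ (𝟙 ∘ enclosed? A) Ω

    -- Squared Markov for the product weight, whose total over all assignments is W^n by
    -- independence. The size estimate then bounds the square of the left side times `y`, and the
    -- nonzero `y` is cancelled.
    enclosed-count : ∀ {p} (A : Subset m) → ∣ A ∣ ≡ suc p → suc p + suc p ≤ m →
                     (m C suc p) * suc d ^ suc p * e A ≤ T
    enclosed-count {p} A ∣A∣ 2a≤m = m*m≤n*n⇒m≤n (*-cancelʳ-≤ _ _ y {{y≢0}} (begin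
      cD * e A * (cD * e A) * y                     ≡⟨ lem cD (e A) y ⟩
      cD * cD * (e A * e A * y)                     ≤⟨ *-monoʳ-≤ (cD * cD) (markov² (enclosed? A) (weight (λ _ → side λ₁ λ₂ A)) y (λ₂ ^ a) Ω weight≥) ⟩
      cD * cD * (λ₂ ^ a * (∑ w Ω * ∑ w Ω))          ≡⟨ cong (λ z → cD * cD * (λ₂ ^ a * (z * z))) ∑w ⟩
      cD * cD * (λ₂ ^ a * (W ^ n * W ^ n))          ≤⟨ estimate p b a+b≡m a≤b ⟩
      T * T * y                                     ∎))
      where
      open ≤-Reasoning
      a  = suc p
      b  = m ∸ a
      λ₁ = n * a + m * m
      λ₂ = n * a
      W  = λ₁ * (a C 2) + λ₂ * (b C 2)
      cD = (m C a) * suc d ^ a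
      y  = λ₁ ^ a * (λ₂ ^ n * λ₂ ^ n)
      w : Vec (Subset m) n → ℕ
      w  = weight (λ _ → side λ₁ λ₂ A)
      y≢0 : NonZero y
      y≢0 = m*n≢0 (λ₁ ^ a) (λ₂ ^ n * λ₂ ^ n) {{m^n≢0 λ₁ a}} {{m*n≢0 (λ₂ ^ n) (λ₂ ^ n) {{m^n≢0 λ₂ n}} {{m^n≢0 λ₂ n}}}}
      a+b≡m : a + b ≡ m
      a+b≡m = m+[n∸m]≡n (≤-trans (m≤m+n a a) 2a≤m)
      a≤b : a ≤ b
      a≤b = m+n≤o⇒m≤o∸n a 2a≤m
      lem : ∀ c e y → c * e * (c * e) * y ≡ c * c * (e * e * y)
      lem = solve-∀
      weight≥ : ∀ F → Enclosed A F → y ≤ λ₂ ^ a * (w F * w F)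
      weight≥ F enc = subst (λ z → λ₁ ^ z * (λ₂ ^ n * λ₂ ^ n) ≤ λ₂ ^ z * (w F * w F)) ∣A∣
        (enclosed-weight λ₁ λ₂ A F (m≤m+n λ₂ (m * m)) enc)
      ∑w : ∑ w Ω ≡ W ^ n
      ∑w = trans (∑-weight n (λ _ → side λ₁ λ₂ A) (kSubsets m 2)) (trans (∏-const n (∑ (side λ₁ λ₂ A) (kSubsets m 2)))
        (cong (_^ n) (trans (∑-side λ₁ λ₂ A) (cong₂ (λ x z → λ₁ * (x C 2) + λ₂ * (z C 2)) ∣A∣
          (trans (∣∁p∣≡n∸∣p∣ A) (cong (m ∸_) ∣A∣))))))

    disconnected-count : d * length (filter (λ F → ¬? (connected? (intersectionGraph F))) Ω) ≤ T
    disconnected-count = begin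
      d * length (filter bad? Ω)                     ≡⟨ cong (d *_) (length-filter bad? Ω) ⟩
      d * ∑ (𝟙 ∘ bad?) Ω                             ≤⟨ *-monoʳ-≤ d (∑-mono-∈ Ω covered) ⟩
      d * ∑ (λ F → ∑ (λ p → ∑ (λ A → 𝟙 (enclosed? A F)) (sets p)) ps) Ω
        ≡⟨ cong (d *_) (trans (∑-swap (λ F p → ∑ (λ A → 𝟙 (enclosed? A F)) (sets p)) Ω ps)
             (∑-cong ps λ p → ∑-swap (λ F A → 𝟙 (enclosed? A F)) Ω (sets p))) ⟩
      d * ∑ (λ p → ∑ e (sets p)) ps                  ≤⟨ geometric-sum d T (λ p → ∑ e (sets p)) ⌊ m /2⌋ per-size ⟩
      T                                              ∎
      where
      open ≤-Reasoning
      bad? = λ (F : Vec (Subset m) n) → ¬? (connected? (intersectionGraph F))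
      -- The entry p stands for size p + 1, so the sizes are 1, ..., ⌊m/2⌋ and the empty set is left
      -- out.
      ps = downFrom ⌊ m /2⌋
      sets : ℕ → List (Subset m)
      sets p = kSubsets m (suc p)
      double : ∀ {p} → p < ⌊ m /2⌋ → suc p + suc p ≤ m
      double p< = ≤-trans (+-mono-≤ p< (≤-trans p< (⌊n/2⌋≤⌈n/2⌉ m))) (≤-reflexive (⌊n/2⌋+⌈n/2⌉≡n m))
      per-size : ∀ {p} → p < ⌊ m /2⌋ → ∑ e (sets p) * suc d ^ suc p ≤ T
      per-size {p} p< = average e (suc d ^ suc p) T (sets p) λ {A} A∈ →
        subst (λ c → c * suc d ^ suc p * e A ≤ T) (sym (length-kSubsets m (suc p)))
          (enclosed-count A (∈-kSubsets⁻ {S = A} A∈) (double p<))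
      half : ∀ {a} → a + a ≤ m → a ≤ ⌊ m /2⌋
      half {a} le = ≤-trans (≤-reflexive (n≡⌊n+n/2⌋ a)) (⌊n/2⌋-mono le)
      covered : ∀ {F} → F List.∈ Ω → 𝟙 (bad? F) ≤ ∑ (λ p → ∑ (λ A → 𝟙 (enclosed? A F)) (sets p)) ps
      covered {F} F∈ = 𝟙≤ (bad? F) λ bad → counted
        (disconnected⇒enclosed F (λ i → ∈-kSubsets⁻ {S = lookup F i} (∈-vectors⁻ (kSubsets m 2) n F∈ i)) bad)
        where
        counted : (∃ λ A → 0 < ∣ A ∣ × ∣ A ∣ + ∣ A ∣ ≤ m × Enclosed A F) →
                  1 ≤ ∑ (λ p → ∑ (λ A → 𝟙 (enclosed? A F)) (sets p)) ps
        counted (A , 0<A , 2A≤m , enc) = begin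
          1                                          ≡⟨ 𝟙-yes (enclosed? A F) enc ⟨
          𝟙 (enclosed? A F)                          ≤⟨ ≤∑ (λ A → 𝟙 (enclosed? A F)) A∈ ⟩
          ∑ (λ A → 𝟙 (enclosed? A F)) (sets p)       ≤⟨ ≤∑ (λ p → ∑ (λ A → 𝟙 (enclosed? A F)) (sets p)) p∈ ⟩
          ∑ (λ p → ∑ (λ A → 𝟙 (enclosed? A F)) (sets p)) ps ∎
          where
          p = pred ∣ A ∣
          sp : ∣ A ∣ ≡ suc p
          sp = sym (suc-pred ∣ A ∣ {{>-nonZero 0<A}})
          A∈ : A List.∈ sets p
          A∈ = ∈-filter⁺ (λ S → ∣ S ∣ ≟ suc p) (∈-allSubsets A) sp
          p∈ : p List.∈ ps
          p∈ = ∈-downFrom⁺ (≤-trans (≤-reflexive (sym sp)) (half 2A≤m))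

-- First and second moments of the number of isolated nodes, for part (ii).

module IsolatedNodes where

  open import Data.Bool.Base using (if_then_else_)
  import Data.Bool.Properties as Bool
  open import Data.Fin.Base using (Fin; zero; suc)
  import Data.Fin.Properties as Fin
  open import Data.Fin.Subset using (Subset; inside; outside; ∣_∣; _⊆_; ∁; _∩_)
    renaming (_∈_ to _∈ˢ_)
  open import Data.Fin.Subset.Properties
    using (_⊆?_; drop-∷-⊆; x∈p∩q⁺; x∈p∩q⁻; x∈∁p⇒x∉p; p∩q⊆p; p∩q⊆q; ⊆-trans; ∣∁p∣≡n∸∣p∣)
  open import Data.List.Base using (List; []; _∷_; length; filter; allFin; cartesianProduct)
  open import Data.List.Membership.Propositional using (_∈_)
  open import Data.List.Membership.Propositional.Properties using (∈-cartesianProduct⁻)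
  open import Data.List.Properties using (map-tabulate; length-tabulate)
  open import Data.Nat.Base
  open import Data.Nat.Combinatorics using (_C_)
  open import Data.Nat.Properties
  open import Data.Nat.Tactic.RingSolver using (solve-∀)
  open import Data.Product.Base using (_×_; _,_; proj₁; proj₂)
  open import Data.Sum.Base using (inj₁; inj₂)
  open import Data.Vec.Base using (Vec; []; _∷_; lookup; here)
  open import Data.Vec.Properties using (≡-dec; ∷-injective)
  open import Defs hiding (∑-++)
  open import Function.Base using (_∘_; id)
  open import Level using (0ℓ)
  open import Relation.Binary.Construct.Closure.ReflexiveTransitive using (Star; ε; _◅_)
  open import Relation.Binary.Definitions using (DecidableEquality)
  open import Relation.Binary.PropositionalEquality
  open import Relation.Nullary using (¬_; Dec; yes; no; does)
  open import Relation.Nullary.Negation using (contradiction)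
  open import Relation.Unary using (Pred; Decidable)
  open Counting

  ∏-one : ∀ {n} (f : Fin (suc n) → ℕ) v {β} → (∀ i → i ≢ v → f i ≡ β) → ∏ f ≡ f v * β ^ n
  ∏-one {n} f zero {β} h = cong (f zero *_) (constant n (f ∘ suc) λ i → h (suc i) λ ())
    where
    constant : ∀ n (g : Fin n → ℕ) → (∀ i → g i ≡ β) → ∏ g ≡ β ^ n
    constant zero    g e = refl
    constant (suc n) g e = cong₂ _*_ (e zero) (constant n (g ∘ suc) (e ∘ suc))
  ∏-one {suc n} f (suc v) {β} h = begin
    f zero * ∏ (f ∘ suc)            ≡⟨ cong₂ _*_ (h zero λ ()) (∏-one (f ∘ suc) v λ i i≢v → h (suc i) (i≢v ∘ Fin.suc-injective)) ⟩
    β * (f (suc v) * β ^ n)         ≡⟨ lem β (f (suc v)) (β ^ n) ⟩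
    f (suc v) * (β * β ^ n)         ∎
    where
    open ≡-Reasoning
    lem : ∀ a b c → a * (b * c) ≡ b * (a * c)
    lem = solve-∀

  ∏-one-≤ : ∀ {n} (f : Fin (suc n) → ℕ) v {α β} → f v ≤ α → (∀ i → i ≢ v → f i ≤ β) →
            ∏ f ≤ α * β ^ n
  ∏-one-≤ {n} f zero {β = β} hv h = *-mono-≤ hv
    (≤-trans (∏-mono λ i → h (suc i) λ ()) (≤-reflexive (∏-const n β)))
  ∏-one-≤ {suc n} f (suc v) {α} {β} hv h = begin
    f zero * ∏ (f ∘ suc)            ≤⟨ *-mono-≤ (h zero λ ()) (∏-one-≤ (f ∘ suc) v hv λ i i≢v → h (suc i) (i≢v ∘ Fin.suc-injective)) ⟩
    β * (α * β ^ n)                 ≡⟨ lem β α (β ^ n) ⟩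
    α * (β * β ^ n)                 ∎
    where
    open ≤-Reasoning
    lem : ∀ a b c → a * (b * c) ≡ b * (a * c)
    lem = solve-∀

  ∏-two-≤ : ∀ {n} (f : Fin (2 + n) → ℕ) u v {α α′ β} → u ≢ v → f u ≤ α → f v ≤ α′ →
            (∀ i → i ≢ u → i ≢ v → f i ≤ β) → ∏ f ≤ α * α′ * β ^ n
  ∏-two-≤ f zero zero u≢v hu hv h = contradiction refl u≢v
  ∏-two-≤ {n} f zero (suc v) {α} {α′} {β} u≢v hu hv h = ≤-trans
    (*-mono-≤ hu (∏-one-≤ (f ∘ suc) v hv λ i i≢v → h (suc i) (λ ()) (i≢v ∘ Fin.suc-injective)))
    (≤-reflexive (sym (*-assoc α α′ (β ^ n))))
  ∏-two-≤ {n} f (suc u) zero {α} {α′} {β} u≢v hu hv h = ≤-trans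
    (*-mono-≤ hv (∏-one-≤ (f ∘ suc) u hu λ i i≢u → h (suc i) (i≢u ∘ Fin.suc-injective) (λ ())))
    (≤-reflexive (lem α′ α (β ^ n)))
    where
    lem : ∀ a b c → a * (b * c) ≡ b * a * c
    lem = solve-∀
  ∏-two-≤ {zero} f (suc zero) (suc zero) u≢v hu hv h = contradiction refl u≢v
  ∏-two-≤ {suc n} f (suc u) (suc v) {α} {α′} {β} u≢v hu hv h = begin
    f zero * ∏ (f ∘ suc)            ≤⟨ *-mono-≤ (h zero (λ ()) (λ ()))
                                         (∏-two-≤ (f ∘ suc) u v (u≢v ∘ cong suc) hu hv λ i i≢u i≢v →
                                            h (suc i) (i≢u ∘ Fin.suc-injective) (i≢v ∘ Fin.suc-injective)) ⟩
    β * (α * α′ * β ^ n)            ≡⟨ lem β (α * α′) (β ^ n) ⟩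
    α * α′ * (β * β ^ n)            ∎
    where
    open ≤-Reasoning
    lem : ∀ a b c → a * (b * c) ≡ b * (a * c)
    lem = solve-∀

  _≟ˢ_ : ∀ {m} → DecidableEquality (Subset m)
  _≟ˢ_ = ≡-dec Bool._≟_

  ∑-allSubsets-≟ : ∀ {m} (S : Subset m) → ∑ (λ x → 𝟙 (x ≟ˢ S)) (allSubsets m) ≡ 1
  ∑-allSubsets-≟ {zero}  []            = refl
  ∑-allSubsets-≟ {suc m} (outside ∷ S) = trans (∑-allSubsets-suc (λ x → 𝟙 (x ≟ˢ (outside ∷ S)))) (cong₂ _+_
    (trans (∑-cong (allSubsets m) λ x → 𝟙-cong ((outside ∷ x) ≟ˢ (outside ∷ S)) (x ≟ˢ S) (proj₂ ∘ ∷-injective) (cong (outside ∷_)))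
      (∑-allSubsets-≟ S))
    (trans (∑-cong (allSubsets m) λ x → 𝟙-no ((inside ∷ x) ≟ˢ (outside ∷ S)) λ ())
      (trans (∑-const 0 (allSubsets m)) (*-zeroʳ (length (allSubsets m))))))
  ∑-allSubsets-≟ {suc m} (inside ∷ S) = trans (∑-allSubsets-suc (λ x → 𝟙 (x ≟ˢ (inside ∷ S)))) (cong₂ _+_
    (trans (∑-cong (allSubsets m) λ x → 𝟙-no ((outside ∷ x) ≟ˢ (inside ∷ S)) λ ())
      (trans (∑-const 0 (allSubsets m)) (*-zeroʳ (length (allSubsets m)))))
    (trans (∑-cong (allSubsets m) λ x → 𝟙-cong ((inside ∷ x) ≟ˢ (inside ∷ S)) (x ≟ˢ S) (proj₂ ∘ ∷-injective) (cong (inside ∷_)))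
      (∑-allSubsets-≟ S)))

  -- Rests on the fact that the enumeration lists every subset exactly once.
  pick : ∀ {m k} (S : Subset m) (g : Subset m → ℕ) → ∣ S ∣ ≡ k →
         ∑ (λ x → 𝟙 (x ≟ˢ S) * g x) (kSubsets m k) ≡ g S
  pick {m} {k} S g ∣S∣ = begin
    ∑ (λ x → 𝟙 (x ≟ˢ S) * g x) (kSubsets m k)                         ≡⟨ ∑-kSubsets m k _ ⟩
    ∑ (λ x → 𝟙 (∣ x ∣ ≟ k) * (𝟙 (x ≟ˢ S) * g x)) (allSubsets m)       ≡⟨ ∑-cong (allSubsets m) at-S ⟩
    ∑ (λ x → 𝟙 (x ≟ˢ S) * g S) (allSubsets m)                         ≡⟨ ∑-*ʳ (g S) _ (allSubsets m) ⟩
    ∑ (λ x → 𝟙 (x ≟ˢ S)) (allSubsets m) * g S                         ≡⟨ cong (_* g S) (∑-allSubsets-≟ S) ⟩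
    1 * g S                                                           ≡⟨ *-identityˡ (g S) ⟩
    g S                                                               ∎
    where
    open ≡-Reasoning
    at-S : ∀ x → 𝟙 (∣ x ∣ ≟ k) * (𝟙 (x ≟ˢ S) * g x) ≡ 𝟙 (x ≟ˢ S) * g S
    at-S x with x ≟ˢ S
    ... | yes refl = trans (cong (_* (1 * g x)) (𝟙-yes (∣ x ∣ ≟ k) ∣S∣)) (*-identityˡ (1 * g x))
    ... | no _     = *-zeroʳ (𝟙 (∣ x ∣ ≟ k))

  ∑-allFin-suc : ∀ n (f : Fin (suc n) → ℕ) → ∑ f (allFin (suc n)) ≡ f zero + ∑ (f ∘ suc) (allFin n)
  ∑-allFin-suc n f = cong (f zero +_) (trans (cong (∑ f) (sym (map-tabulate id suc))) (∑-map f suc (allFin n)))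

  ∑-allFin-≟ : ∀ {n} (v : Fin n) → ∑ (λ u → 𝟙 (u Fin.≟ v)) (allFin n) ≡ 1
  ∑-allFin-≟ {suc n} zero    = trans (∑-allFin-suc n (λ u → 𝟙 (u Fin.≟ zero)))
    (cong suc (trans (∑-cong (allFin n) λ u → 𝟙-no (suc u Fin.≟ zero) λ ())
      (trans (∑-const 0 (allFin n)) (*-zeroʳ (length (allFin n))))))
  ∑-allFin-≟ {suc n} (suc v) = trans (∑-allFin-suc n (λ u → 𝟙 (u Fin.≟ suc v)))
    (trans (cong₂ _+_ (𝟙-no (zero {n} Fin.≟ suc v) λ ())
                      (∑-cong (allFin n) λ u → 𝟙-cong (suc u Fin.≟ suc v) (u Fin.≟ v) Fin.suc-injective (cong suc)))
      (∑-allFin-≟ v))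

  ∣∁∩∁∣ : ∀ {m} (p q : Subset m) → p ⊆ ∁ q → ∣ p ∣ + ∣ q ∣ + ∣ ∁ q ∩ ∁ p ∣ ≡ m
  ∣∁∩∁∣ []            []            p⊆∁q = refl
  ∣∁∩∁∣ (outside ∷ p) (outside ∷ q) p⊆∁q =
    trans (+-suc (∣ p ∣ + ∣ q ∣) _) (cong suc (∣∁∩∁∣ p q (drop-∷-⊆ p⊆∁q)))
  ∣∁∩∁∣ (outside ∷ p) (inside ∷ q)  p⊆∁q =
    trans (cong (_+ ∣ ∁ q ∩ ∁ p ∣) (+-suc ∣ p ∣ ∣ q ∣)) (cong suc (∣∁∩∁∣ p q (drop-∷-⊆ p⊆∁q)))
  ∣∁∩∁∣ (inside ∷ p)  (outside ∷ q) p⊆∁q = cong suc (∣∁∩∁∣ p q (drop-∷-⊆ p⊆∁q))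
  ∣∁∩∁∣ (inside ∷ p)  (inside ∷ q)  p⊆∁q with () ← p⊆∁q here

  -- Divided by l s², where l is the length and s the sum, this is 1 + P(f = 0) ≤ E f² / (E f)² with
  -- P in place of f = 0. Pointwise it is (l f - s)² ≥ 0, with equality to s² where f vanishes,
  -- rearranged so that nothing is subtracted.
  chebyshev : ∀ {A : Set} {P : Pred A 0ℓ} (P? : Decidable P) (f : A → ℕ) xs → (∀ {x} → P x → f x ≡ 0) →
    (length xs + ∑ (𝟙 ∘ P?) xs) * (∑ f xs * ∑ f xs) ≤ length xs * length xs * ∑ (λ x → f x * f x) xs
  chebyshev {A} P? f xs h = +-cancelʳ-≤ (l * (s * s)) _ _ (begin
    (l + z) * (s * s) + l * (s * s)               ≡⟨ lem₁ l z s ⟩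
    s * s * z + 2 * (l * s) * s                   ≡⟨ sym (trans (∑-+ _ _ xs) (cong₂ _+_ (∑-*ˡ (s * s) (𝟙 ∘ P?) xs) (∑-*ˡ (2 * (l * s)) f xs))) ⟩
    ∑ (λ x → s * s * 𝟙 (P? x) + 2 * (l * s) * f x) xs    ≤⟨ ∑-mono xs pointwise ⟩
    ∑ (λ x → l * l * (f x * f x) + s * s) xs      ≡⟨ trans (∑-+ _ _ xs) (cong₂ _+_ (∑-*ˡ (l * l) (λ x → f x * f x) xs) (∑-const (s * s) xs)) ⟩
    l * l * ∑ (λ x → f x * f x) xs + l * (s * s)  ∎)
    where
    open ≤-Reasoning
    l = length xs
    s = ∑ f xs
    z = ∑ (𝟙 ∘ P?) xs
    lem₁ : ∀ l z s → (l + z) * (s * s) + l * (s * s) ≡ s * s * z + 2 * (l * s) * s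
    lem₁ = solve-∀
    2ab≤ : ∀ a b → 2 * (a * b) ≤ a * a + b * b
    2ab≤ a b with ≤-total a b
    ... | inj₁ a≤b with d , refl ← m≤n⇒∃[o]m+o≡n a≤b = ≤-trans (m≤m+n _ (d * d)) (≤-reflexive (lem a d))
      where
      lem : ∀ a d → 2 * (a * (a + d)) + d * d ≡ a * a + (a + d) * (a + d)
      lem = solve-∀
    ... | inj₂ b≤a with d , refl ← m≤n⇒∃[o]m+o≡n b≤a = ≤-trans (m≤m+n _ (d * d)) (≤-reflexive (lem b d))
      where
      lem : ∀ a d → 2 * ((a + d) * a) + d * d ≡ (a + d) * (a + d) + a * a
      lem = solve-∀
    pointwise : ∀ x → s * s * 𝟙 (P? x) + 2 * (l * s) * f x ≤ l * l * (f x * f x) + s * s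
    pointwise x with P? x
    ... | yes Px rewrite h Px = ≤-reflexive (lem l s)
      where
      lem : ∀ l s → s * s * 1 + 2 * (l * s) * 0 ≡ l * l * (0 * 0) + s * s
      lem = solve-∀
    ... | no _ = ≤-trans (≤-reflexive (lem l s (f x))) (≤-trans (2ab≤ (l * f x) s) (≤-reflexive (lem′ l s (f x))))
      where
      lem : ∀ l s y → s * s * 0 + 2 * (l * s) * y ≡ 2 * (l * y * s)
      lem = solve-∀
      lem′ : ∀ l s y → l * y * (l * y) + s * s ≡ l * l * (y * y) + s * s
      lem′ = solve-∀

  weight-* : ∀ {A : Set} {n} (w w′ : Fin n → A → ℕ) (F : Vec A n) →
             weight w F * weight w′ F ≡ weight (λ i x → w i x * w′ i x) F
  weight-* w w′ []      = refl
  weight-* w w′ (x ∷ F) = trans (lem (w zero x) (weight (w ∘ suc) F) (w′ zero x) _)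
    (cong (w zero x * w′ zero x *_) (weight-* (w ∘ suc) (w′ ∘ suc) F))
    where
    lem : ∀ a b c d → a * b * (c * d) ≡ a * c * (b * d)
    lem = solve-∀

  weight≢0 : ∀ {A : Set} {n} (w : Fin n → A → ℕ) (F : Vec A n) → weight w F ≢ 0 →
             ∀ i → w i (lookup F i) ≢ 0
  weight≢0 w (x ∷ F) ≢0 zero    eq = ≢0 (cong (_* weight (w ∘ suc) F) eq)
  weight≢0 w (x ∷ F) ≢0 (suc i) =
    weight≢0 (w ∘ suc) F (λ eq → ≢0 (trans (cong (w zero x *_) eq) (*-zeroʳ (w zero x)))) i

  ∑≡0 : ∀ {A : Set} (f : A → ℕ) xs → (∀ x → f x ≡ 0) → ∑ f xs ≡ 0
  ∑≡0 f xs h = trans (∑-cong xs h) (trans (∑-const 0 xs) (*-zeroʳ (length xs)))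

  ∑-*-∑ : ∀ {A : Set} (f : A → ℕ) xs → ∑ f xs * ∑ f xs ≡ ∑ (λ x → ∑ (λ y → f x * f y) xs) xs
  ∑-*-∑ f xs = trans (sym (∑-*ʳ (∑ f xs) f xs)) (∑-cong xs λ x → sym (∑-*ˡ (f x) f xs))

  -- The product of these over i indicates that node v has the colours S
  -- and that no other node has a colour in S.
  spot : ∀ {n m} → Fin n × Subset m → Fin n → Subset m → ℕ
  spot (v , S) i x = if does (i Fin.≟ v) then 𝟙 (x ≟ˢ S) else 𝟙 (x ⊆? ∁ S)

  spot-≡ : ∀ {n m} (v : Fin n) (S x : Subset m) → spot (v , S) v x ≡ 𝟙 (x ≟ˢ S)
  spot-≡ v S x with v Fin.≟ v
  ... | yes _  = refl
  ... | no v≢v = contradiction refl v≢v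

  spot-≢ : ∀ {n m} {v i : Fin n} (S x : Subset m) → i ≢ v → spot (v , S) i x ≡ 𝟙 (x ⊆? ∁ S)
  spot-≢ {v = v} {i} S x i≢v with i Fin.≟ v
  ... | yes i≡v = contradiction i≡v i≢v
  ... | no _    = refl

  𝟙≢0 : ∀ {P : Set} (P? : Dec P) → 𝟙 P? ≢ 0 → P
  𝟙≢0 (yes p) _  = p
  𝟙≢0 (no _)  ≢0 = contradiction refl ≢0

  -- A nonzero weight makes `v` isolated, so no walk from it reaches another node. That another node
  -- exists is the reason for requiring at least two.
  connected⇒weight≡0 : ∀ {k m} (F : Vec (Subset m) (suc (suc k))) vS →
    Connected (intersectionGraph F) → weight (spot vS) F ≡ 0
  connected⇒weight≡0 {k} F (v , S) conn with weight (spot (v , S)) F ≟ 0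
  ... | yes eq = eq
  ... | no ≢0  = contradiction (conn v (other v)) (isolated (other-≢ v))
    where
    other : Fin (suc (suc k)) → Fin (suc (suc k))
    other zero    = suc zero
    other (suc _) = zero
    other-≢ : ∀ v → v ≢ other v
    other-≢ zero    ()
    other-≢ (suc _) ()
    Fv≡S : lookup F v ≡ S
    Fv≡S = 𝟙≢0 (lookup F v ≟ˢ S) (subst (_≢ 0) (spot-≡ v S (lookup F v)) (weight≢0 (spot (v , S)) F ≢0 v))
    isolated : ∀ {u} → v ≢ u → ¬ Star (Adj (intersectionGraph F)) v u
    isolated v≢u ε = v≢u refl
    isolated v≢u (_◅_ {j = w} (v≢w , c , c∈) _) with c∈v , c∈w ← x∈p∩q⁻ (lookup F v) (lookup F w) c∈ =
      x∈∁p⇒x∉p (𝟙≢0 (lookup F w ⊆? ∁ S) (subst (_≢ 0) (spot-≢ S (lookup F w) (v≢w ∘ sym)) (weight≢0 (spot (v , S)) F ≢0 w)) c∈w)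
        (subst (c ∈ˢ_) Fv≡S c∈v)

  -- `N` counts the colour pairs, `N₂` those that avoid a given pair, and `N₄` those that avoid two
  -- given disjoint pairs.
  module _ (k m : ℕ) {N N₂ N₄ : ℕ} (N≡ : m C 2 ≡ N) (N₂≡ : (m ∸ 2) C 2 ≡ N₂) (N₄≡ : (m ∸ 4) C 2 ≡ N₄)
    {Ω : List (Vec (Subset m) (suc (suc k)))} (Ω≡ : assignments (suc (suc k)) m 2 ≡ Ω) where

    private
      n : ℕ
      n = suc (suc k)

      K = kSubsets m 2

      spots = cartesianProduct (allFin n) K

    -- Equal to the number of isolated nodes, since a node v contributes only through the pair S
    -- that it actually holds. Fixing S as well as v makes each summand a product over the nodes.
    isolated# : Vec (Subset m) n → ℕ
    isolated# F = ∑ (λ p → weight (spot p) F) spots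

    ∑-∁ : ∀ (S : Subset m) → ∣ S ∣ ≡ 2 → ∑ (λ x → 𝟙 (x ⊆? ∁ S)) K ≡ N₂
    ∑-∁ S ∣S∣ = trans (count-kSubsets {m} 2 (∁ S)) (trans (cong (_C 2) (trans (∣∁p∣≡n∸∣p∣ S) (cong (m ∸_) ∣S∣))) N₂≡)

    ∑-weight-Ω : ∀ w → ∑ (weight w) Ω ≡ ∏ (λ i → ∑ (w i) K)
    ∑-weight-Ω w = trans (cong (∑ (weight w)) (sym Ω≡)) (∑-weight n w K)

    ∑-spot : ∀ {p} → p ∈ spots → ∑ (weight (spot p)) Ω ≡ N₂ ^ suc k
    ∑-spot {v , S} p∈ = begin
      ∑ (weight (spot (v , S))) Ω                   ≡⟨ ∑-weight-Ω (spot (v , S)) ⟩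
      ∏ (λ i → ∑ (spot (v , S) i) K)                ≡⟨ ∏-one (λ i → ∑ (spot (v , S) i) K) v (λ i i≢v →
                                                         trans (∑-cong K λ x → spot-≢ S x i≢v) (∑-∁ S ∣S∣)) ⟩
      ∑ (spot (v , S) v) K * N₂ ^ suc k             ≡⟨ cong (_* N₂ ^ suc k) (trans (∑-cong K λ x →
                                                         trans (spot-≡ v S x) (sym (*-identityʳ _))) (pick S (λ _ → 1) ∣S∣)) ⟩
      1 * N₂ ^ suc k                                ≡⟨ *-identityˡ _ ⟩
      N₂ ^ suc k                                    ∎
      where
      open ≡-Reasoning
      ∣S∣ : ∣ S ∣ ≡ 2
      ∣S∣ = ∈-kSubsets⁻ {S = S} (proj₂ (∈-cartesianProduct⁻ (allFin n) K p∈))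

    length-spots : length spots ≡ n * N
    length-spots = begin
      length spots                                      ≡⟨ ∑-1 spots ⟨
      ∑ (λ _ → 1) spots                                 ≡⟨ ∑-cartesianProductWith (λ _ → 1) _,_ (allFin n) K ⟩
      ∑ (λ _ → ∑ (λ _ → 1) K) (allFin n)            ≡⟨ ∑-const (∑ (λ _ → 1) K) (allFin n) ⟩
      length (allFin n) * ∑ (λ _ → 1) K             ≡⟨ cong₂ _*_ (length-tabulate {n = n} id) (trans (∑-1 K) (trans (length-kSubsets m 2) N≡)) ⟩
      n * N                                         ∎
      where open ≡-Reasoning

    -- Divided by the N^n assignments, this is the mean n q^(n-1) with q = N₂/N.
    first-moment : ∑ isolated# Ω ≡ n * N * N₂ ^ suc k
    first-moment = begin
      ∑ isolated# Ω                                 ≡⟨ ∑-swap (λ F p → weight (spot p) F) Ω spots ⟩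
      ∑ (λ p → ∑ (weight (spot p)) Ω) spots             ≡⟨ ∑-cong-∈ spots ∑-spot ⟩
      ∑ (λ _ → N₂ ^ suc k) spots                        ≡⟨ ∑-const (N₂ ^ suc k) spots ⟩
      length spots * N₂ ^ suc k                         ≡⟨ cong (_* N₂ ^ suc k) length-spots ⟩
      n * N * N₂ ^ suc k                            ∎
      where
      open ≡-Reasoning
      ∑-cong-∈ : ∀ {A : Set} {f g : A → ℕ} xs → (∀ {x} → x ∈ xs → f x ≡ g x) → ∑ f xs ≡ ∑ g xs
      ∑-cong-∈ xs h = ≤-antisym (∑-mono-∈ xs (≤-reflexive ∘ h)) (∑-mono-∈ xs (≤-reflexive ∘ sym ∘ h))

    module _ (v : Fin n) (S : Subset m) (∣S∣ : ∣ S ∣ ≡ 2) where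

      private
        factor : Fin n → Subset m → Fin n → ℕ
        factor u S′ i = ∑ (λ x → spot (v , S) i x * spot (u , S′) i x) K

      same-node : ∀ S′ → ∣ S′ ∣ ≡ 2 → ∏ (factor v S′) ≤ 𝟙 (S′ ≟ˢ S) * N₂ ^ suc k
      same-node S′ ∣S′∣ = ∏-one-≤ (factor v S′) v
        (≤-reflexive (trans (∑-cong K λ x → trans (*-comm (spot (v , S) v x) _) (cong₂ _*_ (spot-≡ v S′ x) (spot-≡ v S x)))
          (pick S′ (λ x → 𝟙 (x ≟ˢ S)) ∣S′∣)))
        λ i i≢v → ≤-trans (∑-mono K λ x → begin
          spot (v , S) i x * spot (v , S′) i x      ≡⟨ cong₂ _*_ (spot-≢ S x i≢v) (spot-≢ S′ x i≢v) ⟩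
          𝟙 (x ⊆? ∁ S) * 𝟙 (x ⊆? ∁ S′)              ≤⟨ *-monoʳ-≤ (𝟙 (x ⊆? ∁ S)) (𝟙≤1 (x ⊆? ∁ S′)) ⟩
          𝟙 (x ⊆? ∁ S) * 1                          ≡⟨ *-identityʳ _ ⟩
          𝟙 (x ⊆? ∁ S)                              ∎)
          (≤-reflexive (∑-∁ S ∣S∣))
        where open ≤-Reasoning

      -- Two different nodes can both be isolated only if their pairs are disjoint; the other k
      -- nodes then avoid four colours.
      distinct-nodes : ∀ u S′ → u ≢ v → ∣ S′ ∣ ≡ 2 → ∏ (factor u S′) ≤ 𝟙 (S′ ⊆? ∁ S) * N₄ ^ k
      distinct-nodes u S′ u≢v ∣S′∣ with S′ ⊆? ∁ S
      -- The factor at `u` is 0, so any bound serves for the other factors.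
      ... | no S′⊈∁S = ≤-trans (∏-two-≤ (factor u S′) u v u≢v
          (≤-reflexive (trans at-u (𝟙-no (S′ ⊆? ∁ S) S′⊈∁S))) ≤-refl λ i _ _ → ≤-trans (∑-mono K λ x → *-mono-≤ (spot≤1 v S i x) (spot≤1 u S′ i x)) ≤-refl)
          ≤-refl
        where
        spot≤1 : ∀ v S i x → spot {n} {m} (v , S) i x ≤ 1
        spot≤1 v S i x with i Fin.≟ v
        ... | yes _ = 𝟙≤1 (x ≟ˢ S)
        ... | no _  = 𝟙≤1 (x ⊆? ∁ S)
        at-u : factor u S′ u ≡ 𝟙 (S′ ⊆? ∁ S)
        at-u = trans (∑-cong K λ x → trans (*-comm (spot (v , S) u x) _) (cong₂ _*_ (spot-≡ u S′ x) (spot-≢ S x u≢v)))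
          (pick S′ (λ x → 𝟙 (x ⊆? ∁ S)) ∣S′∣)
      ... | yes S′⊆∁S = ∏-two-≤ (factor u S′) u v u≢v at-u at-v λ i i≢u i≢v → ≤-reflexive (begin
          factor u S′ i                                      ≡⟨ ∑-cong K (λ x → cong₂ _*_ (spot-≢ S x i≢v) (spot-≢ S′ x i≢u)) ⟩
          ∑ (λ x → 𝟙 (x ⊆? ∁ S) * 𝟙 (x ⊆? ∁ S′)) K           ≡⟨ ∑-cong K both ⟩
          ∑ (λ x → 𝟙 (x ⊆? ∁ S ∩ ∁ S′)) K                    ≡⟨ count-kSubsets {m} 2 (∁ S ∩ ∁ S′) ⟩
          ∣ ∁ S ∩ ∁ S′ ∣ C 2                                 ≡⟨ trans (cong (_C 2) card) N₄≡ ⟩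
          N₄                                                 ∎)
        where
        open ≡-Reasoning
        at-u : factor u S′ u ≤ 1
        at-u = ≤-trans (≤-reflexive (trans (∑-cong K λ x → trans (*-comm (spot (v , S) u x) _) (cong₂ _*_ (spot-≡ u S′ x) (spot-≢ S x u≢v)))
          (pick S′ (λ x → 𝟙 (x ⊆? ∁ S)) ∣S′∣))) (𝟙≤1 (S′ ⊆? ∁ S))
        at-v : factor u S′ v ≤ 1
        at-v = ≤-trans (≤-reflexive (trans (∑-cong K λ x → cong₂ _*_ (spot-≡ v S x) (spot-≢ S′ x (u≢v ∘ sym)))
          (pick S (λ x → 𝟙 (x ⊆? ∁ S′)) ∣S∣))) (𝟙≤1 (S ⊆? ∁ S′))
        both : ∀ x → 𝟙 (x ⊆? ∁ S) * 𝟙 (x ⊆? ∁ S′) ≡ 𝟙 (x ⊆? ∁ S ∩ ∁ S′)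
        both x with x ⊆? ∁ S | x ⊆? ∁ S′
        ... | yes p | yes q = sym (𝟙-yes (x ⊆? ∁ S ∩ ∁ S′) λ c∈ → x∈p∩q⁺ (p c∈ , q c∈))
        ... | yes p | no ¬q = sym (𝟙-no (x ⊆? ∁ S ∩ ∁ S′) λ pq → ¬q (⊆-trans pq (p∩q⊆q (∁ S) (∁ S′))))
        ... | no ¬p | _     = sym (𝟙-no (x ⊆? ∁ S ∩ ∁ S′) λ pq → ¬p (⊆-trans pq (p∩q⊆p (∁ S) (∁ S′))))
        card : ∣ ∁ S ∩ ∁ S′ ∣ ≡ m ∸ 4
        card = trans (sym (m+n∸m≡n 4 ∣ ∁ S ∩ ∁ S′ ∣)) (cong (_∸ 4)
          (subst₂ (λ x y → x + y + ∣ ∁ S ∩ ∁ S′ ∣ ≡ m) ∣S′∣ ∣S∣ (∣∁∩∁∣ S′ S S′⊆∁S)))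

      -- For `u = v` the second summand is a surplus. It keeps the bound uniform in `u`, so that the
      -- sum over all nodes has n such terms rather than n - 1.
      ∑-node : ∀ u → ∑ (λ S′ → ∏ (factor u S′)) K ≤ 𝟙 (u Fin.≟ v) * N₂ ^ suc k + N₂ * N₄ ^ k
      ∑-node u with u Fin.≟ v
      ... | yes refl = begin
        ∑ (λ S′ → ∏ (factor v S′)) K                ≤⟨ ∑-mono-∈ K (λ {S′} S′∈ → same-node S′ (∈-kSubsets⁻ {S = S′} S′∈)) ⟩
        ∑ (λ S′ → 𝟙 (S′ ≟ˢ S) * N₂ ^ suc k) K       ≡⟨ pick S (λ _ → N₂ ^ suc k) ∣S∣ ⟩
        N₂ ^ suc k                                  ≡⟨ *-identityˡ _ ⟨
        1 * N₂ ^ suc k                              ≤⟨ m≤m+n _ _ ⟩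
        1 * N₂ ^ suc k + N₂ * N₄ ^ k                ∎
        where open ≤-Reasoning
      ... | no u≢v = begin
        ∑ (λ S′ → ∏ (factor u S′)) K                ≤⟨ ∑-mono-∈ K (λ {S′} S′∈ → distinct-nodes u S′ u≢v (∈-kSubsets⁻ {S = S′} S′∈)) ⟩
        ∑ (λ S′ → 𝟙 (S′ ⊆? ∁ S) * N₄ ^ k) K         ≡⟨ ∑-*ʳ (N₄ ^ k) _ K ⟩
        ∑ (λ S′ → 𝟙 (S′ ⊆? ∁ S)) K * N₄ ^ k         ≡⟨ cong (_* N₄ ^ k) (∑-∁ S ∣S∣) ⟩
        N₂ * N₄ ^ k                                 ∎
        where open ≤-Reasoning

      ∑-pairs : ∑ (λ q → ∑ (λ F → weight (spot (v , S)) F * weight (spot q) F) Ω) spots ≤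
                N₂ ^ suc k + n * (N₂ * N₄ ^ k)
      ∑-pairs = begin
        ∑ (λ q → ∑ (λ F → weight (spot (v , S)) F * weight (spot q) F) Ω) spots
          ≡⟨ ∑-cong spots (λ q → trans (∑-cong Ω λ F → weight-* (spot (v , S)) (spot q) F)
               (∑-weight-Ω (λ i x → spot (v , S) i x * spot q i x))) ⟩
        ∑ (λ q → ∏ (factor (proj₁ q) (proj₂ q))) spots
          ≡⟨ ∑-cartesianProductWith (λ q → ∏ (factor (proj₁ q) (proj₂ q))) _,_ (allFin n) K ⟩
        ∑ (λ u → ∑ (λ S′ → ∏ (factor u S′)) K) (allFin n)
          ≤⟨ ∑-mono (allFin n) ∑-node ⟩
        ∑ (λ u → 𝟙 (u Fin.≟ v) * N₂ ^ suc k + N₂ * N₄ ^ k) (allFin n)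
          ≡⟨ trans (∑-+ (λ u → 𝟙 (u Fin.≟ v) * N₂ ^ suc k) (λ _ → N₂ * N₄ ^ k) (allFin n)) (cong₂ _+_
               (trans (∑-*ʳ (N₂ ^ suc k) (λ u → 𝟙 (u Fin.≟ v)) (allFin n)) (trans (cong (_* N₂ ^ suc k) (∑-allFin-≟ v)) (*-identityˡ _)))
               (trans (∑-const (N₂ * N₄ ^ k) (allFin n)) (cong (_* (N₂ * N₄ ^ k)) (length-tabulate {n = n} id)))) ⟩
        N₂ ^ suc k + n * (N₂ * N₄ ^ k) ∎
        where open ≤-Reasoning

    second-moment : ∑ (λ F → isolated# F * isolated# F) Ω ≤ n * N * (N₂ ^ suc k + n * (N₂ * N₄ ^ k))
    second-moment = begin
      ∑ (λ F → isolated# F * isolated# F) Ω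
        ≡⟨ ∑-cong Ω (λ F → ∑-*-∑ (λ p → weight (spot p) F) spots) ⟩
      ∑ (λ F → ∑ (λ p → ∑ (λ q → weight (spot p) F * weight (spot q) F) spots) spots) Ω
        ≡⟨ trans (∑-swap (λ F p → ∑ (λ q → weight (spot p) F * weight (spot q) F) spots) Ω spots)
             (∑-cong spots λ p → ∑-swap (λ F q → weight (spot p) F * weight (spot q) F) Ω spots) ⟩
      ∑ (λ p → ∑ (λ q → ∑ (λ F → weight (spot p) F * weight (spot q) F) Ω) spots) spots
        ≤⟨ ∑-mono-∈ spots (λ {p} p∈ → ∑-pairs (proj₁ p) (proj₂ p) (∈-kSubsets⁻ {S = proj₂ p} (proj₂ (∈-cartesianProduct⁻ (allFin n) K p∈)))) ⟩
      ∑ (λ _ → N₂ ^ suc k + n * (N₂ * N₄ ^ k)) spots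
        ≡⟨ trans (∑-const _ spots) (cong (_* (N₂ ^ suc k + n * (N₂ * N₄ ^ k))) length-spots) ⟩
      n * N * (N₂ ^ suc k + n * (N₂ * N₄ ^ k)) ∎
      where open ≤-Reasoning

    -- Chebyshev's inequality with both moments inserted; connected assignments are among those
    -- without an isolated node.
    connected-count : ∀ {P : Pred (Vec (Subset m) n) 0ℓ} (P? : Decidable P) →
      (∀ F → P F → Connected (intersectionGraph F)) →
      let S₁ = n * N * N₂ ^ suc k
      in (N ^ n + length (filter P? Ω)) * (S₁ * S₁) ≤ N ^ n * N ^ n * (n * N * (N₂ ^ suc k + n * (N₂ * N₄ ^ k)))
    connected-count P? P⇒conn = begin
      (N ^ n + length (filter P? Ω)) * (S₁ * S₁)
        ≡⟨ cong₂ (λ l s → (l + length (filter P? Ω)) * (s * s)) (sym ∣Ω∣) (sym first-moment) ⟩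
      (length Ω + length (filter P? Ω)) * (∑ isolated# Ω * ∑ isolated# Ω)
        ≡⟨ cong (λ z → (length Ω + z) * (∑ isolated# Ω * ∑ isolated# Ω)) (length-filter P? Ω) ⟩
      (length Ω + ∑ (𝟙 ∘ P?) Ω) * (∑ isolated# Ω * ∑ isolated# Ω)
        ≤⟨ chebyshev P? isolated# Ω (λ {F} PF → ∑≡0 (λ p → weight (spot p) F) spots λ p → connected⇒weight≡0 F p (P⇒conn F PF)) ⟩
      length Ω * length Ω * ∑ (λ F → isolated# F * isolated# F) Ω
        ≤⟨ *-monoʳ-≤ (length Ω * length Ω) second-moment ⟩
      length Ω * length Ω * (n * N * (N₂ ^ suc k + n * (N₂ * N₄ ^ k)))
        ≡⟨ cong (λ l → l * l * (n * N * (N₂ ^ suc k + n * (N₂ * N₄ ^ k)))) ∣Ω∣ ⟩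
      N ^ n * N ^ n * (n * N * (N₂ ^ suc k + n * (N₂ * N₄ ^ k))) ∎
      where
      open ≤-Reasoning
      S₁ = n * N * N₂ ^ suc k
      ∣Ω∣ : length Ω ≡ N ^ n
      ∣Ω∣ = trans (cong length (sym Ω≡)) (trans (length-vectors K n) (cong (_^ n) (trans (length-kSubsets m 2) N≡)))

-- Estimates that make the second-moment bound small.

module IsolatedEstimate where

  open import Data.Nat.Base as ℕ using (ℕ; suc)
  open import Data.Nat.Combinatorics using (_C_; nC1≡n; nCk+nC[k+1]≡[n+1]C[k+1])
  import Data.Nat.Properties as ℕ
  import Data.Nat.Tactic.RingSolver as ℕSolver
  open import Data.Rational.Base
  open import Data.Rational.Properties
  open import Defs hiding (∑-++)
  open import Data.Product.Base using (∃; _,_)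
  open import Relation.Binary.PropositionalEquality
  open Rational
  open Exponential
  open ComponentEstimate using (half)
  open _↦_
  open Counting using (nC2)

  -- (4n)² = x² m² ≤ L² m², and L² ≤ 4n because (1 + L/2)² ≤ e^L ≤ n. One factor 4n is then
  -- cancelled.
  4n≤m² : ∀ k m {x} → x * fromℕ m ≡ fromℕ 4 * fromℕ (suc k) → 0ℚ ≤ x → x ≤ L (suc k) →
          4 ℕ.* suc k ℕ.≤ m ℕ.* m
  4n≤m² k m {x} ex 0≤x x≤L = fromℕ-cancel-≤ (subst₂ _≤_ (sym (fromℕ-* 4 (suc k))) (sym (fromℕ-* m m))
    (*-cancelˡ-≤-pos (fromℕ 4 * n) {{positive 0<4n}} (begin
      fromℕ 4 * n * (fromℕ 4 * n)          ≡⟨ cong₂ _*_ ex ex ⟨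
      x * fromℕ m * (x * fromℕ m)          ≡⟨ lem x (fromℕ m) ⟩
      x * x * (fromℕ m * fromℕ m)          ≤⟨ *-monoʳ-≤-nonNeg (fromℕ m * fromℕ m) {{nonNegative (0≤p*q (0≤fromℕ m) (0≤fromℕ m))}}
                                                (≤-trans (*-mono-≤ 0≤x 0≤x x≤L x≤L) L²≤4n) ⟩
      fromℕ 4 * n * (fromℕ m * fromℕ m)    ∎)))
    where
    open ≤-Reasoning
    n = fromℕ (suc k)
    l = L (suc k)
    0≤l : 0ℚ ≤ l
    0≤l = ≤-trans 0≤x x≤L
    0<4n : 0ℚ < fromℕ 4 * n
    0<4n = <-≤-trans (positive⁻¹ (fromℕ 4)) (subst (_≤ fromℕ 4 * n) (*-identityʳ (fromℕ 4))
      (*-monoˡ-≤-nonNeg (fromℕ 4) {{nonNegative (0≤fromℕ 4)}} (fromℕ-mono-≤ {1} {suc k} (ℕ.s≤s ℕ.z≤n))))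
    lem : ∀ x m → x * m * (x * m) ≡ x * x * (m * m)
    lem x m = solve 2 (λ x m → x :* m :* (x :* m) := x :* x :* (m :* m)) refl x m
    e : (1ℚ + l * inv 1) ≤exp (l * inv 1)
    e = ≤exp-factor (0≤p+q 0≤1 (0≤p*q 0≤l (0≤inv 1))) ≤-refl
    ≤1 : (1ℚ + l * inv 1) * ((1ℚ + l * inv 1) * inv k) ≤ 1ℚ
    ≤1 = ≤exp⇒≤1 (e ⊗ e ⊗ 1/n≤exp k) (≤-reflexive (lem′ l))
      where
      lem′ : ∀ l → l * inv 1 + (l * inv 1 + - l) ≡ 0ℚ
      lem′ l = solve 1 (λ l → l :* con (inv 1) :+ (l :* con (inv 1) :+ :- l) := con 0ℚ) refl l
    L²≤4n : l * l ≤ fromℕ 4 * n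
    L²≤4n = lem″ l n (inv k) 0≤l (0≤fromℕ (suc k)) (inv-inverse k) ≤1
      where
      lem″ : ∀ l n i → 0ℚ ≤ l → 0ℚ ≤ n → i * n ≡ 1ℚ → (1ℚ + l * inv 1) * ((1ℚ + l * inv 1) * i) ≤ 1ℚ → l * l ≤ fromℕ 4 * n
      lem″ l n i 0≤l 0≤n ei ≤1 = ≤-by₁ (fromℕ 4 * ((1ℚ + l * inv 1) * (1ℚ + l * inv 1)))
        (0≤p+q (0≤p*q (0≤p*q (0≤fromℕ 4) 0≤n) (p≤q⇒0≤q-p ≤1)) (0≤p+q (0≤fromℕ 4) (0≤p*q (0≤fromℕ 4) 0≤l)))
        ei (solve 3 (λ l n i →
            con (fromℕ 4) :* n :- l :* l :=
            con (fromℕ 4) :* n :* (con 1ℚ :- (con 1ℚ :+ l :* con (inv 1)) :* ((con 1ℚ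
              :+ l :* con (inv 1)) :* i)) :+ (con (fromℕ 4) :+ con (fromℕ 4) :* l)
              :+ con (fromℕ 4) :* ((con 1ℚ :+ l :* con (inv 1)) :* (con 1ℚ
              :+ l :* con (inv 1))) :* (i :* n :- con 1ℚ))
          refl l n i)

  -- Here N = C(m,2) and N₂ = C(m-2,2) with m = q + 2.
  pairs-ratio : ∀ {q i₂ i₃ N N₂} → N ≡ ((q + fromℕ 2) * (q + fromℕ 2) - (q + fromℕ 2)) * inv 1 →
    N₂ ≡ (q * q - q) * inv 1 → i₂ * q ≡ 1ℚ → i₃ * (q - 1ℚ) ≡ 1ℚ →
    N ≡ N₂ * (1ℚ + (fromℕ 4 * q + fromℕ 2) * (i₂ * i₃))
  pairs-ratio {q} {i₂} {i₃} refl refl e₂ e₃ =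
    ≡-by₁ (- ((q - 1ℚ) * i₃ * (fromℕ 2 * q + 1ℚ))) e₂
      (≡-by₁ (- (fromℕ 2 * q + 1ℚ)) e₃ (solve 3 (λ q i₂ i₃ →
          ((q :+ con (fromℕ 2)) :* (q :+ con (fromℕ 2)) :- (q :+ con (fromℕ 2))) :* con (inv 1) :=
          (q :* q :- q) :* con (inv 1) :* (con 1ℚ :+ (con (fromℕ 4) :* q
            :+ con (fromℕ 2)) :* (i₂ :* i₃)) :+ :- ((q :- con 1ℚ) :* i₃ :* (con (fromℕ 2) :* q
            :+ con 1ℚ)) :* (i₂ :* q :- con 1ℚ) :+ :- (con (fromℕ 2) :* q :+ con 1ℚ) :* (i₃ :* (q
            :- con 1ℚ) :- con 1ℚ))
        refl q i₂ i₃))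

  -- Here m = q + 2 = j + 6. The left side is N/N₂ - 1, which is 4/m to leading order. Factors equal
  -- to 1, such as im (q + 2), are inserted to bring both sides over one denominator; the difference
  -- of the numerators has nonnegative coefficients in `j`.
  pairs-ratio-≤ : ∀ {j i₂ i₃ im} → let q = j + fromℕ 4 in 0ℚ ≤ j → 0ℚ ≤ i₂ → 0ℚ ≤ i₃ → 0ℚ ≤ im →
    i₂ * q ≡ 1ℚ → i₃ * (q - 1ℚ) ≡ 1ℚ → im * (q + fromℕ 2) ≡ 1ℚ →
    (fromℕ 4 * q + fromℕ 2) * (i₂ * i₃) ≤ im * (fromℕ 4 + fromℕ 32 * im)
  pairs-ratio-≤ {j} {i₂} {i₃} {im} 0≤j 0≤i₂ 0≤i₃ 0≤im e₂ e₃ em = begin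
    Y                                                       ≡⟨ trans (cong₂ (λ a b → Y * (a * b)) em em) (*-identityʳ Y) ⟨
    Y * ((im * (j + fromℕ 4 + fromℕ 2)) * (im * (j + fromℕ 4 + fromℕ 2)))
      ≤⟨ ≤-by {p = (fromℕ 4 * (j + fromℕ 4) + fromℕ 2) * (i₂ * i₃) * ((im * (j + fromℕ 4 + fromℕ 2)) * (im * (j + fromℕ 4 + fromℕ 2)))}
              {q = im * (fromℕ 4 * (im * (j + fromℕ 4 + fromℕ 2)) + fromℕ 32 * im) * ((i₂ * (j + fromℕ 4)) * (i₃ * (j + fromℕ 4 - 1ℚ)))}
           (0≤p*q (0≤p*q (0≤p*q 0≤im 0≤im) (0≤p*q 0≤i₂ 0≤i₃))
                  (0≤p+q (0≤fromℕ 24) (0≤p+q (0≤p*q (0≤fromℕ 80) 0≤j) (0≤p*q (0≤fromℕ 18) (0≤p*q 0≤j 0≤j)))))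
           (solve 4 (λ j i₂ i₃ im →
               im :* (con (fromℕ 4) :* (im :* (j :+ con (fromℕ 4) :+ con (fromℕ 2)))
                 :+ con (fromℕ 32) :* im) :* (i₂ :* (j :+ con (fromℕ 4)) :* (i₃ :* (j
                 :+ con (fromℕ 4) :- con 1ℚ))) :- (con (fromℕ 4) :* (j :+ con (fromℕ 4))
                 :+ con (fromℕ 2)) :* (i₂ :* i₃) :* (im :* (j :+ con (fromℕ 4)
                 :+ con (fromℕ 2)) :* (im :* (j :+ con (fromℕ 4) :+ con (fromℕ 2)))) :=
               im :* im :* (i₂ :* i₃) :* (con (fromℕ 24) :+ (con (fromℕ 80) :* j
                 :+ con (fromℕ 18) :* (j :* j))))
             refl j i₂ i₃ im) ⟩
    im * (fromℕ 4 * (im * (j + fromℕ 4 + fromℕ 2)) + fromℕ 32 * im) * ((i₂ * (j + fromℕ 4)) * (i₃ * (j + fromℕ 4 - 1ℚ)))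
      ≡⟨ cong₂ (λ a b → im * (fromℕ 4 * a + fromℕ 32 * im) * b) em (cong₂ _*_ e₂ e₃) ⟩
    im * (fromℕ 4 * 1ℚ + fromℕ 32 * im) * (1ℚ * 1ℚ)         ≡⟨ solve 1 (λ im →
        im :* (con (fromℕ 4) :* con 1ℚ :+ con (fromℕ 32) :* im) :* (con 1ℚ :* con 1ℚ) :=
        im :* (con (fromℕ 4) :+ con (fromℕ 32) :* im))
      refl im ⟩
    im * (fromℕ 4 + fromℕ 32 * im)                          ∎
    where
    open ≤-Reasoning
    Y = (fromℕ 4 * (j + fromℕ 4) + fromℕ 2) * (i₂ * i₃)

  -- `M` is the number of assignments, `S₁` the first moment and t = M/S₁ = 1/E X, while 1 + y =
  -- N/N₂ = 1/q. Dividing the conclusion by `M` gives Z/M ≤ 1/E X + 1/q - 1. The hypothesis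
  -- `R * R₄ ≤ P * P` is log-concavity raised to the power k, for the k nodes other than the two in
  -- question.
  cancel-moments : ∀ {n i N N₂ P y y′ R R₄ Z} →
    0ℚ ≤ n → 0ℚ ≤ N → 0ℚ ≤ N₂ → 0ℚ ≤ R →
    i * n ≡ 1ℚ → N ≡ N₂ * (1ℚ + y) → R ≡ P * y′ → R * R₄ ≤ P * P →
    let M  = N * (N * R)
        S₁ = n * N * (N₂ * P)
        t  = (1ℚ + y) * y′ * i
    in 0ℚ < S₁ * S₁ →
       (M + Z) * (S₁ * S₁) ≤ M * M * (n * N * (N₂ * P + n * (N₂ * R₄))) →
       M + Z ≤ M * t + M * (1ℚ + y)
  cancel-moments {n} {i} {N} {N₂} {P} {y} {y′} {R} {R₄} {Z} 0≤n 0≤N 0≤N₂ 0≤R ei eN eR R≤ 0<S² le =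
    *-cancelʳ-≤-pos (S₁ * S₁) {{positive 0<S²}} (begin
      (M + Z) * (S₁ * S₁)                                                  ≤⟨ le ⟩
      M * M * (n * N * (N₂ * P + n * (N₂ * R₄)))                           ≡⟨ expand n N N₂ P R R₄ ⟩
      M * (S₁ * M) + M * (n * n * N * N₂ * (N * N)) * (R * R₄)             ≤⟨ +-monoʳ-≤ (M * (S₁ * M)) (*-monoˡ-≤-nonNeg c {{nonNegative 0≤c}} R≤) ⟩
      M * (S₁ * M) + M * (n * n * N * N₂ * (N * N)) * (P * P)              ≡⟨ cong₂ (λ a b → M * (S₁ * a) + M * (n * n * N * N₂ * (N * b)) * (P * P)) M≡ eN ⟩
      M * (S₁ * (S₁ * t)) + M * (n * n * N * N₂ * (N * (N₂ * (1ℚ + y)))) * (P * P)   ≡⟨ collect M S₁ t n N N₂ y P refl ⟩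
      (M * t + M * (1ℚ + y)) * (S₁ * S₁)                                   ∎)
    where
    open ≤-Reasoning
    M  = N * (N * R)
    S₁ = n * N * (N₂ * P)
    t  = (1ℚ + y) * y′ * i
    c  = M * (n * n * N * N₂ * (N * N))
    0≤c : 0ℚ ≤ c
    0≤c = 0≤p*q (0≤p*q 0≤N (0≤p*q 0≤N 0≤R)) (0≤p*q (0≤p*q (0≤p*q (0≤p*q 0≤n 0≤n) 0≤N) 0≤N₂) (0≤p*q 0≤N 0≤N))
    expand : ∀ n N N₂ P R R₄ → let M = N * (N * R); S₁ = n * N * (N₂ * P) in
      M * M * (n * N * (N₂ * P + n * (N₂ * R₄))) ≡ M * (S₁ * M) + M * (n * n * N * N₂ * (N * N)) * (R * R₄)
    expand n N N₂ P R R₄ = solve 6 (λ n N N₂ P R R₄ →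
        N :* (N :* R) :* (N :* (N :* R)) :* (n :* N :* (N₂ :* P :+ n :* (N₂ :* R₄))) :=
        N :* (N :* R) :* (n :* N :* (N₂ :* P) :* (N :* (N :* R)))
          :+ N :* (N :* R) :* (n :* n :* N :* N₂ :* (N :* N)) :* (R :* R₄))
      refl n N N₂ P R R₄
    collect : ∀ M S t n N N₂ y P → S ≡ n * N * (N₂ * P) →
      M * (S * (S * t)) + M * (n * n * N * N₂ * (N * (N₂ * (1ℚ + y)))) * (P * P) ≡ (M * t + M * (1ℚ + y)) * (S * S)
    collect M _ t n N N₂ y P refl = solve 7 (λ M t n N N₂ y P →
        M :* (n :* N :* (N₂ :* P) :* (n :* N :* (N₂ :* P) :* t))
          :+ M :* (n :* n :* N :* N₂ :* (N :* (N₂ :* (con 1ℚ :+ y)))) :* (P :* P) :=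
        (M :* t :+ M :* (con 1ℚ :+ y)) :* (n :* N :* (N₂ :* P) :* (n :* N :* (N₂ :* P))))
      refl M t n N N₂ y P
    mean : ∀ N N₂ P y y′ n i → i * n ≡ 1ℚ → N * (N₂ * (1ℚ + y) * (P * y′)) ≡ n * N * (N₂ * P) * ((1ℚ + y) * y′ * i)
    mean N N₂ P y y′ n i e = ≡-by₁ (- (N * (N₂ * (1ℚ + y) * (P * y′)))) e (solve 7 (λ N N₂ P y y′ n i →
        N :* (N₂ :* (con 1ℚ :+ y) :* (P :* y′)) :=
        n :* N :* (N₂ :* P) :* ((con 1ℚ :+ y) :* y′ :* i) :+ :- (N :* (N₂ :* (con 1ℚ
          :+ y) :* (P :* y′))) :* (i :* n :- con 1ℚ))
      refl N N₂ P y y′ n i)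
    M≡ : M ≡ S₁ * t
    M≡ = trans (cong₂ (λ a b → N * (a * b)) eN eR) (mean N N₂ P y y′ n i ei)

  suc-C-2 : ∀ n → suc n C 2 ≡ n ℕ.+ (n C 2)
  suc-C-2 n = trans (sym (nCk+nC[k+1]≡[n+1]C[k+1] n 1)) (cong (ℕ._+ (n C 2)) (nC1≡n n))

  -- Written in terms of c = C(j,2), with j² = 2c + j, the two sides differ by 4c + 8j + 1.
  pairs-log-concave : ∀ j → ((4 ℕ.+ j) C 2) ℕ.* (j C 2) ℕ.≤ ((2 ℕ.+ j) C 2) ℕ.* ((2 ℕ.+ j) C 2)
  pairs-log-concave j = begin
    ((4 ℕ.+ j) C 2) ℕ.* c                  ≡⟨ cong (ℕ._* c) (trans (suc-C-2 (3 ℕ.+ j)) (cong (3 ℕ.+ j ℕ.+_) (trans (suc-C-2 (2 ℕ.+ j)) (cong (2 ℕ.+ j ℕ.+_) two)))) ⟩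
    (3 ℕ.+ j ℕ.+ (2 ℕ.+ j ℕ.+ (1 ℕ.+ j ℕ.+ (j ℕ.+ c)))) ℕ.* c   ≤⟨ ℕ.m≤m+n _ (4 ℕ.* c ℕ.+ (8 ℕ.* j ℕ.+ 1)) ⟩
    (3 ℕ.+ j ℕ.+ (2 ℕ.+ j ℕ.+ (1 ℕ.+ j ℕ.+ (j ℕ.+ c)))) ℕ.* c ℕ.+ (4 ℕ.* c ℕ.+ (8 ℕ.* j ℕ.+ 1))   ≡⟨ lem₁ j c ⟩
    c ℕ.* c ℕ.+ (4 ℕ.* j ℕ.+ 2) ℕ.* c ℕ.+ 4 ℕ.* (c ℕ.+ c ℕ.+ j) ℕ.+ (4 ℕ.* j ℕ.+ 1)              ≡⟨ cong (λ z → c ℕ.* c ℕ.+ (4 ℕ.* j ℕ.+ 2) ℕ.* c ℕ.+ 4 ℕ.* z ℕ.+ (4 ℕ.* j ℕ.+ 1)) (nC2 j) ⟩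
    c ℕ.* c ℕ.+ (4 ℕ.* j ℕ.+ 2) ℕ.* c ℕ.+ 4 ℕ.* (j ℕ.* j) ℕ.+ (4 ℕ.* j ℕ.+ 1)                    ≡⟨ lem₂ j c ⟩
    (1 ℕ.+ j ℕ.+ (j ℕ.+ c)) ℕ.* (1 ℕ.+ j ℕ.+ (j ℕ.+ c))         ≡⟨ cong₂ ℕ._*_ two two ⟨
    ((2 ℕ.+ j) C 2) ℕ.* ((2 ℕ.+ j) C 2)    ∎
    where
    open ℕ.≤-Reasoning
    c = j C 2
    two : (2 ℕ.+ j) C 2 ≡ 1 ℕ.+ j ℕ.+ (j ℕ.+ c)
    two = trans (suc-C-2 (1 ℕ.+ j)) (cong (1 ℕ.+ j ℕ.+_) (suc-C-2 j))
    lem₁ : ∀ j c → (3 ℕ.+ j ℕ.+ (2 ℕ.+ j ℕ.+ (1 ℕ.+ j ℕ.+ (j ℕ.+ c)))) ℕ.* c ℕ.+ (4 ℕ.* c ℕ.+ (8 ℕ.* j ℕ.+ 1)) ≡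
           c ℕ.* c ℕ.+ (4 ℕ.* j ℕ.+ 2) ℕ.* c ℕ.+ 4 ℕ.* (c ℕ.+ c ℕ.+ j) ℕ.+ (4 ℕ.* j ℕ.+ 1)
    lem₁ = ℕSolver.solve-∀
    lem₂ : ∀ j c → c ℕ.* c ℕ.+ (4 ℕ.* j ℕ.+ 2) ℕ.* c ℕ.+ 4 ℕ.* (j ℕ.* j) ℕ.+ (4 ℕ.* j ℕ.+ 1) ≡
           (1 ℕ.+ j ℕ.+ (j ℕ.+ c)) ℕ.* (1 ℕ.+ j ℕ.+ (j ℕ.+ c))
    lem₂ = ℕSolver.solve-∀

  -- The main term 4n/m is x, and the error 32 n/m² is at most 8 since 4n ≤ m².
  exponent≤ : ∀ {x y n m im} → 0ℚ ≤ n → 0ℚ ≤ im → x * m ≡ fromℕ 4 * n → im * m ≡ 1ℚ →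
    y ≤ im * (fromℕ 4 + fromℕ 32 * im) → fromℕ 4 * n ≤ m * m → n * y ≤ x + fromℕ 8
  exponent≤ {x} {y} {n} {m} {im} 0≤n 0≤im ex em y≤ 4n≤ = ≤-by₂ im (- (x + fromℕ 8 * (im * m + 1ℚ)))
    (0≤p+q (0≤p*q 0≤n (p≤q⇒0≤q-p y≤)) (0≤p*q (0≤fromℕ 8) (0≤p*q (0≤p*q 0≤im 0≤im) (p≤q⇒0≤q-p 4n≤))))
    ex em (solve 5 (λ x y n m im →
        x :+ con (fromℕ 8) :- n :* y :=
        n :* (im :* (con (fromℕ 4) :+ con (fromℕ 32) :* im) :- y)
          :+ con (fromℕ 8) :* (im :* im :* (m :* m :- con (fromℕ 4) :* n)) :+ im :* (x :* m
          :- con (fromℕ 4) :* n) :+ :- (x :+ con (fromℕ 8) :* (im :* m :+ con 1ℚ)) :* (im :* m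
          :- con 1ℚ))
      refl x y n m im)

  -- As 1/m ≤ 1, y ≤ 36/m, and 2E · 36/m ≤ 1 when m ≥ 72 E.
  ratio-small : ∀ {y m im E} → 0ℚ ≤ im → im ≤ 1ℚ → 0ℚ ≤ E → im * m ≡ 1ℚ →
    y ≤ im * (fromℕ 4 + fromℕ 32 * im) → fromℕ 72 * E ≤ m → fromℕ 2 * E * y ≤ 1ℚ
  ratio-small {y} {m} {im} {E} 0≤im im≤1 0≤E em y≤ E≤ = ≤-by₁ (- 1ℚ)
    (0≤p+q (0≤p*q (0≤p*q (0≤fromℕ 2) 0≤E) (p≤q⇒0≤q-p y≤))
      (0≤p+q (0≤p*q (0≤p*q (0≤fromℕ 64) (0≤p*q 0≤E 0≤im)) (p≤q⇒0≤q-p im≤1)) (0≤p*q 0≤im (p≤q⇒0≤q-p E≤))))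
    em (solve 4 (λ y m im E →
        con 1ℚ :- con (fromℕ 2) :* E :* y :=
        con (fromℕ 2) :* E :* (im :* (con (fromℕ 4) :+ con (fromℕ 32) :* im) :- y)
          :+ (con (fromℕ 64) :* (E :* im) :* (con 1ℚ :- im) :+ im :* (m :- con (fromℕ 72) :* E))
          :+ :- con 1ℚ :* (im :* m :- con 1ℚ))
      refl y m im E)

  -- Z/M ≤ t + y, and each of the two terms takes half of 1/E.
  combine-small : ∀ {M Z t y E} → 0ℚ ≤ M → 0ℚ ≤ t → 0ℚ ≤ E → M + Z ≤ M * t + M * (1ℚ + y) →
    (1ℚ + fromℕ 2 * E) * t ≤ 1ℚ → fromℕ 2 * E * y ≤ 1ℚ → E * Z ≤ M
  combine-small {M} {Z} {t} {y} {E} 0≤M 0≤t 0≤E le t≤ y≤ = ≤-by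
    (0≤p+q (0≤p*q 0≤E (p≤q⇒0≤q-p le)) (0≤p*q (0≤p*q 0≤M (0≤inv 1))
      (0≤p+q (0≤p+q (p≤q⇒0≤q-p t≤) 0≤t) (p≤q⇒0≤q-p y≤))))
    (solve 5 (λ M Z t y E →
        M :- E :* Z :=
        E :* (M :* t :+ M :* (con 1ℚ :+ y) :- (M :+ Z)) :+ M :* con (inv 1) :* (con 1ℚ
          :- (con 1ℚ :+ con (fromℕ 2) :* E) :* t :+ t :+ (con 1ℚ :- con (fromℕ 2) :* E :* y)))
      refl M Z t y E)

  log-concave : ∀ {m} → 4 ℕ.≤ m → (m C 2) ℕ.* ((m ℕ.∸ 4) C 2) ℕ.≤ ((m ℕ.∸ 2) C 2) ℕ.* ((m ℕ.∸ 2) C 2)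
  log-concave 4≤m with j , refl ← ℕ.m≤n⇒∃[o]m+o≡n 4≤m = pairs-log-concave j

  0<C2 : ∀ {m} → 2 ℕ.≤ m → 0 ℕ.< m C 2
  0<C2 2≤m with j , refl ← ℕ.m≤n⇒∃[o]m+o≡n 2≤m = subst (1 ℕ.≤_) (sym (suc-C-2 (suc j))) (ℕ.s≤s ℕ.z≤n)

  -- Writing m = 6 + j makes m - 2 and m - 3 into 4 + j and 3 + j, so their inverses exist and no
  -- truncated subtraction remains in the rational estimates.
  connected-estimate : ∀ k m E Z {N N₂ N₄ x} →
    let n  = 2 ℕ.+ k
        S₁ = n ℕ.* N ℕ.* N₂ ℕ.^ suc k
    in N ℕ.+ N ℕ.+ m ≡ m ℕ.* m → N₂ ℕ.+ N₂ ℕ.+ (m ℕ.∸ 2) ≡ (m ℕ.∸ 2) ℕ.* (m ℕ.∸ 2) →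
       N ℕ.* N₄ ℕ.≤ N₂ ℕ.* N₂ → 0 ℕ.< N → 0 ℕ.< N₂ → (∃ λ j → 6 ℕ.+ j ≡ m) →
       72 ℕ.* E ℕ.≤ m → x * fromℕ m ≡ fromℕ 4 * fromℕ n → 0ℚ ≤ x →
       x + (fromℕ 2 * fromℕ E + fromℕ 8) ≤ L n →
       (N ℕ.^ n ℕ.+ Z) ℕ.* (S₁ ℕ.* S₁) ℕ.≤
       N ℕ.^ n ℕ.* N ℕ.^ n ℕ.* (n ℕ.* N ℕ.* (N₂ ℕ.^ suc k ℕ.+ n ℕ.* (N₂ ℕ.* N₄ ℕ.^ k))) →
       E ℕ.* Z ℕ.≤ N ℕ.^ n
  connected-estimate k _ E Z {N′} {N₂′} {N₄′} {x} hN hN₂ hN₄ 0<N 0<N₂ (j , refl) 72E≤m ex 0≤x x≤ count = fromℕ-cancel-≤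
    (subst₂ _≤_ (sym (fromℕ-* E Z)) (sym (value M↦))
      (combine-small {M} {fromℕ Z} {t} {y} {fromℕ E} 0≤M (nonneg et) (0≤fromℕ E)
        (cancel-moments {n} {i} {N} {N₂} {P} {y} {y′} {R} {R₄} {fromℕ Z} (0≤fromℕ n′) (0≤fromℕ N′) (0≤fromℕ N₂′) 0≤R
          (inv-inverse (1 ℕ.+ k)) eN eR R≤ 0<S²
          (subst₂ _≤_ (value ((M↦ ⟨+⟩ ⟦ Z ⟧) ⟨*⟩ (S↦ ⟨*⟩ S↦)))
            (value (M↦ ⟨*⟩ M↦ ⟨*⟩ (⟦ n′ ⟧ ⟨*⟩ ⟦ N′ ⟧ ⟨*⟩ (⟦ N₂′ ⟧ ⟨^⟩ suc k ⟨+⟩ ⟦ n′ ⟧ ⟨*⟩ (⟦ N₂′ ⟧ ⟨*⟩ ⟦ N₄′ ⟧ ⟨^⟩ k)))))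
            (fromℕ-mono-≤ count)))
        (subst (_≤ 1ℚ) (*-comm t (1ℚ + fromℕ 2 * fromℕ E)) (≤exp⇒≤1 (et ⊗ eE) exponent≤0))
        (ratio-small {y} {m} {im} {fromℕ E} 0≤im (inv-antimono {0} {5 ℕ.+ j} ℕ.z≤n) (0≤fromℕ E) em ratio≤
          (subst (_≤ m) (fromℕ-* 72 E) (fromℕ-mono-≤ 72E≤m)))))
    where
    n′ = 2 ℕ.+ k
    m′ = 6 ℕ.+ j
    n = fromℕ n′
    m = fromℕ m′
    N = fromℕ N′
    N₂ = fromℕ N₂′
    i = inv (1 ℕ.+ k)
    im = inv (5 ℕ.+ j)
    i₂ = inv (3 ℕ.+ j)
    i₃ = inv (2 ℕ.+ j)
    q = fromℕ j + fromℕ 4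
    y = (fromℕ 4 * q + fromℕ 2) * (i₂ * i₃)
    y′ = (1ℚ + y) ^ k
    P = N₂ ^ k
    R = N ^ k
    R₄ = fromℕ N₄′ ^ k
    M = N * (N * R)
    t = (1ℚ + y) * y′ * i
    0≤im = 0≤inv (5 ℕ.+ j)
    0≤R = 0≤^ k (0≤fromℕ N′)
    0≤M = 0≤p*q (0≤fromℕ N′) (0≤p*q (0≤fromℕ N′) 0≤R)
    0≤y : 0ℚ ≤ y
    0≤y = 0≤p*q (0≤p+q (0≤p*q (0≤fromℕ 4) (0≤p+q (0≤fromℕ j) (0≤fromℕ 4))) (0≤fromℕ 2)) (0≤p*q (0≤inv (3 ℕ.+ j)) (0≤inv (2 ℕ.+ j)))
    M↦ : N′ ℕ.^ n′ ↦ M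
    M↦ = ⟦ N′ ⟧ ⟨^⟩ n′
    S↦ : n′ ℕ.* N′ ℕ.* N₂′ ℕ.^ suc k ↦ n * N * (N₂ * P)
    S↦ = ⟦ n′ ⟧ ⟨*⟩ ⟦ N′ ⟧ ⟨*⟩ ⟦ N₂′ ⟧ ⟨^⟩ suc k
    q≡ : fromℕ (4 ℕ.+ j) ≡ q
    q≡ = trans (cong fromℕ (ℕ.+-comm 4 j)) (fromℕ-+ j 4)
    m≡ : m ≡ q + fromℕ 2
    m≡ = trans (cong fromℕ (ℕ.+-comm 2 (4 ℕ.+ j))) (trans (fromℕ-+ (4 ℕ.+ j) 2) (cong (_+ fromℕ 2) q≡))
    q-1≡ : fromℕ (3 ℕ.+ j) ≡ q - 1ℚ
    q-1≡ = trans (minus (fromℕ (3 ℕ.+ j))) (cong (_- 1ℚ) (trans (sym (fromℕ-suc (3 ℕ.+ j))) q≡))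
      where
      minus : ∀ p → p ≡ p + 1ℚ - 1ℚ
      minus p = solve 1 (λ p → p := p :+ con 1ℚ :- con 1ℚ) refl p
    em : im * m ≡ 1ℚ
    em = inv-inverse (5 ℕ.+ j)
    e₂ : i₂ * q ≡ 1ℚ
    e₂ = trans (cong (i₂ *_) (sym q≡)) (inv-inverse (3 ℕ.+ j))
    e₃ : i₃ * (q - 1ℚ) ≡ 1ℚ
    e₃ = trans (cong (i₃ *_) (sym q-1≡)) (inv-inverse (2 ℕ.+ j))
    eN : N ≡ N₂ * (1ℚ + y)
    eN = pairs-ratio {q} {i₂} {i₃} {N} {N₂}
      (trans (half {N′} {m′} hN) (cong (λ z → (z * z - z) * inv 1) m≡))
      (trans (half {N₂′} {4 ℕ.+ j} hN₂) (cong (λ z → (z * z - z) * inv 1) q≡)) e₂ e₃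
    eR : R ≡ P * y′
    eR = trans (cong (_^ k) eN) (^-distrib-* N₂ (1ℚ + y) k)
    R≤ : R * R₄ ≤ P * P
    R≤ = subst₂ _≤_ (^-distrib-* N (fromℕ N₄′) k) (^-distrib-* N₂ N₂ k)
      (^-mono-≤ k (0≤p*q (0≤fromℕ N′) (0≤fromℕ N₄′))
        (subst₂ _≤_ (fromℕ-* N′ N₄′) (fromℕ-* N₂′ N₂′) (fromℕ-mono-≤ hN₄)))
    0<S² : 0ℚ < n * N * (N₂ * P) * (n * N * (N₂ * P))
    0<S² = subst (0ℚ <_) (value (S↦ ⟨*⟩ S↦)) (<-≤-trans (positive⁻¹ 1ℚ) (fromℕ-mono-≤ {1} (ℕ.*-mono-≤ 1≤S 1≤S)))
      where
      1≤S : 1 ℕ.≤ n′ ℕ.* N′ ℕ.* N₂′ ℕ.^ suc k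
      1≤S = ℕ.*-mono-≤ (ℕ.*-mono-≤ {1} {n′} (ℕ.s≤s ℕ.z≤n) 0<N)
        (ℕ.m^n>0 N₂′ {{ℕ.>-nonZero 0<N₂}} (suc k))
    ratio≤ : y ≤ im * (fromℕ 4 + fromℕ 32 * im)
    ratio≤ = pairs-ratio-≤ (0≤fromℕ j) (0≤inv (3 ℕ.+ j)) (0≤inv (2 ℕ.+ j)) 0≤im e₂ e₃ (trans (cong (im *_) (sym m≡)) em)
    ey : (1ℚ + y) ≤exp y
    ey = ≤exp-factor (0≤p+q 0≤1 0≤y) ≤-refl
    et : t ≤exp (y + fromℕ k * y + - L n′)
    et = (ey ⊗ ≤exp-^ k ey) ⊗ 1/n≤exp (1 ℕ.+ k)
    eE : (1ℚ + fromℕ 2 * fromℕ E) ≤exp (fromℕ 2 * fromℕ E)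
    eE = ≤exp-factor (0≤p+q 0≤1 (0≤p*q (0≤fromℕ 2) (0≤fromℕ E))) ≤-refl
    x≤L : x ≤ L n′
    x≤L = ≤-trans (≤-by (0≤p+q (0≤p*q (0≤fromℕ 2) (0≤fromℕ E)) (0≤fromℕ 8)) (plus x (fromℕ 2 * fromℕ E + fromℕ 8))) x≤
      where
      plus : ∀ x z → x + z - x ≡ z
      plus x z = solve 2 (λ x z → x :+ z :- x := z) refl x z
    ny≤ : n * y ≤ x + fromℕ 8
    ny≤ = exponent≤ {x} {y} {n} {m} {im} (0≤fromℕ n′) 0≤im ex em ratio≤
      (subst₂ _≤_ (fromℕ-* 4 n′) (fromℕ-* m′ m′) (fromℕ-mono-≤ (4n≤m² (1 ℕ.+ k) m′ ex 0≤x x≤L)))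
    -- The exponents of t and 1 + 2E. Rounding k + 1 up to n = k + 2 brings in the bound n y ≤ x +
    -- 8, and the gap between x and L covers 8 + 2E.
    exponent≤0 : y + fromℕ k * y + - L n′ + fromℕ 2 * fromℕ E ≤ 0ℚ
    exponent≤0 = sum y (fromℕ k) n (L n′) (fromℕ E) x 0≤y (trans (cong fromℕ (ℕ.+-comm 2 k)) (fromℕ-+ k 2)) ny≤ x≤
      where
      sum : ∀ y k n l E x → 0ℚ ≤ y → n ≡ k + fromℕ 2 → n * y ≤ x + fromℕ 8 → x + (fromℕ 2 * E + fromℕ 8) ≤ l →
            y + k * y + - l + fromℕ 2 * E ≤ 0ℚ
      sum y k n l E x 0≤y refl le le′ = ≤-by (0≤p+q (0≤p+q (p≤q⇒0≤q-p le) (p≤q⇒0≤q-p le′)) 0≤y)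
        (solve 5 (λ y k l E x →
            con 0ℚ :- (y :+ k :* y :+ :- l :+ con (fromℕ 2) :* E) :=
            x :+ con (fromℕ 8) :- (k :+ con (fromℕ 2)) :* y :+ (l :- (x :+ (con (fromℕ 2) :* E
              :+ con (fromℕ 8)))) :+ y)
          refl y k l E x)

-- From the counting bounds to probabilities and limits.

module Limits where

  open import Data.Fin.Subset using (Subset)
  import Data.Integer.Base as ℤ
  import Data.Integer.Properties as ℤ
  open import Data.List.Base using ([]; _∷_; length; filter)
  open import Data.Nat.Base as ℕ using (ℕ; zero; suc; NonZero)
  open import Data.Nat.Combinatorics using (_C_)
  import Data.Nat.Properties as ℕ
  open import Data.Product.Base using (∃; _,_)
  open import Data.Rational.Base hiding (NonZero)
  open import Data.Rational.Properties
  import Data.Rational.Unnormalised.Base as ℚᵘ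
  import Data.Rational.Unnormalised.Properties as ℚᵘ
  open import Data.Sum.Base using (inj₁; inj₂)
  open import Data.Vec.Base using (Vec)
  open import Defs hiding (∑-++)
  open import Function.Base using (_∘_)
  open import Level using (0ℓ)
  open import Relation.Binary.PropositionalEquality
  open import Relation.Nullary using (yes; no)
  open import Relation.Nullary.Decidable using (¬?)
  open import Relation.Unary using (Pred; Decidable)
  open Rational
  open Exponential
  open ComponentEstimate using (component-estimate)
  open IsolatedEstimate using (4n≤m²; connected-estimate; log-concave; 0<C2)
  open Counting using (nC2; nCk*a^k*b^l≤; length-vectors; length-kSubsets)
  open Disconnected using (SizeEstimate; disconnected-count)
  open IsolatedNodes using (connected-count)

  /-cancel : ∀ a l .{{_ : NonZero l}} → (ℤ.+ a / l) * fromℕ l ≡ fromℕ a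
  /-cancel a (suc k) = toℚᵘ-injective (begin
    toℚᵘ ((ℤ.+ a / suc k) * fromℕ (suc k))              ≈⟨ toℚᵘ-homo-* (ℤ.+ a / suc k) (fromℕ (suc k)) ⟩
    toℚᵘ (ℤ.+ a / suc k) ℚᵘ.* toℚᵘ (fromℕ (suc k))      ≈⟨ ℚᵘ.*-cong (toℚᵘ-fromℚᵘ (ℚᵘ.mkℚᵘ (ℤ.+ a) k)) (fromℕ-ᵘ (suc k)) ⟩
    ℚᵘ.mkℚᵘ (ℤ.+ a) k ℚᵘ.* ℚᵘ.mkℚᵘ (ℤ.+ suc k) 0        ≈⟨ ℚᵘ.*≡* (trans (ℤ.*-identityʳ _)
                                                             (cong (ℤ.+ a ℤ.*_) (cong ℤ.+_ (sym (ℕ.*-identityʳ (suc k)))))) ⟩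
    ℚᵘ.mkℚᵘ (ℤ.+ a) 0                                   ≈⟨ fromℕ-ᵘ a ⟨
    toℚᵘ (fromℕ a)                                      ∎)
    where open import Relation.Binary.Reasoning.Setoid ℚᵘ.≃-setoid

  -- For ε = (p+1)/(e+1) the witness is 1/(e+2).
  archimedes : ∀ ε → 0ℚ < ε → ∃ λ d → inv d < ε
  archimedes ε@(mkℚ (ℤ.+ suc p) e _) _ = suc e , toℚᵘ-cancel-< (ℚᵘ.<-respˡ-≃ (ℚᵘ.≃-sym (inv-ᵘ (suc e)))
    (ℚᵘ.*<* (ℤ.+<+ (subst₂ ℕ._<_ (sym (ℕ.*-identityˡ (suc e))) refl
      (ℕ.≤-trans (ℕ.n<1+n (suc e)) (ℕ.m≤m+n (suc (suc e)) (p ℕ.* suc (suc e))))))))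
  archimedes (mkℚ (ℤ.+ zero) _ _) (*<* (ℤ.+<+ ()))
  archimedes (mkℚ ℤ.-[1+ _ ] _ _) (*<* ())

  p≤∣p∣ : ∀ p → p ≤ ∣ p ∣
  p≤∣p∣ p with ≤-total 0ℚ p
  ... | inj₁ 0≤p = ≤-reflexive (sym (0≤p⇒∣p∣≡p 0≤p))
  ... | inj₂ p≤0 = ≤-trans p≤0 (0≤∣p∣ p)

  -p≤∣p∣ : ∀ p → - p ≤ ∣ p ∣
  -p≤∣p∣ p = subst (- p ≤_) (∣-p∣≡∣p∣ p) (p≤∣p∣ (- p))

  near-one : ∀ g b l .{{_ : NonZero l}} d → g ℕ.+ b ≡ l → suc d ℕ.* b ℕ.≤ l → ∣ (ℤ.+ g / l) - 1ℚ ∣ ≤ inv d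
  near-one g b l@(suc k) d g+b≡l le = ∣p∣≤ (≤-trans above (0≤inv d)) below
    where
    r = ℤ.+ g / l
    i = inv k
    ei : i * fromℕ l ≡ 1ℚ
    ei = inv-inverse k
    sum : fromℕ g + fromℕ b ≡ fromℕ l
    sum = trans (sym (fromℕ-+ g b)) (cong fromℕ g+b≡l)
    r≡ : r ≡ fromℕ g * i
    r≡ = trans (lem r i (fromℕ l) ei) (cong (_* i) (/-cancel g l))
      where
      lem : ∀ r i l → i * l ≡ 1ℚ → r ≡ r * l * i
      lem r i l e = ≡-by₁ (- r) e (solve 3 (λ r i l → r := r :* l :* i :+ :- r :* (i :* l
        :- con 1ℚ)) refl r i l)
    1-r≡ : 1ℚ - r ≡ fromℕ b * i
    1-r≡ = trans (cong (λ z → 1ℚ - z) r≡) (lem (fromℕ g) (fromℕ b) (fromℕ l) i ei sum)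
      where
      lem : ∀ g b l i → i * l ≡ 1ℚ → g + b ≡ l → 1ℚ - g * i ≡ b * i
      lem g b _ i e refl = ≡-by₁ (- 1ℚ) e (solve 3 (λ g b i →
          con 1ℚ :- g :* i :=
          b :* i :+ :- con 1ℚ :* (i :* (g :+ b) :- con 1ℚ))
        refl g b i)
    negate : ∀ r → - (1ℚ - r) ≡ r - 1ℚ
    negate r = solve 1 (λ r → :- (con 1ℚ :- r) := r :- con 1ℚ) refl r
    negate′ : ∀ r → 1ℚ - r ≡ - (r - 1ℚ)
    negate′ r = solve 1 (λ r → con 1ℚ :- r := :- (r :- con 1ℚ)) refl r
    above : r - 1ℚ ≤ 0ℚ
    above = subst (_≤ 0ℚ) (negate r) (neg-antimono-≤ (subst (0ℚ ≤_) (sym 1-r≡) (0≤p*q (0≤fromℕ b) (0≤inv k))))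
    below : - (r - 1ℚ) ≤ inv d
    below = subst (_≤ inv d) (trans (sym 1-r≡) (negate′ r))
      (lem (fromℕ (suc d)) (fromℕ b) (fromℕ l) (inv d) i (0≤inv d) (0≤inv k) (inv-inverse d) ei
        (subst (_≤ fromℕ l) (fromℕ-* (suc d) b) (fromℕ-mono-≤ le)))
      where
      lem : ∀ D b l e i → 0ℚ ≤ e → 0ℚ ≤ i → e * D ≡ 1ℚ → i * l ≡ 1ℚ → D * b ≤ l → b * i ≤ e
      lem D b l e i 0≤e 0≤i eD el le = ≤-by₂ (b * i) (- e) (0≤p*q (0≤p*q 0≤e 0≤i) (p≤q⇒0≤q-p le)) eD el
        (solve 5 (λ D b l e i →
            e :- b :* i :=
            e :* i :* (l :- D :* b) :+ b :* i :* (e :* D :- con 1ℚ) :+ :- e :* (i :* l :- con 1ℚ))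
          refl D b l e i)

  length-filter-¬ : ∀ {A : Set} {P : Pred A 0ℓ} (P? : Decidable P) xs →
    length (filter P? xs) ℕ.+ length (filter (¬? ∘ P?) xs) ≡ length xs
  length-filter-¬ P? []       = refl
  length-filter-¬ P? (x ∷ xs) with P? x
  ... | yes _ = cong suc (length-filter-¬ P? xs)
  ... | no _  = trans (ℕ.+-suc _ _) (cong suc (length-filter-¬ P? xs))

  length-assignments : ∀ n m → length (assignments n m 2) ≡ (m C 2) ℕ.^ n
  length-assignments n m = trans (length-vectors (kSubsets m 2) n) (cong (ℕ._^ n) (length-kSubsets m 2))

  component-estimate′ : ∀ k d {x} p b m → suc p ℕ.+ b ≡ m → suc p ℕ.≤ b →
    x * fromℕ m ≡ fromℕ 4 * fromℕ (suc k) → L (suc k) + (fromℕ 2 * fromℕ d + fromℕ 6) ≤ x →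
    fromℕ 128 * fromℕ (suc d) ≤ x → SizeEstimate (suc k) m d p b
  component-estimate′ k d p b _ refl a≤b ex L≤ D≤ =
    component-estimate k p b d {(suc p ℕ.+ b) C suc p} {suc p C 2} {b C 2} {(suc p ℕ.+ b) C 2} a≤b ex L≤ D≤
      (nCk*a^k*b^l≤ (suc p) b (suc p) (suc p ℕ.+ b)) (nC2 (suc p)) (nC2 b) (nC2 (suc p ℕ.+ b))

  -- 134 + 128 d dominates both gaps that the component estimate asks for: 2 d + 6 above L, and 128
  -- (d + 1) outright, the latter because L ≥ 0.
  supercritical : ∀ k m d {x K} → K ≡ fromℕ 134 + fromℕ 128 * fromℕ d →
    x * fromℕ m ≡ fromℕ 4 * fromℕ (suc k) → L (suc k) + K ≤ x →
    d ℕ.* length (filter (λ F → ¬? (connected? (intersectionGraph F))) (assignments (suc k) m 2)) ℕ.≤ (m C 2) ℕ.^ suc k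
  supercritical k m d {x} refl ex le = disconnected-count k m d λ p b eq a≤b →
    component-estimate′ k d p b m eq a≤b ex
      (lem₁ (L (suc k)) (fromℕ d) x (0≤fromℕ d) le)
      (subst (λ z → fromℕ 128 * z ≤ x) (sym (fromℕ-suc d)) (lem₂ (L (suc k)) (fromℕ d) x (0≤∑1/ 2 (k ℕ.* 2)) le))
    where
    lem₁ : ∀ l d x → 0ℚ ≤ d → l + (fromℕ 134 + fromℕ 128 * d) ≤ x → l + (fromℕ 2 * d + fromℕ 6) ≤ x
    lem₁ l d x 0≤d le = ≤-by (0≤p+q (p≤q⇒0≤q-p le) (0≤p+q (0≤fromℕ 128) (0≤p*q (0≤fromℕ 126) 0≤d)))
      (solve 3 (λ l d x →
          x :- (l :+ (con (fromℕ 2) :* d :+ con (fromℕ 6))) :=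
          x :- (l :+ (con (fromℕ 134) :+ con (fromℕ 128) :* d)) :+ (con (fromℕ 128)
            :+ con (fromℕ 126) :* d))
        refl l d x)
    lem₂ : ∀ l d x → 0ℚ ≤ l → l + (fromℕ 134 + fromℕ 128 * d) ≤ x → fromℕ 128 * (d + 1ℚ) ≤ x
    lem₂ l d x 0≤l le = ≤-by (0≤p+q (p≤q⇒0≤q-p le) (0≤p+q (0≤fromℕ 6) 0≤l)) (solve 3 (λ l d x →
        x :- con (fromℕ 128) :* (d :+ con 1ℚ) :=
        x :- (l :+ (con (fromℕ 134) :+ con (fromℕ 128) :* d)) :+ (con (fromℕ 6) :+ l))
      refl l d x)

  -- That m is large is derived rather than assumed: B² ≤ n ≤ 4n ≤ m² gives B ≤ m, where B = 72 (E +
  -- 1). This also yields the bound 6 ≤ m needed for the pair counts.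
  subcritical : ∀ k m E {B x K N N₂ N₄} → K ≡ fromℕ 2 * fromℕ (suc E) + fromℕ 8 → B ≡ 72 ℕ.* suc E →
    m C 2 ≡ N → (m ℕ.∸ 2) C 2 ≡ N₂ → (m ℕ.∸ 4) C 2 ≡ N₄ →
    {P : Pred (Vec (Subset m) (suc (suc k))) 0ℓ} (P? : Decidable P) → (∀ F → P F → Connected (intersectionGraph F)) →
    x * fromℕ m ≡ fromℕ 4 * fromℕ (2 ℕ.+ k) → 0ℚ ≤ x → x + K ≤ L (2 ℕ.+ k) → B ℕ.* B ℕ.≤ 2 ℕ.+ k →
    suc E ℕ.* length (filter P? (assignments (suc (suc k)) m 2)) ℕ.≤ N ℕ.^ suc (suc k)
  subcritical k m E {B} {x} {K} {N} {N₂} {N₄} K≡ B≡ N≡ N₂≡ N₄≡ P? P⇒conn ex 0≤x le n≥ =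
    connected-estimate k m (suc E) (length (filter P? (assignments (suc (suc k)) m 2)))
      (subst (λ N → N ℕ.+ N ℕ.+ m ≡ m ℕ.* m) N≡ (nC2 m))
      (subst (λ N₂ → N₂ ℕ.+ N₂ ℕ.+ (m ℕ.∸ 2) ≡ (m ℕ.∸ 2) ℕ.* (m ℕ.∸ 2)) N₂≡ (nC2 (m ℕ.∸ 2)))
      (subst₂ ℕ._≤_ (cong₂ ℕ._*_ N≡ N₄≡) (cong₂ ℕ._*_ N₂≡ N₂≡) (log-concave (ℕ.≤-trans (ℕ.m≤m+n 4 2) 6≤m)))
      (subst (0 ℕ.<_) N≡ (0<C2 (ℕ.≤-trans (ℕ.m≤m+n 2 4) 6≤m)))
      (subst (0 ℕ.<_) N₂≡ (0<C2 (ℕ.∸-monoˡ-≤ 2 (ℕ.≤-trans (ℕ.m≤m+n 4 2) 6≤m))))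
      (ℕ.m≤n⇒∃[o]m+o≡n 6≤m) (subst (ℕ._≤ m) B≡ B≤m) ex 0≤x (subst (λ z → x + z ≤ L (2 ℕ.+ k)) K≡ le) (connected-count k m N≡ N₂≡ N₄≡ refl P? P⇒conn)
    where
    x≤L : x ≤ L (2 ℕ.+ k)
    x≤L = ≤-trans (≤-by 0≤K (lem x K)) le
      where
      0≤K : 0ℚ ≤ K
      0≤K = subst (0ℚ ≤_) (sym K≡) (0≤p+q (0≤p*q (0≤fromℕ 2) (0≤fromℕ (suc E))) (0≤fromℕ 8))
      lem : ∀ x z → x + z - x ≡ z
      lem x z = solve 2 (λ x z → x :+ z :- x := z) refl x z
    B≤m : B ℕ.≤ m
    B≤m = Disconnected.m*m≤n*n⇒m≤n (ℕ.≤-trans n≥ (ℕ.≤-trans (ℕ.m≤m+n (2 ℕ.+ k) _) (4n≤m² (suc k) m ex 0≤x x≤L)))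
    6≤m : 6 ℕ.≤ m
    6≤m = ℕ.≤-trans (subst (6 ℕ.≤_) (sym B≡) (ℕ.≤-trans (ℕ.m≤m+n 6 66) (ℕ.m≤m*n 72 (suc E)))) B≤m

  -- Entry 0 of a sum of reals is the sum of the entries 1, so entry 1 of ω is the one that meets
  -- `L`. The term 1 is the tolerance 1/2 + 1/2 of the order on reals at that entry.
  Dominates : (ℕ → ℝ) → ℚ → Set
  Dominates ω K = ∃ λ N → ∀ n → N ℕ.≤ n → K ≤ seq (ω n) 1 + 1ℚ

  dominates : ∀ {ω} → TendsTo∞ ω → ∀ K → Dominates ω K
  dominates ω→∞ K with N , h ← ω→∞ (fromℚ K) = N , λ n N≤n → h n N≤n 1

  module _ {n m : ℕ} (2≤m : 2 ℕ.≤ m) {P : Pred (SimpleGraph n) 0ℓ} (P? : Decidable P) (d : ℕ) where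

    private
      Ω = assignments n m 2

    prob-near-one : suc d ℕ.* length (filter (λ F → ¬? (P? (intersectionGraph F))) Ω) ℕ.≤ (m C 2) ℕ.^ n →
                    ∣ ProbG n m 2 2≤m P? - 1ℚ ∣ ≤ inv d
    prob-near-one le = near-one _ _ (length Ω) {{assignments-nonZero n 2≤m}} d
      (length-filter-¬ (P? ∘ intersectionGraph) Ω)
      (ℕ.≤-trans le (ℕ.≤-reflexive (sym (length-assignments n m))))

    prob-¬-near-one : suc d ℕ.* length (filter (λ F → P? (intersectionGraph F)) Ω) ℕ.≤ (m C 2) ℕ.^ n →
                      ∣ ProbG n m 2 2≤m (λ G → ¬? (P? G)) - 1ℚ ∣ ≤ inv d
    prob-¬-near-one le = near-one _ _ (length Ω) {{assignments-nonZero n 2≤m}} d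
      (trans (ℕ.+-comm (length (filter (λ F → ¬? (P? (intersectionGraph F))) Ω)) _)
        (length-filter-¬ (P? ∘ intersectionGraph) Ω))
      (ℕ.≤-trans le (ℕ.≤-reflexive (sym (length-assignments n m))))

  module _ (m : ℕ → ℕ) (2≤m : ∀ n → 2 ℕ.≤ m n) (ω : ℕ → ℝ) (ω→∞ : TendsTo∞ ω) where

    private
      x : ℕ → ℚ
      x n = _/_ (ℤ.+ (4 ℕ.* n)) (m n) {{2≤⇒nonZero (2≤m n)}}

      0≤x : ∀ n → 0ℚ ≤ x n
      0≤x n = nonNegative⁻¹ (x n) {{normalize-nonNeg (4 ℕ.* n) (m n) {{2≤⇒nonZero (2≤m n)}}}}

      x*m : ∀ n → x n * fromℕ (m n) ≡ fromℕ 4 * fromℕ n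
      x*m n = trans (/-cancel (4 ℕ.* n) (m n) {{2≤⇒nonZero (2≤m n)}}) (fromℕ-* 4 n)

    connected-aas : (∀ n → .{{_ : NonZero n}} → fromℚ (x n) ≃ᴿ log n +ᴿ ω n) → AAS m 2 2≤m connected?
    connected-aas x≃ ε 0<ε = eventually (archimedes ε 0<ε)
      where
      -- The 3 is the tolerance 1 + 1 of the equality of reals at entry 0, plus the tolerance 1 in
      -- `Dominates`.
      lower : ∀ l x w K → - (x - (l + w)) ≤ inv 0 + inv 0 → fromℕ 3 + K ≤ w + 1ℚ → l + K ≤ x
      lower l x w K le le′ = ≤-by (0≤p+q (p≤q⇒0≤q-p le) (p≤q⇒0≤q-p le′)) (solve 4 (λ l x w K →
          x :- (l :+ K) :=
          con (inv 0) :+ con (inv 0) :- :- (x :- (l :+ w)) :+ (w :+ con 1ℚ :- (con (fromℕ 3) :+ K)))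
        refl l x w K)

      close : ∀ {d K N} → inv d < ε → K ≡ fromℕ 134 + fromℕ 128 * fromℕ (suc d) →
        (∀ n → N ℕ.≤ n → fromℕ 3 + K ≤ seq (ω n) 1 + 1ℚ) →
        ∀ n → suc N ℕ.≤ n → ∣ ProbG n (m n) 2 (2≤m n) connected? - 1ℚ ∣ < ε
      close {d} {K} inv<ε K≡ h n@(suc k) N<n = ≤-<-trans
        (prob-near-one (2≤m n) connected? d
          (supercritical k (m n) (suc d) K≡ (x*m n)
            (lower (L n) (x n) (seq (ω n) 1) K (≤-trans (-p≤∣p∣ _) (x≃ n 0)) (h n (ℕ.<⇒≤ N<n)))))
        inv<ε

      eventually : (∃ λ d → inv d < ε) →
        ∃ λ N → ∀ n → N ℕ.≤ n → ∣ ProbG n (m n) 2 (2≤m n) connected? - 1ℚ ∣ < ε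
      eventually (d , inv<ε) =
        let N , h = dominates {ω} ω→∞ (fromℕ 3 + (fromℕ 134 + fromℕ 128 * fromℕ (suc d)))
        in suc N , close {d} {_} {N} inv<ε refl h

    disconnected-aas : (∀ n → .{{_ : NonZero n}} → fromℚ (x n) ≃ᴿ log n -ᴿ ω n) →
                       AAS m 2 2≤m (λ G → ¬? (connected? G))
    disconnected-aas x≃ ε 0<ε = eventually (archimedes ε 0<ε)
      where
      upper : ∀ l x w K → x - (l - w) ≤ inv 0 + inv 0 → fromℕ 3 + K ≤ w + 1ℚ → x + K ≤ l
      upper l x w K le le′ = ≤-by (0≤p+q (p≤q⇒0≤q-p le) (p≤q⇒0≤q-p le′)) (solve 4 (λ l x w K →
          l :- (x :+ K) :=
          con (inv 0) :+ con (inv 0) :- (x :- (l :- w)) :+ (w :+ con 1ℚ :- (con (fromℕ 3) :+ K)))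
        refl l x w K)

      -- The threshold collects three demands on n: two nodes, so that an isolated one disconnects
      -- the graph; `N`, so that ω exceeds the gap; and B² to force B ≤ m.
      close : ∀ {d K B N} → inv d < ε → K ≡ fromℕ 2 * fromℕ (suc d) + fromℕ 8 → B ≡ 72 ℕ.* suc d →
        (∀ n → N ℕ.≤ n → fromℕ 3 + K ≤ seq (ω n) 1 + 1ℚ) →
        ∀ n → 2 ℕ.+ (N ℕ.+ B ℕ.* B) ℕ.≤ n → ∣ ProbG n (m n) 2 (2≤m n) (λ G → ¬? (connected? G)) - 1ℚ ∣ < ε
      close {d} {K} {B} {N} inv<ε K≡ B≡ h n@(suc (suc k)) N≤n = ≤-<-trans
        (prob-¬-near-one (2≤m n) connected? d
          (subcritical k (m n) d K≡ B≡ refl refl refl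
            (λ F → connected? (intersectionGraph F)) (λ _ conn → conn) (x*m n) (0≤x n)
            (upper (L n) (x n) (seq (ω n) 1) K (≤-trans (p≤∣p∣ _) (x≃ n 0))
              (h n (ℕ.≤-trans (ℕ.≤-trans (ℕ.m≤m+n N (B ℕ.* B)) (ℕ.m≤n+m _ 2)) N≤n)))
            (ℕ.≤-trans (ℕ.≤-trans (ℕ.m≤n+m (B ℕ.* B) N) (ℕ.m≤n+m _ 2)) N≤n)))
        inv<ε
      close inv<ε K≡ B≡ h (suc zero) (ℕ.s≤s ())

      eventually : (∃ λ d → inv d < ε) →
        ∃ λ N → ∀ n → N ℕ.≤ n → ∣ ProbG n (m n) 2 (2≤m n) (λ G → ¬? (connected? G)) - 1ℚ ∣ < ε
      eventually (d , inv<ε) =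
        let N , h = dominates {ω} ω→∞ (fromℕ 3 + (fromℕ 2 * fromℕ (suc d) + fromℕ 8))
            B     = 72 ℕ.* suc d
        in 2 ℕ.+ (N ℕ.+ B ℕ.* B) , close {d} {_} {B} {N} inv<ε refl refl h

open import Defs
open import Data.Integer.Base using (+_)
open import Data.Nat.Base using (ℕ; _*_; _≤_; NonZero)
open import Data.Product.Base using (_×_; _,_)
open import Data.Rational.Base using (_/_)
open import Relation.Nullary.Decidable using (¬?)

theorem3 :
  (m : ℕ → ℕ) (2≤m : ∀ n → 2 ≤ m n) →
  let 4n/m : ℕ → ℝ
      4n/m n = fromℚ (_/_ (+ (4 * n)) (m n) {{2≤⇒nonZero (2≤m n)}})
  in
  ((ω : ℕ → ℝ) → TendsTo∞ ω →
   (∀ n → .{{_ : NonZero n}} → 4n/m n ≃ᴿ log n +ᴿ ω n) →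
   AAS m 2 2≤m connected?)
  ×
  ((ω : ℕ → ℝ) → TendsTo∞ ω →
   (∀ n → .{{_ : NonZero n}} → 4n/m n ≃ᴿ log n -ᴿ ω n) →
   AAS m 2 2≤m (λ G → ¬? (connected? G)))
theorem3 m 2≤m = Limits.connected-aas m 2≤m , Limits.disconnected-aas m 2≤m
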